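{- For every nonnegative integer $n$ and every integer $k\geq 2$, \begin{align*} \overline{a}_5(20n+6) &\equiv 0 \pmod{10},\\ \overline{a}_5(20n+14) &\equiv 0 \pmod{10},\\ 4\overline{a}_5(5^{k}n) &\equiv 5\overline{a}_5(n) - \overline{a}_5(5n) \pmod{5^k}. \end{align*}
   Context: For $j\ge1$ let $f_j:=\prod_{k\ge 1}(1-q^{jk})$ (for $|q|<1$, or as a formal power series). Let $\varphi(-q):=\sum_{n=-\infty}^{\infty}(-1)^n q^{n^2}=f_1^2/f_2$, so that $\varphi(-q^5)=f_5^2/f_{10}$. The integers $\overline{a}_5(n)$ are defined by $$\sum_{n=0}^\infty \overline{a}_5(n)q^n=\frac{\varphi^5(-q^5)}{\varphi(-q)}=1+2q+4q^2+8q^3+14q^4+14q^5+20q^6+24q^7+\cdots .$$ -}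

module Defs where

open import Data.Bool.Base using (if_then_else_)
open import Data.Fin.Base using (toℕ)
open import Data.Integer.Base as ℤ using (ℤ; +_; _⊖_; ∣_∣; 0ℤ; 1ℤ; -1ℤ)
open import Data.Integer.Divisibility.Signed as ℤ using ()
open import Data.Integer.Properties as ℤ using ()
open import Data.Integer.Tactic.RingSolver using (solve-∀)
open import Data.List.Base using (_∷_; []; applyUpTo)
open import Data.Nat.Base as ℕ using (ℕ; zero; suc; NonZero)
open import Data.Nat.Divisibility using (_∣?_)
open import Data.Nat.DivMod using (_/_)
open import Relation.Binary.PropositionalEquality
open import Relation.Nullary.Decidable.Core using (does)

open import Algebra.Properties.Monoid.Sum ℤ.+-0-monoid using (sum-syntax)

infix 4 _≡_[mod_]

_≡_[mod_] : ℤ → ℤ → ℕ → Set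
a ≡ b [mod m ] = + m ℤ.∣ a ℤ.- b

-- Formal power series over ℤ, as coefficient sequences.
Series : Set
Series = ℕ → ℤ

infixl 7 _⊛_ _⊘_
infixr 8 _^ˢ_

1ˢ : Series
1ˢ zero    = 1ℤ
1ˢ (suc _) = 0ℤ

_⊛_ : Series → Series → Series
(f ⊛ g) n = ∑[ i < suc n ] (f (toℕ i) ℤ.* g (n ℕ.∸ toℕ i))

_^ˢ_ : Series → ℕ → Series
f ^ˢ zero  = 1ˢ
f ^ˢ suc k = f ⊛ f ^ˢ k

-- f(q) ↦ f(q^j)
dilate : (j : ℕ) .{{_ : NonZero j}} → Series → Series
dilate j f n = if does (j ∣? n) then f (n / j) else 0ℤ

-- Long division: f/g = f(0) + q · ((f − f(0) g)/q) / g.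
-- This is the quotient only when g has constant term 1; see ⊘-⊛.
_⊘_ : Series → Series → Series
(f ⊘ g) zero    = f 0
(f ⊘ g) (suc n) = ((λ m → f (suc m) ℤ.- f 0 ℤ.* g (suc m)) ⊘ g) n

⊘-⊛ : ∀ f g → g 0 ≡ 1ℤ → (f ⊘ g) ⊛ g ≗ f
⊘-⊛ f g g₀≡1 zero = begin
  f 0 ℤ.* g 0 ℤ.+ 0ℤ ≡⟨ ℤ.+-identityʳ _ ⟩
  f 0 ℤ.* g 0        ≡⟨ cong (f 0 ℤ.*_) g₀≡1 ⟩
  f 0 ℤ.* 1ℤ         ≡⟨ ℤ.*-identityʳ _ ⟩
  f 0                ∎
  where open ≡-Reasoning
⊘-⊛ f g g₀≡1 (suc n) = begin
  f 0 ℤ.* g (suc n) ℤ.+ ((f′ ⊘ g) ⊛ g) n ≡⟨ cong (λ x → f 0 ℤ.* g (suc n) ℤ.+ x) (⊘-⊛ f′ g g₀≡1 n) ⟩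
  f 0 ℤ.* g (suc n) ℤ.+ f′ n             ≡⟨ cancel (f 0 ℤ.* g (suc n)) (f (suc n)) ⟩
  f (suc n)                              ∎
  where
  open ≡-Reasoning
  f′ : Series
  f′ m = f (suc m) ℤ.- f 0 ℤ.* g (suc m)
  cancel : ∀ x y → x ℤ.+ (y ℤ.- x) ≡ y
  cancel = solve-∀

-- φ(−q) = ∑_{m ∈ ℤ} (−1)^m q^(m²).  Since |m| ≤ m², the coefficient of q^n
-- only involves m = i − n with 0 ≤ i ≤ 2n.
φ[-q] : Series
φ[-q] n = ∑[ i < suc (2 ℕ.* n) ] term (toℕ i ⊖ n)
  where
  term : ℤ → ℤ
  term m = if does (m ℤ.* m ℤ.≟ + n) then -1ℤ ℤ.^ ∣ m ∣ else 0ℤ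

φ[-q⁵] : Series
φ[-q⁵] = dilate 5 φ[-q]

ā₅ : ℕ → ℤ
ā₅ = φ[-q⁵] ^ˢ 5 ⊘ φ[-q]

ā₅-spec : ā₅ ⊛ φ[-q] ≗ φ[-q⁵] ^ˢ 5
ā₅-spec = ⊘-⊛ (φ[-q⁵] ^ˢ 5) φ[-q] refl

ā₅-initial : applyUpTo ā₅ 8 ≡
  + 1 ∷ + 2 ∷ + 4 ∷ + 8 ∷ + 14 ∷ + 14 ∷ + 20 ∷ + 24 ∷ []
ā₅-initial = refl

{-# OPTIONS --safe #-}

-- Let φ = φ(−q), φ₅ = φ(−q⁵) and (U f)(n) = f(5n).  Split φ = a + u + v by exponents 0, 1, 4
-- modulo 5.  The product of φ(−ζq) over the fifth roots of unity ζ is a polynomial in a, uv and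
-- u⁵ + v⁵.  Multiplication by 2 ± i in ℤ[i] gives r₂(5n) = 2 r₂(n) − r₂(n/5), which determines uv;
-- the product itself is φ(−q⁵)⁶ / φ(−q²⁵), because both sides have the same logarithmic
-- derivative: that of φ is a divisor sum, on which U acts by a Hecke relation.  It follows that
-- U ā₅ = 5 ā₅ − 5 φ₅³ φ + φ₅ φ³ and then U² ā₅ = 6 U ā₅ − 5 ā₅, so that
-- 4 ā₅(5ᵏn) = 5 ā₅(n) − ā₅(5n) + 5ᵏ (ā₅(5n) − ā₅(n)).
--
-- Modulo 2, φ ≡ 1.  Modulo 5, ā₅ ≡ φ²⁴ = X⁶ with X = φ(−q)⁴; put Y = φ(q)⁴.  The doubling formulas
-- for φ show that E = X² − XY + Y² satisfies E(q) ≡ E(q²), hence E ≡ 1.  Therefore, for odd m,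
-- the coefficient of X⁶ at 2m is minus that of X² + X⁶ at m, which is that of 2 X⁴; and
-- X⁴ = φ¹⁶ ≡ φ₅³ φ has no terms with exponent ±2 modulo 5, as φ is supported on squares.

module Submission where

open import Defs
open import Defs using () renaming (φ[-q] to φ; φ[-q⁵] to φ₅)
open import Algebra.Bundles using (CommutativeRing)
import Algebra.Solver.Ring
open import Algebra.Solver.Ring.AlmostCommutativeRing using (fromCommutativeRing; _-Raw-AlmostCommutative⟶_)
open import Data.Bool.Base using (if_then_else_)
open import Data.Empty using (⊥-elim)
open import Data.Fin.Base using (toℕ)
open import Data.Integer.Base as ℤ using (ℤ; +_; -[1+_]; +[1+_]; _⊖_; ∣_∣; 0ℤ; 1ℤ; -1ℤ)
open import Data.Integer.DivMod using (_%ℕ_; _/ℕ_; a≡a%ℕn+[a/ℕn]*n; n%ℕd<d)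
open import Data.Integer.Divisibility.Signed as ℤ using (divides)
open import Data.Integer.Properties as ℤ using ()
open import Data.Integer.Tactic.RingSolver using (solve-∀)
open import Data.List.Base using (List; []; _∷_; _++_; map; filter; upTo; applyUpTo)
open import Data.List.Membership.Propositional using (_∈_)
open import Data.List.Membership.Propositional.Properties
open import Data.List.Membership.Propositional.Properties.WithK using (unique∧set⇒bag)
open import Data.List.Relation.Binary.BagAndSetEquality using (∼bag⇒↭)
open import Data.List.Relation.Binary.Permutation.Propositional as ↭ using (_↭_)
import Data.List.Relation.Unary.All as All
import Data.List.Relation.Unary.All.Properties as All
open import Data.List.Relation.Unary.AllPairs using ([]; _∷_)
open import Data.List.Relation.Unary.Any using (here; there)
open import Data.List.Relation.Unary.Unique.Propositional using (Unique)
import Data.List.Relation.Unary.Unique.Propositional.Properties as Unique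
open import Data.Maybe.Base as Maybe using (Maybe)
open import Data.Nat.Base as ℕ using (ℕ; zero; suc; NonZero; ⌊_/2⌋; _+_; _*_; _^_; _≤_)
open import Data.Nat.Divisibility using (_∣_; _∣?_; divides; m∣m*n; ∣-refl; n∣m⇒m%n≡0; m%n≡0⇒n∣m; ∣m∣n⇒∣m+n)
import Data.Nat.Divisibility as ℕ using (_∣_; divides; m∣m*n)
open import Data.Nat.DivMod using (_/_; _%_; m*n/n≡m; %-distribˡ-+; %-distribˡ-*; m%n<n; m%n%n≡m%n;
  m≡m%n+[m/n]*n; [m+kn]%n≡m%n; m∣n⇒o%n%m≡o%m)
open import Data.Nat.Induction using (<-rec)
open import Data.Nat.Primality using (Prime; prime?; euclidsLemma)
import Data.Nat.Properties as ℕ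
import Data.Nat.Tactic.RingSolver as ℕ using (solve-∀)
open import Data.Product.Base using (∃; _×_; _,_; proj₁; proj₂)
open import Data.Sum.Base using (_⊎_; inj₁; inj₂; [_,_]′)
open import Function.Base using (_∘_; id)
open import Function.Bundles using (mk⇔)
open import Level using (0ℓ)
open import Relation.Binary.Bundles using (Setoid)
open import Relation.Binary.Definitions using (tri<; tri≈; tri>)
open import Relation.Binary.PropositionalEquality
open import Relation.Binary.Structures using (IsEquivalence)
open import Relation.Nullary using (¬_; Dec; yes; no; contradiction)
open import Relation.Nullary.Decidable using (¬?; _×-dec_; does; dec-true; dec-false; dec⇒maybe; from-yes)
open import Algebra.Properties.Monoid.Sum ℤ.+-0-monoid using (sum-syntax)

-- Finite sums over enumerated sets

-- Here φ is a theta series, not a product, so its logarithmic derivative must be found without a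
-- product expansion. Liouville's elementary method does this: it shows directly that φ times a
-- divisor sum has coefficients supported on squares.
--
-- Dividing by φ obstructs U, which is linear only over series in q⁵. Writing 1/φ as cofactor/norm
-- moves the denominator into q⁵, where it passes through U; this is why the norm must be known
-- exactly. No root of unity is needed: norm and cofactor are explicit polynomials in the three
-- parts of φ, and the logarithmic derivative of the norm follows from the principle that the
-- derivative of a norm is a trace. On exponents, the trace is five times the part divisible by 5.
--
-- Every quotient is cleared before an identity is proved. Cancellation is then allowed because the
-- factors removed have constant term 1, hence integral inverses.
--
-- Bijections carry the arithmetic input: multiplication by Gaussian integers, scaling of divisors,
-- and Liouville's transformations of triples. Each preserves a quadratic form, so integer points
-- are summed over lists whose order is irrelevant.

private variable
  A B I : Set
  P Q R : A → Set

-- A finite set is a duplicate-free list of bare elements. Proofs of `P` stay outside the list, so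
-- elements can be compared by plain equality and a sum depends on `P` alone.
record Enum {A : Set} (P : A → Set) : Set where
  field
    list     : List A
    unique   : Unique list
    sound    : ∀ {a} → a ∈ list → P a
    complete : ∀ {a} → P a → a ∈ list

sumOver : (A → ℤ) → List A → ℤ
sumOver w []       = 0ℤ
sumOver w (x ∷ xs) = w x ℤ.+ sumOver w xs

sumOver-cong : {w v : A → ℤ} (xs : List A) → (∀ {a} → a ∈ xs → w a ≡ v a) → sumOver w xs ≡ sumOver v xs
sumOver-cong []       eq = refl
sumOver-cong (x ∷ xs) eq = cong₂ ℤ._+_ (eq (here refl)) (sumOver-cong xs (eq ∘ there))

sumOver-map : (w : B → ℤ) (f : A → B) (xs : List A) → sumOver w (map f xs) ≡ sumOver (w ∘ f) xs
sumOver-map w f []       = refl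
sumOver-map w f (x ∷ xs) = cong (ℤ._+_ (w (f x))) (sumOver-map w f xs)

sumOver-++ : (w : A → ℤ) (xs ys : List A) → sumOver w (xs ++ ys) ≡ sumOver w xs ℤ.+ sumOver w ys
sumOver-++ w []       ys = sym (ℤ.+-identityˡ _)
sumOver-++ w (x ∷ xs) ys = trans (cong (ℤ._+_ (w x)) (sumOver-++ w xs ys)) (sym (ℤ.+-assoc (w x) _ _))

sumOver-↭ : (w : A → ℤ) {xs ys : List A} → xs ↭ ys → sumOver w xs ≡ sumOver w ys
sumOver-↭ w ↭.refl          = refl
sumOver-↭ w (↭.prep x p)    = cong (ℤ._+_ (w x)) (sumOver-↭ w p)
sumOver-↭ w (↭.swap x y p)  = trans (cong (λ s → w x ℤ.+ (w y ℤ.+ s)) (sumOver-↭ w p))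
  (exchange (w x) (w y) _)
  where
  exchange : ∀ a b c → a ℤ.+ (b ℤ.+ c) ≡ b ℤ.+ (a ℤ.+ c)
  exchange = solve-∀
sumOver-↭ w (↭.trans p q)   = trans (sumOver-↭ w p) (sumOver-↭ w q)

map-unique : {f : A → B} {xs : List A} →
  (∀ {a b} → a ∈ xs → b ∈ xs → f a ≡ f b → a ≡ b) → Unique xs → Unique (map f xs)
map-unique {xs = []}     inj []       = []
map-unique {xs = x ∷ xs} inj (x≢ ∷ u) =
  All.map⁺ (All.tabulate λ a∈ fx≡fa → All.lookup x≢ a∈ (inj (here refl) (there a∈) fx≡fa))
  ∷ map-unique (λ a∈ b∈ → inj (there a∈) (there b∈)) u

open Enum

∑ᴱ : {P : A → Set} → Enum P → (A → ℤ) → ℤ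
∑ᴱ E w = sumOver w (list E)

∑ᴱ-cong : (E : Enum P) {w v : A → ℤ} → (∀ a → P a → w a ≡ v a) → ∑ᴱ E w ≡ ∑ᴱ E v
∑ᴱ-cong E eq = sumOver-cong (list E) (λ a∈ → eq _ (sound E a∈))

-- Two duplicate-free lists with the same members are permutations of each other. It therefore
-- suffices that `f` and `g` are mutually inverse on `P` and `Q`; outside these sets they may do
-- anything.
reindex : (E : Enum P) (F : Enum Q) (f : A → B) (g : B → A) {w : A → ℤ} {v : B → ℤ} →
  (∀ a → P a → Q (f a)) → (∀ b → Q b → P (g b)) →
  (∀ a → P a → g (f a) ≡ a) → (∀ b → Q b → f (g b) ≡ b) →
  (∀ a → P a → w a ≡ v (f a)) → ∑ᴱ E w ≡ ∑ᴱ F v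
reindex E F f g {w} {v} fP gQ gf fg wv = begin
  sumOver w (list E)
    ≡⟨ sumOver-↭ w (∼bag⇒↭ (unique∧set⇒bag (unique E) (map-unique g-inj (unique F)) (mk⇔ to from))) ⟩
  sumOver w (map g (list F)) ≡⟨ sumOver-map w g (list F) ⟩
  sumOver (w ∘ g) (list F)   ≡⟨ ∑ᴱ-cong F (λ b q → trans (wv (g b) (gQ b q)) (cong v (fg b q))) ⟩
  sumOver v (list F)         ∎
  where
  open ≡-Reasoning
  g-inj : ∀ {a b} → a ∈ list F → b ∈ list F → g a ≡ g b → a ≡ b
  g-inj a∈ b∈ eq = trans (sym (fg _ (sound F a∈))) (trans (cong f eq) (fg _ (sound F b∈)))
  to : ∀ {a} → a ∈ list E → a ∈ map g (list F)
  to a∈ = let p = sound E a∈ in subst (_∈ _) (gf _ p) (∈-map⁺ g (complete F (fP _ p)))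
  from : ∀ {a} → a ∈ map g (list F) → a ∈ list E
  from a∈ with b , b∈ , refl ← ∈-map⁻ g a∈ = complete E (gQ b (sound F b∈))

same : (E : Enum P) (F : Enum Q) {w : A → ℤ} → (∀ a → P a → Q a) → (∀ a → Q a → P a) → ∑ᴱ E w ≡ ∑ᴱ F w
same E F to from = reindex E F id id to from (λ _ _ → refl) (λ _ _ → refl) (λ _ _ → refl)

∑ᴱ-+ : (E : Enum P) (w v : A → ℤ) → ∑ᴱ E (λ a → w a ℤ.+ v a) ≡ ∑ᴱ E w ℤ.+ ∑ᴱ E v
∑ᴱ-+ E w v = go (list E)
  where
  interchange : ∀ a b c d → (a ℤ.+ b) ℤ.+ (c ℤ.+ d) ≡ (a ℤ.+ c) ℤ.+ (b ℤ.+ d)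
  interchange = solve-∀
  go : ∀ xs → sumOver (λ a → w a ℤ.+ v a) xs ≡ sumOver w xs ℤ.+ sumOver v xs
  go []       = refl
  go (x ∷ xs) = trans (cong (ℤ._+_ (w x ℤ.+ v x)) (go xs)) (interchange (w x) (v x) _ _)

∑ᴱ-* : (E : Enum P) (c : ℤ) (w : A → ℤ) → ∑ᴱ E (λ a → c ℤ.* w a) ≡ c ℤ.* ∑ᴱ E w
∑ᴱ-* E c w = go (list E)
  where
  go : ∀ xs → sumOver (λ a → c ℤ.* w a) xs ≡ c ℤ.* sumOver w xs
  go []       = sym (ℤ.*-zeroʳ c)
  go (x ∷ xs) = trans (cong (ℤ._+_ (c ℤ.* w x)) (go xs)) (sym (ℤ.*-distribˡ-+ c (w x) _))

∑ᴱ-*ʳ : (E : Enum P) (c : ℤ) (w : A → ℤ) → ∑ᴱ E (λ a → w a ℤ.* c) ≡ ∑ᴱ E w ℤ.* c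
∑ᴱ-*ʳ E c w = trans (∑ᴱ-cong E (λ a _ → ℤ.*-comm (w a) c)) (trans (∑ᴱ-* E c w) (ℤ.*-comm c _))

∑ᴱ-neg : (E : Enum P) (w : A → ℤ) → ∑ᴱ E (λ a → ℤ.- w a) ≡ ℤ.- ∑ᴱ E w
∑ᴱ-neg E w = trans (∑ᴱ-cong E (λ a _ → sym (ℤ.-1*i≡-i (w a)))) (trans (∑ᴱ-* E -1ℤ w) (ℤ.-1*i≡-i _))

∑ᴱ-zero : (E : Enum P) {w : A → ℤ} → (∀ a → P a → w a ≡ 0ℤ) → ∑ᴱ E w ≡ 0ℤ
∑ᴱ-zero E {w} eq = trans (∑ᴱ-cong E eq) (∑ᴱ-* E 0ℤ w)

∑ᴱ-const : (E : Enum P) (c : ℤ) → ∑ᴱ E (λ _ → c) ≡ ∑ᴱ E (λ _ → 1ℤ) ℤ.* c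
∑ᴱ-const E c = trans (∑ᴱ-cong E (λ _ _ → sym (ℤ.*-identityˡ c))) (∑ᴱ-*ʳ E c (λ _ → 1ℤ))

∑ᴱ-empty : (E : Enum P) {w : A → ℤ} → (∀ a → ¬ P a) → ∑ᴱ E w ≡ 0ℤ
∑ᴱ-empty E ¬P = ∑ᴱ-zero E (λ a p → ⊥-elim (¬P a p))

infixl 6 _∩_

_∩_ : Enum P → (∀ a → Dec (Q a)) → Enum (λ a → P a × Q a)
E ∩ Q? = record
  { list     = filter Q? (list E)
  ; unique   = Unique.filter⁺ Q? (unique E)
  ; sound    = λ a∈ → let a∈E , q = ∈-filter⁻ Q? a∈ in sound E a∈E , q
  ; complete = λ (p , q) → ∈-filter⁺ Q? (complete E p) q
  }

∑ᴱ-split : (E : Enum P) (Q? : ∀ a → Dec (Q a)) (w : A → ℤ) →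
  ∑ᴱ E w ≡ ∑ᴱ (E ∩ Q?) w ℤ.+ ∑ᴱ (E ∩ (λ a → ¬? (Q? a))) w
∑ᴱ-split E Q? w = go (list E)
  where
  exchange : ∀ a b c → a ℤ.+ (b ℤ.+ c) ≡ b ℤ.+ (a ℤ.+ c)
  exchange = solve-∀
  go : ∀ xs → sumOver w xs ≡ sumOver w (filter Q? xs) ℤ.+ sumOver w (filter (λ a → ¬? (Q? a)) xs)
  go [] = refl
  go (x ∷ xs) with Q? x
  ... | yes _ = trans (cong (ℤ._+_ (w x)) (go xs)) (sym (ℤ.+-assoc (w x) _ _))
  ... | no _  = trans (cong (ℤ._+_ (w x)) (go xs)) (exchange (w x) (sumOver w (filter Q? xs))
    (sumOver w (filter (λ a → ¬? (Q? a)) xs)))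

module _ {Q : I → A → Set} (F : ∀ i → Enum (Q i)) where

  tagged : List I → List (I × A)
  tagged []       = []
  tagged (i ∷ is) = map (i ,_) (list (F i)) ++ tagged is

  tagged⁺ : ∀ {is i a} → i ∈ is → a ∈ list (F i) → (i , a) ∈ tagged is
  tagged⁺ (here refl)         a∈ = ∈-++⁺ˡ (∈-map⁺ _ a∈)
  tagged⁺ {j ∷ is} (there i∈) a∈ = ∈-++⁺ʳ (map (j ,_) (list (F j))) (tagged⁺ i∈ a∈)

  tagged⁻ : ∀ is {i a} → (i , a) ∈ tagged is → i ∈ is × a ∈ list (F i)
  tagged⁻ (i ∷ is) p with ∈-++⁻ (map (i ,_) (list (F i))) p
  ... | inj₁ q with a , a∈ , refl ← ∈-map⁻ (i ,_) q = here refl , a∈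
  ... | inj₂ q = let i∈ , a∈ = tagged⁻ is q in there i∈ , a∈

  tagged-unique : ∀ {is} → Unique is → Unique (tagged is)
  tagged-unique [] = []
  tagged-unique {i ∷ is} (i∉ ∷ u) =
    Unique.++⁺ (map-unique (λ { _ _ refl → refl }) (unique (F i))) (tagged-unique u) disjoint
    where
    disjoint : ∀ {ia} → ¬ (ia ∈ map (i ,_) (list (F i)) × ia ∈ tagged is)
    disjoint (p , q) with a , a∈ , refl ← ∈-map⁻ (i ,_) p = All.lookup i∉ (proj₁ (tagged⁻ is q)) refl

infixr 5 _⋉_

_⋉_ : {Q : I → A → Set} → Enum P → (∀ i → Enum (Q i)) → Enum (λ ia → P (proj₁ ia) × Q (proj₁ ia) (proj₂ ia))
E ⋉ F = record
  { list     = tagged F (list E)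
  ; unique   = tagged-unique F (unique E)
  ; sound    = λ p → let i∈ , a∈ = tagged⁻ F (list E) p in sound E i∈ , sound (F _) a∈
  ; complete = λ (p , q) → tagged⁺ F (complete E p) (complete (F _) q)
  }

∑ᴱ-⋉ : {Q : I → A → Set} (E : Enum P) (F : ∀ i → Enum (Q i)) (w : I × A → ℤ) →
  ∑ᴱ (E ⋉ F) w ≡ ∑ᴱ E (λ i → ∑ᴱ (F i) (λ a → w (i , a)))
∑ᴱ-⋉ E F w = go (list E)
  where
  go : ∀ is → sumOver w (tagged F is) ≡ sumOver (λ i → ∑ᴱ (F i) (λ a → w (i , a))) is
  go []       = refl
  go (i ∷ is) = trans (sumOver-++ w (map (i ,_) (list (F i))) (tagged F is))
    (cong₂ ℤ._+_ (sumOver-map w (i ,_) (list (F i))) (go is))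

carve : Enum P → (∀ a → Dec (Q a)) → (∀ a → Q a → P a) → Enum Q
carve E Q? Q⊆P = record
  { list     = list (E ∩ Q?)
  ; unique   = unique (E ∩ Q?)
  ; sound    = proj₂ ∘ sound (E ∩ Q?)
  ; complete = λ q → complete (E ∩ Q?) (Q⊆P _ q , q)
  }

below : ∀ n → Enum (ℕ._< n)
below n = record
  { list = upTo n ; unique = Unique.upTo⁺ n ; sound = ∈-upTo⁻ ; complete = ∈-upTo⁺ }

∑-below : ∀ n (w : ℕ → ℤ) → ∑[ i < n ] w (toℕ i) ≡ ∑ᴱ (below n) w
∑-below n w = go n id
  where
  go : ∀ n (f : ℕ → ℕ) → ∑[ i < n ] w (f (toℕ i)) ≡ sumOver w (applyUpTo f n)
  go zero    f = refl
  go (suc n) f = cong (ℤ._+_ (w (f 0))) (go n (f ∘ suc))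

-- The ring of formal power series

infixl 6 _⊞_ _⊟_
infix 8 ⊝_

0ˢ : Series
0ˢ _ = 0ℤ

_⊞_ : Series → Series → Series
(f ⊞ g) n = f n ℤ.+ g n

⊝_ : Series → Series
(⊝ f) n = ℤ.- f n

_⊟_ : Series → Series → Series
f ⊟ g = f ⊞ ⊝ g

κ : ℤ → Series
κ c zero    = c
κ c (suc _) = 0ℤ

-- By the recursion of finite sums, `(f ⊛ g) (suc n)` is definitionally
-- `f 0 * g (suc n) + (shift f ⊛ g) n`. The ring laws are proved by induction on the coefficient,
-- peeling the left factor.
shift : Series → Series
shift f n = f (suc n)

⊛-cong : ∀ {f f′ g g′} → f ≗ f′ → g ≗ g′ → f ⊛ g ≗ f′ ⊛ g′
⊛-cong p q zero    = cong₂ (λ a b → a ℤ.* b ℤ.+ 0ℤ) (p 0) (q 0)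
⊛-cong p q (suc n) = cong₂ ℤ._+_ (cong₂ ℤ._*_ (p 0) (q (suc n))) (⊛-cong (p ∘ suc) q n)

⊛-zeroˡ : ∀ g → 0ˢ ⊛ g ≗ 0ˢ
⊛-zeroˡ g zero    = refl
⊛-zeroˡ g (suc n) = trans (ℤ.+-identityˡ _) (⊛-zeroˡ g n)

κ-⊛ : ∀ c g n → (κ c ⊛ g) n ≡ c ℤ.* g n
κ-⊛ c g zero    = ℤ.+-identityʳ _
κ-⊛ c g (suc n) = trans (cong (ℤ._+_ (c ℤ.* g (suc n))) (⊛-zeroˡ g n)) (ℤ.+-identityʳ _)

⊛-distribʳ : ∀ h f g → (f ⊞ g) ⊛ h ≗ f ⊛ h ⊞ g ⊛ h
⊛-distribʳ h f g zero = lemma (f 0) (g 0) (h 0)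
  where
  lemma : ∀ a b c → (a ℤ.+ b) ℤ.* c ℤ.+ 0ℤ ≡ (a ℤ.* c ℤ.+ 0ℤ) ℤ.+ (b ℤ.* c ℤ.+ 0ℤ)
  lemma = solve-∀
⊛-distribʳ h f g (suc n) =
  trans (cong (ℤ._+_ ((f 0 ℤ.+ g 0) ℤ.* h (suc n))) (⊛-distribʳ h (shift f) (shift g) n))
  (lemma (f 0) (g 0) (h (suc n)) ((shift f ⊛ h) n) ((shift g ⊛ h) n))
  where
  lemma : ∀ a b c x y → (a ℤ.+ b) ℤ.* c ℤ.+ (x ℤ.+ y) ≡ (a ℤ.* c ℤ.+ x) ℤ.+ (b ℤ.* c ℤ.+ y)
  lemma = solve-∀

-- The mirror image of the definitional recursion: it peels the right factor, which is what
-- commutativity needs.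
⊛-suc : ∀ f g n → (f ⊛ g) (suc n) ≡ (f ⊛ shift g) n ℤ.+ f (suc n) ℤ.* g 0
⊛-suc f g zero = lemma (f 0 ℤ.* g 1) (f 1 ℤ.* g 0)
  where
  lemma : ∀ a b → a ℤ.+ (b ℤ.+ 0ℤ) ≡ (a ℤ.+ 0ℤ) ℤ.+ b
  lemma = solve-∀
⊛-suc f g (suc n) = trans (cong (ℤ._+_ (f 0 ℤ.* g (suc (suc n)))) (⊛-suc (shift f) g n))
  (sym (ℤ.+-assoc (f 0 ℤ.* g (suc (suc n))) ((shift f ⊛ shift g) n) (f (suc (suc n)) ℤ.* g 0)))

⊛-comm : ∀ f g → f ⊛ g ≗ g ⊛ f
⊛-comm f g zero    = cong (ℤ._+ 0ℤ) (ℤ.*-comm (f 0) (g 0))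
⊛-comm f g (suc n) = begin
  f 0 ℤ.* g (suc n) ℤ.+ (shift f ⊛ g) n ≡⟨ cong₂ ℤ._+_ (ℤ.*-comm (f 0) _) (⊛-comm (shift f) g n) ⟩
  g (suc n) ℤ.* f 0 ℤ.+ (g ⊛ shift f) n ≡⟨ ℤ.+-comm (g (suc n) ℤ.* f 0) _ ⟩
  (g ⊛ shift f) n ℤ.+ g (suc n) ℤ.* f 0 ≡⟨ ⊛-suc g f n ⟨
  (g ⊛ f) (suc n)                       ∎
  where open ≡-Reasoning

⊛-scaleˡ : ∀ c f g n → ((λ m → c ℤ.* f m) ⊛ g) n ≡ c ℤ.* (f ⊛ g) n
⊛-scaleˡ c f g zero = lemma c (f 0) (g 0)
  where
  lemma : ∀ c a b → (c ℤ.* a) ℤ.* b ℤ.+ 0ℤ ≡ c ℤ.* (a ℤ.* b ℤ.+ 0ℤ)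
  lemma = solve-∀
⊛-scaleˡ c f g (suc n) = trans (cong (ℤ._+_ ((c ℤ.* f 0) ℤ.* g (suc n))) (⊛-scaleˡ c (shift f) g n))
  (lemma c (f 0) (g (suc n)) ((shift f ⊛ g) n))
  where
  lemma : ∀ c a b x → (c ℤ.* a) ℤ.* b ℤ.+ c ℤ.* x ≡ c ℤ.* (a ℤ.* b ℤ.+ x)
  lemma = solve-∀

⊛-assoc : ∀ f g h → (f ⊛ g) ⊛ h ≗ f ⊛ (g ⊛ h)
⊛-assoc f g h zero = lemma (f 0) (g 0) (h 0)
  where
  lemma : ∀ a b c → (a ℤ.* b ℤ.+ 0ℤ) ℤ.* c ℤ.+ 0ℤ ≡ a ℤ.* (b ℤ.* c ℤ.+ 0ℤ) ℤ.+ 0ℤ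
  lemma = solve-∀
⊛-assoc f g h (suc n) = begin
  (f 0 ℤ.* g 0 ℤ.+ 0ℤ) ℤ.* h (suc n) ℤ.+ (((λ m → f 0 ℤ.* g (suc m)) ⊞ shift f ⊛ g) ⊛ h) n
    ≡⟨ cong (ℤ._+_ ((f 0 ℤ.* g 0 ℤ.+ 0ℤ) ℤ.* h (suc n)))
      (⊛-distribʳ h (λ m → f 0 ℤ.* g (suc m)) (shift f ⊛ g) n) ⟩
  (f 0 ℤ.* g 0 ℤ.+ 0ℤ) ℤ.* h (suc n) ℤ.+ (((λ m → f 0 ℤ.* g (suc m)) ⊛ h) n ℤ.+ ((shift f ⊛ g) ⊛ h) n)
    ≡⟨ cong₂ (λ x y → (f 0 ℤ.* g 0 ℤ.+ 0ℤ) ℤ.* h (suc n) ℤ.+ (x ℤ.+ y)) (⊛-scaleˡ (f 0) (shift g) h n)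
      (⊛-assoc (shift f) g h n) ⟩
  (f 0 ℤ.* g 0 ℤ.+ 0ℤ) ℤ.* h (suc n) ℤ.+ (f 0 ℤ.* (shift g ⊛ h) n ℤ.+ (shift f ⊛ (g ⊛ h)) n)
    ≡⟨ lemma (f 0) (g 0) (h (suc n)) ((shift g ⊛ h) n) ((shift f ⊛ (g ⊛ h)) n) ⟩
  f 0 ℤ.* (g 0 ℤ.* h (suc n) ℤ.+ (shift g ⊛ h) n) ℤ.+ (shift f ⊛ (g ⊛ h)) n ∎
  where
  open ≡-Reasoning
  lemma : ∀ a b c x y → (a ℤ.* b ℤ.+ 0ℤ) ℤ.* c ℤ.+ (a ℤ.* x ℤ.+ y) ≡ a ℤ.* (b ℤ.* c ℤ.+ x) ℤ.+ y
  lemma = solve-∀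

⊛-identityˡ : ∀ f → 1ˢ ⊛ f ≗ f
⊛-identityˡ f zero    = trans (ℤ.+-identityʳ _) (ℤ.*-identityˡ (f 0))
⊛-identityˡ f (suc n) = trans (cong₂ ℤ._+_ (ℤ.*-identityˡ (f (suc n))) (⊛-zeroˡ f n)) (ℤ.+-identityʳ _)

-- A record, so that unification compares series instead of unfolding their coefficients.
infix 4 _≈_
record _≈_ (f g : Series) : Set where
  constructor coefficientwise
  field at : f ≗ g
open _≈_

-- Multiplication is made opaque so that the type checker compares products of series
-- by their factors instead of by their coefficients.
opaque

  infixl 7 _·_

  _·_ : Series → Series → Series
  _·_ = _⊛_

  ·-⊛ : ∀ f g → f · g ≗ f ⊛ g
  ·-⊛ f g n = refl

  ·-cong : ∀ {f f′ g g′} → f ≗ f′ → g ≗ g′ → f · g ≗ f′ · g′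
  ·-cong = ⊛-cong

  ·-zeroˡ : ∀ g → 0ˢ · g ≗ 0ˢ
  ·-zeroˡ = ⊛-zeroˡ

  κ-· : ∀ c g n → (κ c · g) n ≡ c ℤ.* g n
  κ-· = κ-⊛

  ·-distribʳ : ∀ h f g → (f ⊞ g) · h ≗ f · h ⊞ g · h
  ·-distribʳ = ⊛-distribʳ

  ·-comm : ∀ f g → f · g ≗ g · f
  ·-comm = ⊛-comm

  ·-assoc : ∀ f g h → (f · g) · h ≗ f · (g · h)
  ·-assoc = ⊛-assoc

  ·-identityˡ : ∀ f → 1ˢ · f ≗ f
  ·-identityˡ = ⊛-identityˡ

≈-isEquivalence : IsEquivalence _≈_
≈-isEquivalence = record
  { refl  = coefficientwise λ _ → refl
  ; sym   = λ p → coefficientwise λ n → sym (at p n)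
  ; trans = λ p q → coefficientwise λ n → trans (at p n) (at q n)
  }

seriesSetoid : Setoid 0ℓ 0ℓ
seriesSetoid = record { isEquivalence = ≈-isEquivalence }

seriesRing : CommutativeRing 0ℓ 0ℓ
seriesRing = record
  { Carrier = Series ; _≈_ = _≈_ ; _+_ = _⊞_ ; _*_ = _·_ ; -_ = ⊝_ ; 0# = 0ˢ ; 1# = 1ˢ
  ; isCommutativeRing = record
    { isRing = record
      { +-isAbelianGroup = record
        { isGroup = record
          { isMonoid = record
            { isSemigroup = record
              { isMagma = record
                { isEquivalence = ≈-isEquivalence
                ; ∙-cong = ⊞-cong
                }
              ; assoc = λ f g h → coefficientwise λ n → ℤ.+-assoc (f n) (g n) (h n)
              }
            ; identity = (λ f → coefficientwise λ n → ℤ.+-identityˡ (f n)) ,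
              (λ f → coefficientwise λ n → ℤ.+-identityʳ (f n))
            }
          ; inverse = (λ f → coefficientwise λ n → ℤ.+-inverseˡ (f n)) ,
            (λ f → coefficientwise λ n → ℤ.+-inverseʳ (f n))
          ; ⁻¹-cong = λ p → coefficientwise λ n → cong ℤ.-_ (at p n)
          }
        ; comm = λ f g → coefficientwise λ n → ℤ.+-comm (f n) (g n)
        }
      ; *-cong     = λ p q → coefficientwise (·-cong (at p) (at q))
      ; *-assoc    = λ f g h → coefficientwise (·-assoc f g h)
      ; *-identity = comm∧idˡ⇒id comm (λ f → coefficientwise (·-identityˡ f))
      ; distrib    = comm∧distrʳ⇒distr ⊞-cong comm (λ h f g → coefficientwise (·-distribʳ h f g))
      }
    ; *-comm = comm
    }
  }
  where
  open import Algebra.Consequences.Setoid seriesSetoid using (comm∧idˡ⇒id; comm∧distrʳ⇒distr)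
  comm : ∀ f g → f · g ≈ g · f
  comm f g = coefficientwise (·-comm f g)
  ⊞-cong : ∀ {f f′ g g′} → f ≈ f′ → g ≈ g′ → f ⊞ g ≈ f′ ⊞ g′
  ⊞-cong p q = coefficientwise λ n → cong₂ ℤ._+_ (at p n) (at q n)

-- With ℤ as the coefficient ring of the solver, numerals in series identities are normalised by
-- decidable integer arithmetic.
κ-homo : CommutativeRing.rawRing ℤ.+-*-commutativeRing -Raw-AlmostCommutative⟶ fromCommutativeRing
  seriesRing
κ-homo = record
  { ⟦_⟧    = κ
  ; +-homo = λ a b → coefficientwise λ { zero → refl ; (suc n) → refl }
  ; *-homo = λ a b → coefficientwise λ
      { zero    → sym (κ-· a (κ b) 0)
      ; (suc n) → trans (sym (ℤ.*-zeroʳ a)) (sym (κ-· a (κ b) (suc n))) }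
  ; -‿homo = λ a → coefficientwise λ { zero → refl ; (suc n) → refl }
  ; 0-homo = coefficientwise λ { zero → refl ; (suc n) → refl }
  ; 1-homo = coefficientwise λ { zero → refl ; (suc n) → refl }
  }

κ-≟ : ∀ a b → Maybe (κ a ≈ κ b)
κ-≟ a b = Maybe.map (λ { refl → coefficientwise λ _ → refl }) (dec⇒maybe (a ℤ.≟ b))

module SeriesSolver = Algebra.Solver.Ring _ _ κ-homo κ-≟

open SeriesSolver using (solve; con; _:=_; _:+_; _:*_; _:-_; :-_; _:^_)

open CommutativeRing seriesRing public using ()
  renaming (refl to ≈-refl; sym to ≈-sym; trans to ≈-trans; +-cong to ⊞-cong; *-cong to *-cong; -‿cong to
    ⊝-cong)

·-congˡ : ∀ f {g g′} → g ≈ g′ → f · g ≈ f · g′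
·-congˡ f = *-cong (≈-refl {f})

·-congʳ : ∀ g {f f′} → f ≈ f′ → f · g ≈ f′ · g
·-congʳ g p = *-cong p (≈-refl {g})

⊞-congˡ : ∀ f {g g′} → g ≈ g′ → f ⊞ g ≈ f ⊞ g′
⊞-congˡ f = ⊞-cong (≈-refl {f})

⊞-congʳ : ∀ g {f f′} → f ≈ f′ → f ⊞ g ≈ f′ ⊞ g
⊞-congʳ g p = ⊞-cong p (≈-refl {g})

open import Algebra.Properties.Semiring.Exp (CommutativeRing.semiring seriesRing) public using () renaming
  (_^_ to _↑_)

^ˢ≈↑ : ∀ f k → f ^ˢ k ≈ f ↑ k
^ˢ≈↑ f zero    = ≈-refl
^ˢ≈↑ f (suc k) = coefficientwise λ n → trans (⊛-cong {f} (λ _ → refl) (at (^ˢ≈↑ f k)) n)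
  (sym (·-⊛ f (f ↑ k) n))

-- Sections, dilations, the derivation q d/dq and q ↦ −q

·-∑ : ∀ f g n → (f · g) n ≡ ∑ᴱ (below (suc n)) (λ i → f i ℤ.* g (n ℕ.∸ i))
·-∑ f g n = trans (·-⊛ f g n) (∑-below (suc n) (λ i → f i ℤ.* g (n ℕ.∸ i)))

extract : ℕ → Series → Series
extract j f n = f (j ℕ.* n)

extract-cong : ∀ j {f g} → f ≈ g → extract j f ≈ extract j g
extract-cong j p = coefficientwise λ n → at p (j ℕ.* n)

Supp : (m : ℕ) .{{_ : NonZero m}} → ℕ → Series → Set
Supp m r f = ∀ n → n % m ≢ r → f n ≡ 0ℤ

module _ {m : ℕ} .{{_ : NonZero m}} where

  Supp-resp : ∀ {r f g} → f ≈ g → Supp m r f → Supp m r g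
  Supp-resp p s n n≢ = trans (sym (at p n)) (s n n≢)

  Supp-⊞ : ∀ {r f g} → Supp m r f → Supp m r g → Supp m r (f ⊞ g)
  Supp-⊞ s t n n≢ = cong₂ ℤ._+_ (s n n≢) (t n n≢)

  Supp-⊝ : ∀ {r f} → Supp m r f → Supp m r (⊝ f)
  Supp-⊝ s n n≢ = cong ℤ.-_ (s n n≢)

  Supp-⊟ : ∀ {r f g} → Supp m r f → Supp m r g → Supp m r (f ⊟ g)
  Supp-⊟ s t = Supp-⊞ s (Supp-⊝ t)

  Supp-κ· : ∀ c {r f} → Supp m r f → Supp m r (κ c · f)
  Supp-κ· c {f = f} s n n≢ = trans (κ-· c f n) (trans (cong (c ℤ.*_) (s n n≢)) (ℤ.*-zeroʳ c))

  Supp-· : ∀ {r s t f g} → (r ℕ.+ s) % m ≡ t → Supp m r f → Supp m s g → Supp m t (f · g)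
  Supp-· {r} {s} {t} {f} {g} r+s≡t F G n n≢t = trans (·-∑ f g n) (∑ᴱ-zero (below (suc n)) zeroTerm)
    where
    zeroTerm : ∀ i → i ℕ.< suc n → f i ℤ.* g (n ℕ.∸ i) ≡ 0ℤ
    zeroTerm i (ℕ.s≤s i≤n) with i % m ℕ.≟ r | (n ℕ.∸ i) % m ℕ.≟ s
    ... | no i≢r  | _       = cong (ℤ._* g (n ℕ.∸ i)) (F i i≢r)
    ... | yes _   | no j≢s  = trans (cong (f i ℤ.*_) (G (n ℕ.∸ i) j≢s)) (ℤ.*-zeroʳ (f i))
    ... | yes i≡r | yes j≡s = ⊥-elim (n≢t (begin
      n % m                                    ≡⟨ cong (_% m) (ℕ.m+[n∸m]≡n i≤n) ⟨
      (i ℕ.+ (n ℕ.∸ i)) % m                    ≡⟨ %-distribˡ-+ i (n ℕ.∸ i) m ⟩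
      (i % m ℕ.+ (n ℕ.∸ i) % m) % m            ≡⟨ cong₂ (λ a b → (a ℕ.+ b) % m) i≡r j≡s ⟩
      (r ℕ.+ s) % m                            ≡⟨ r+s≡t ⟩
      t                                        ∎))
      where open ≡-Reasoning

  extract-Supp : ∀ {r f} → r ≢ 0 → Supp m r f → extract m f ≈ 0ˢ
  extract-Supp r≢0 s = coefficientwise λ n →
    s (m ℕ.* n) (λ eq → r≢0 (trans (sym eq) (n∣m⇒m%n≡0 (m ℕ.* n) m (m∣m*n n))))

  dilate-* : ∀ f n → dilate m f (m ℕ.* n) ≡ f n
  dilate-* f n with m ∣? (m ℕ.* n)
  ... | yes _ = cong f (trans (cong (_/ m) (ℕ.*-comm m n)) (m*n/n≡m n m))
  ... | no ∤  = contradiction (m∣m*n n) ∤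

  dilate-∤ : ∀ f {n} → ¬ m ∣ n → dilate m f n ≡ 0ℤ
  dilate-∤ f {n} ∤ with m ∣? n
  ... | yes ∣n = contradiction ∣n ∤
  ... | no _   = refl

  -- Recognises a dilation by its values at multiples of `m` and its vanishing elsewhere, so later
  -- proofs never compute with the quotient in the definition of `dilate`.
  dilate-unique : ∀ {f g} → (∀ n → g (m ℕ.* n) ≡ f n) → (∀ {n} → ¬ m ∣ n → g n ≡ 0ℤ) → g ≈ dilate m f
  dilate-unique {f} {g} eq zer = coefficientwise go
    where
    go : g ≗ dilate m f
    go n with m ∣? n
    ... | no ∤ = zer ∤
    ... | yes (divides q refl) = trans (cong g (ℕ.*-comm q m)) (trans (eq q) (cong f (sym (m*n/n≡m q m))))

  dilate-cong : ∀ {f g} → f ≈ g → dilate m f ≈ dilate m g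
  dilate-cong {f} {g} p = dilate-unique (λ n → trans (dilate-* f n) (at p n)) (dilate-∤ f)

  Supp-dilate : ∀ f → Supp m 0 (dilate m f)
  Supp-dilate f n n≢0 = dilate-∤ f (λ m∣n → n≢0 (n∣m⇒m%n≡0 n m m∣n))

  dilate-extract : ∀ {f} → Supp m 0 f → f ≈ dilate m (extract m f)
  dilate-extract s = dilate-unique (λ _ → refl) (λ {n} ∤ → s n (∤ ∘ m%n≡0⇒n∣m n m))

  extract-dilate : ∀ f → extract m (dilate m f) ≈ f
  extract-dilate f = coefficientwise (dilate-* f)

  dilate-⊞ : ∀ f g → dilate m (f ⊞ g) ≈ dilate m f ⊞ dilate m g
  dilate-⊞ f g = ≈-sym (dilate-unique {g = dilate m f ⊞ dilate m g}
    (λ k → cong₂ ℤ._+_ (dilate-* f k) (dilate-* g k))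
    (λ ∤ → cong₂ ℤ._+_ (dilate-∤ f ∤) (dilate-∤ g ∤)))

  dilate-⊝ : ∀ f → dilate m (⊝ f) ≈ ⊝ dilate m f
  dilate-⊝ f = ≈-sym (dilate-unique {g = ⊝ dilate m f} (λ k → cong ℤ.-_ (dilate-* f k))
    (λ ∤ → cong ℤ.-_ (dilate-∤ f ∤)))

  -- Extraction is linear over series in q^m: in the convolution at mn only indices i divisible by m
  -- survive, and they are reindexed by i/m.
  extract-· : ∀ f g → extract m (dilate m f · g) ≈ f · extract m g
  extract-· f g = coefficientwise go
   where
   go : ∀ n → extract m (dilate m f · g) n ≡ (f · extract m g) n
   go n = begin
    (dilate m f · g) (m ℕ.* n)                          ≡⟨ ·-∑ (dilate m f) g (m ℕ.* n) ⟩
    ∑ᴱ E w                                              ≡⟨ ∑ᴱ-split E (m ∣?_) w ⟩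
    ∑ᴱ (E ∩ (m ∣?_)) w ℤ.+ ∑ᴱ (E ∩ (λ i → ¬? (m ∣? i))) w
      ≡⟨ cong₂ ℤ._+_
           (reindex (E ∩ (m ∣?_)) (below (suc n)) (_/ m) (m ℕ.*_) {w} {v} to from back forth weight)
           (∑ᴱ-zero (E ∩ (λ i → ¬? (m ∣? i))) (λ i (_ , ∤) → cong (ℤ._* g (m ℕ.* n ℕ.∸ i)) (dilate-∤ f ∤)))
             ⟩
    ∑ᴱ (below (suc n)) v ℤ.+ 0ℤ                         ≡⟨ ℤ.+-identityʳ _ ⟩
    ∑ᴱ (below (suc n)) v                                ≡⟨ ·-∑ f (extract m g) n ⟨
    (f · extract m g) n                                 ∎
    where
    open ≡-Reasoning
    E = below (suc (m ℕ.* n))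
    w v : ℕ → ℤ
    w i = dilate m f i ℤ.* g (m ℕ.* n ℕ.∸ i)
    v i = f i ℤ.* extract m g (n ℕ.∸ i)
    back : ∀ i → i ℕ.< suc (m ℕ.* n) × m ∣ i → m ℕ.* (i / m) ≡ i
    back _ (_ , divides q refl) = trans (cong (m ℕ.*_) (m*n/n≡m q m)) (ℕ.*-comm m q)
    forth : ∀ i → i ℕ.< suc n → (m ℕ.* i) / m ≡ i
    forth i _ = trans (cong (_/ m) (ℕ.*-comm m i)) (m*n/n≡m i m)
    to : ∀ i → i ℕ.< suc (m ℕ.* n) × m ∣ i → i / m ℕ.< suc n
    to i p@(ℕ.s≤s i≤ , _) = ℕ.s≤s (ℕ.*-cancelˡ-≤ m (subst (ℕ._≤ _) (sym (back i p)) i≤))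
    from : ∀ i → i ℕ.< suc n → m ℕ.* i ℕ.< suc (m ℕ.* n) × m ∣ m ℕ.* i
    from i (ℕ.s≤s i≤) = ℕ.s≤s (ℕ.*-monoʳ-≤ m i≤) , m∣m*n i
    weight : ∀ i → i ℕ.< suc (m ℕ.* n) × m ∣ i → w i ≡ v (i / m)
    weight i p = cong₂ ℤ._*_
      (trans (cong (dilate m f) (sym (back i p))) (dilate-* f (i / m)))
      (cong g (trans (cong (m ℕ.* n ℕ.∸_) (sym (back i p))) (sym (ℕ.*-distribˡ-∸ m n (i / m)))))

  dilate-· : ∀ f g → dilate m (f · g) ≈ dilate m f · dilate m g
  dilate-· f g = ≈-sym (dilate-unique {g = dilate m f · dilate m g}
    (λ k → at (≈-trans (extract-· f (dilate m g)) (·-congˡ f (extract-dilate g))) k)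
    (λ {k} ∤ → Supp-· (n∣m⇒m%n≡0 0 m (divides 0 refl)) (Supp-dilate f) (Supp-dilate g) k
      (∤ ∘ m%n≡0⇒n∣m k m)))

  dilate-κ : ∀ c → dilate m (κ c) ≈ κ c
  dilate-κ c = ≈-sym (dilate-unique {g = κ c} atMultiple offMultiple)
    where
    atMultiple : ∀ k → κ c (m ℕ.* k) ≡ κ c k
    atMultiple zero    = cong (κ c) (ℕ.*-zeroʳ m)
    atMultiple (suc k) = subst (λ j → κ c j ≡ 0ℤ) (ℕ.suc-pred (m ℕ.* suc k) {{ℕ.m*n≢0 m (suc k)}}) refl
    offMultiple : ∀ {k} → ¬ m ∣ k → κ c k ≡ 0ℤ
    offMultiple {zero}  ∤ = contradiction (divides 0 refl) ∤
    offMultiple {suc _} _ = refl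

Θ : Series → Series
Θ f n = + n ℤ.* f n

Θ-cong : ∀ {f g} → f ≈ g → Θ f ≈ Θ g
Θ-cong p = coefficientwise λ n → cong (+ n ℤ.*_) (at p n)

Θ-⊞ : ∀ f g → Θ (f ⊞ g) ≈ Θ f ⊞ Θ g
Θ-⊞ f g = coefficientwise λ n → ℤ.*-distribˡ-+ (+ n) (f n) (g n)

Θ-⊝ : ∀ f → Θ (⊝ f) ≈ ⊝ Θ f
Θ-⊝ f = coefficientwise λ n → sym (ℤ.neg-distribʳ-* (+ n) (f n))

Θ-κ : ∀ c → Θ (κ c) ≈ 0ˢ
Θ-κ c = coefficientwise λ { zero → refl ; (suc n) → ℤ.*-zeroʳ (+ suc n) }

module _ (f g : Series) where

  Θ-· : Θ (f · g) ≈ Θ f · g ⊞ f · Θ g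
  Θ-· = coefficientwise λ n → begin
    + n ℤ.* (f · g) n ≡⟨ cong (+ n ℤ.*_) (·-∑ f g n) ⟩
    + n ℤ.* ∑ᴱ (below (suc n)) (λ i → f i ℤ.* g (n ℕ.∸ i))
      ≡⟨ ∑ᴱ-* (below (suc n)) (+ n) (λ i → f i ℤ.* g (n ℕ.∸ i)) ⟨
    ∑ᴱ (below (suc n)) (λ i → + n ℤ.* (f i ℤ.* g (n ℕ.∸ i))) ≡⟨ ∑ᴱ-cong (below (suc n)) (leibniz n) ⟩
    ∑ᴱ (below (suc n)) (λ i → Θ f i ℤ.* g (n ℕ.∸ i) ℤ.+ f i ℤ.* Θ g (n ℕ.∸ i))
      ≡⟨ ∑ᴱ-+ (below (suc n)) (λ i → Θ f i ℤ.* g (n ℕ.∸ i)) (λ i → f i ℤ.* Θ g (n ℕ.∸ i)) ⟩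
    ∑ᴱ (below (suc n)) (λ i → Θ f i ℤ.* g (n ℕ.∸ i)) ℤ.+ ∑ᴱ (below (suc n)) (λ i → f i ℤ.* Θ g (n ℕ.∸ i))
      ≡⟨ cong₂ ℤ._+_ (·-∑ (Θ f) g n) (·-∑ f (Θ g) n) ⟨
    (Θ f · g ⊞ f · Θ g) n ∎
    where
    open ≡-Reasoning
    lemma : ∀ i j a b → (i ℤ.+ j) ℤ.* (a ℤ.* b) ≡ (i ℤ.* a) ℤ.* b ℤ.+ a ℤ.* (j ℤ.* b)
    lemma = solve-∀
    leibniz : ∀ n i → i ℕ.< suc n → + n ℤ.* (f i ℤ.* g (n ℕ.∸ i)) ≡ Θ f i ℤ.* g (n ℕ.∸ i) ℤ.+ f i ℤ.* Θ g
      (n ℕ.∸ i)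
    leibniz n i (ℕ.s≤s i≤n) = trans
      (cong (λ k → + k ℤ.* (f i ℤ.* g (n ℕ.∸ i))) (sym (ℕ.m+[n∸m]≡n i≤n)))
      (lemma (+ i) (+ (n ℕ.∸ i)) (f i) (g (n ℕ.∸ i)))

Supp-Θ : ∀ {m r f} .{{_ : NonZero m}} → Supp m r f → Supp m r (Θ f)
Supp-Θ s n n≢ = trans (cong (+ n ℤ.*_) (s n n≢)) (ℤ.*-zeroʳ (+ n))

extract-Θ : ∀ j f → extract j (Θ f) ≈ κ (+ j) · Θ (extract j f)
extract-Θ j f = coefficientwise λ n → begin
  + (j ℕ.* n) ℤ.* f (j ℕ.* n)     ≡⟨ cong (ℤ._* f (j ℕ.* n)) (ℤ.pos-* j n) ⟩
  + j ℤ.* + n ℤ.* f (j ℕ.* n)     ≡⟨ ℤ.*-assoc (+ j) (+ n) (f (j ℕ.* n)) ⟩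
  + j ℤ.* (+ n ℤ.* f (j ℕ.* n))   ≡⟨ κ-· (+ j) (Θ (extract j f)) n ⟨
  (κ (+ j) · Θ (extract j f)) n ∎
  where open ≡-Reasoning

Θ-dilate : ∀ m .{{_ : NonZero m}} f → Θ (dilate m f) ≈ κ (+ m) · dilate m (Θ f)
Θ-dilate m f = begin
  Θ (dilate m f)                                 ≈⟨ dilate-extract (Supp-Θ (Supp-dilate f)) ⟩
  dilate m (extract m (Θ (dilate m f)))          ≈⟨ dilate-cong (extract-Θ m (dilate m f)) ⟩
  dilate m (κ (+ m) · Θ (extract m (dilate m f)))
    ≈⟨ dilate-cong (·-congˡ (κ (+ m)) (Θ-cong (extract-dilate f))) ⟩
  dilate m (κ (+ m) · Θ f)                       ≈⟨ dilate-· (κ (+ m)) (Θ f) ⟩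
  dilate m (κ (+ m)) · dilate m (Θ f)            ≈⟨ ·-congʳ (dilate m (Θ f)) (dilate-κ (+ m)) ⟩
  κ (+ m) · dilate m (Θ f)                       ∎
  where open import Relation.Binary.Reasoning.Setoid seriesSetoid

sgn : ℕ → ℤ
sgn n = -1ℤ ℤ.^ n

-- f(q) ↦ f(−q)
τ : Series → Series
τ f n = sgn n ℤ.* f n

τ-cong : ∀ {f g} → f ≈ g → τ f ≈ τ g
τ-cong p = coefficientwise λ n → cong (sgn n ℤ.*_) (at p n)

τ-· : ∀ f g → τ (f · g) ≈ τ f · τ g
τ-· f g = coefficientwise λ n → begin
  sgn n ℤ.* (f · g) n ≡⟨ cong (sgn n ℤ.*_) (·-∑ f g n) ⟩
  sgn n ℤ.* ∑ᴱ (below (suc n)) (λ i → f i ℤ.* g (n ℕ.∸ i))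
    ≡⟨ ∑ᴱ-* (below (suc n)) (sgn n) (λ i → f i ℤ.* g (n ℕ.∸ i)) ⟨
  ∑ᴱ (below (suc n)) (λ i → sgn n ℤ.* (f i ℤ.* g (n ℕ.∸ i))) ≡⟨ ∑ᴱ-cong (below (suc n)) (twist n) ⟩
  ∑ᴱ (below (suc n)) (λ i → τ f i ℤ.* τ g (n ℕ.∸ i)) ≡⟨ ·-∑ (τ f) (τ g) n ⟨
  (τ f · τ g) n ∎
  where
  open ≡-Reasoning
  lemma : ∀ s t a b → (s ℤ.* t) ℤ.* (a ℤ.* b) ≡ (s ℤ.* a) ℤ.* (t ℤ.* b)
  lemma = solve-∀
  twist : ∀ n i → i ℕ.< suc n → sgn n ℤ.* (f i ℤ.* g (n ℕ.∸ i)) ≡ τ f i ℤ.* τ g (n ℕ.∸ i)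
  twist n i (ℕ.s≤s i≤n) = trans
    (cong (ℤ._* (f i ℤ.* g (n ℕ.∸ i))) (trans (cong sgn (sym (ℕ.m+[n∸m]≡n i≤n)))
      (ℤ.^-distribˡ-+-* -1ℤ i (n ℕ.∸ i))))
    (lemma (sgn i) (sgn (n ℕ.∸ i)) (f i) (g (n ℕ.∸ i)))

-- Lattice sums

ε : ℤ → ℤ
ε x = sgn ∣ x ∣

sgn-+ : ∀ m n → sgn (m ℕ.+ n) ≡ sgn m ℤ.* sgn n
sgn-+ = ℤ.^-distribˡ-+-* -1ℤ

sgn-cases : ∀ n → sgn n ≡ 1ℤ ⊎ sgn n ≡ -1ℤ
sgn-cases zero    = inj₁ refl
sgn-cases (suc n) = [ (λ eq → inj₂ (cong (-1ℤ ℤ.*_) eq)) , (λ eq → inj₁ (cong (-1ℤ ℤ.*_) eq)) ]′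
  (sgn-cases n)

sgn-sq : ∀ n → sgn n ℤ.* sgn n ≡ 1ℤ
sgn-sq n = [ (λ eq → cong₂ ℤ._*_ eq eq) , (λ eq → cong₂ ℤ._*_ eq eq) ]′ (sgn-cases n)

sgn-suc-suc : ∀ n → sgn (suc (suc n)) ≡ sgn n
sgn-suc-suc n = trans (sym (ℤ.*-assoc -1ℤ -1ℤ (sgn n))) (ℤ.*-identityˡ (sgn n))

ε-⊖ : ∀ m n → ε (m ⊖ n) ≡ sgn (m ℕ.+ n)
ε-⊖ m       zero    = cong sgn (sym (ℕ.+-identityʳ m))
ε-⊖ zero    (suc n) = refl
ε-⊖ (suc m) (suc n) = begin
  ε (suc m ⊖ suc n)      ≡⟨ cong ε (ℤ.[1+m]⊖[1+n]≡m⊖n m n) ⟩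
  ε (m ⊖ n)              ≡⟨ ε-⊖ m n ⟩
  sgn (m ℕ.+ n)          ≡⟨ sgn-suc-suc (m ℕ.+ n) ⟨
  sgn (suc (suc m ℕ.+ n)) ≡⟨ cong (sgn ∘ suc) (ℕ.+-suc m n) ⟨
  sgn (suc m ℕ.+ suc n)  ∎
  where open ≡-Reasoning

ε-+ : ∀ x y → ε (x ℤ.+ y) ≡ ε x ℤ.* ε y
ε-+ (+ m)    (+ n)    = sgn-+ m n
ε-+ (+ m)    -[1+ n ] = trans (ε-⊖ m (suc n)) (sgn-+ m (suc n))
ε-+ -[1+ m ] (+ n)    = trans (ε-⊖ n (suc m)) (trans (sgn-+ n (suc m)) (ℤ.*-comm (sgn n) (sgn (suc m))))
ε-+ -[1+ m ] -[1+ n ] = trans (cong (sgn ∘ suc) (sym (ℕ.+-suc m n))) (sgn-+ (suc m) (suc n))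

ε-neg : ∀ x → ε (ℤ.- x) ≡ ε x
ε-neg x = cong sgn (ℤ.∣-i∣≡∣i∣ x)

ε-- : ∀ x y → ε (x ℤ.- y) ≡ ε x ℤ.* ε y
ε-- x y = trans (ε-+ x (ℤ.- y)) (cong (ε x ℤ.*_) (ε-neg y))

ε-sq : ∀ x → ε x ℤ.* ε x ≡ 1ℤ
ε-sq x = sgn-sq ∣ x ∣

ε-double : ∀ x → ε (+ 2 ℤ.* x) ≡ 1ℤ
ε-double x = trans (cong ε (double x)) (trans (ε-+ x x) (ε-sq x))
  where
  double : ∀ x → + 2 ℤ.* x ≡ x ℤ.+ x
  double = solve-∀

ε-quintuple : ∀ x → ε (+ 5 ℤ.* x) ≡ ε x
ε-quintuple x = begin
  ε (+ 5 ℤ.* x)                 ≡⟨ cong ε (quintuple x) ⟩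
  ε (+ 2 ℤ.* (+ 2 ℤ.* x) ℤ.+ x) ≡⟨ ε-+ (+ 2 ℤ.* (+ 2 ℤ.* x)) x ⟩
  ε (+ 2 ℤ.* (+ 2 ℤ.* x)) ℤ.* ε x ≡⟨ cong (ℤ._* ε x) (ε-double (+ 2 ℤ.* x)) ⟩
  1ℤ ℤ.* ε x                    ≡⟨ ℤ.*-identityˡ (ε x) ⟩
  ε x                           ∎
  where
  open ≡-Reasoning
  quintuple : ∀ x → + 5 ℤ.* x ≡ + 2 ℤ.* (+ 2 ℤ.* x) ℤ.+ x
  quintuple = solve-∀

sgn-* : ∀ n → sgn (n ℕ.* n) ≡ sgn n
sgn-* n with sgn-cases n
... | inj₁ eq = trans (sym (ℤ.^-*-assoc -1ℤ n n)) (trans (cong (ℤ._^ n) eq) (trans (ℤ.^-zeroˡ n) (sym eq)))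
... | inj₂ eq = trans (sym (ℤ.^-*-assoc -1ℤ n n)) (cong (ℤ._^ n) eq)

square : ∀ x → x ℤ.* x ≡ + (∣ x ∣ ℕ.* ∣ x ∣)
square (+ n)    = sym (ℤ.pos-* n n)
square -[1+ n ] = refl

box : ∀ n → Enum (λ x → ∣ x ∣ ℕ.≤ n)
box n = record
  { list     = map +_ (upTo (suc n)) ++ map -[1+_] (upTo n)
  ; unique   = Unique.++⁺ (Unique.map⁺ ℤ.+-injective (Unique.upTo⁺ (suc n)))
                          (Unique.map⁺ ℤ.-[1+-injective (Unique.upTo⁺ n)) disjoint
  ; sound    = λ x∈ → [ nonneg , neg ]′ (∈-++⁻ (map +_ (upTo (suc n))) x∈)
  ; complete = λ {x} → complete′ x
  }
  where
  disjoint : ∀ {x} → ¬ (x ∈ map +_ (upTo (suc n)) × x ∈ map -[1+_] (upTo n))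
  disjoint (p , q) with _ , _ , refl ← ∈-map⁻ +_ p | _ , _ , () ← ∈-map⁻ -[1+_] q
  nonneg : ∀ {x} → x ∈ map +_ (upTo (suc n)) → ∣ x ∣ ℕ.≤ n
  nonneg p with m , m∈ , refl ← ∈-map⁻ +_ p = ℕ.s≤s⁻¹ (∈-upTo⁻ m∈)
  neg : ∀ {x} → x ∈ map -[1+_] (upTo n) → ∣ x ∣ ℕ.≤ n
  neg p with m , m∈ , refl ← ∈-map⁻ -[1+_] p = ∈-upTo⁻ m∈
  complete′ : ∀ x → ∣ x ∣ ℕ.≤ n → x ∈ map +_ (upTo (suc n)) ++ map -[1+_] (upTo n)
  complete′ (+ m)    m≤n = ∈-++⁺ˡ (∈-map⁺ +_ (∈-upTo⁺ (ℕ.s≤s m≤n)))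
  complete′ -[1+ m ] m<n = ∈-++⁺ʳ (map +_ (upTo (suc n))) (∈-map⁺ -[1+_] (∈-upTo⁺ m<n))

n≤n*n : ∀ n → n ℕ.≤ n ℕ.* n
n≤n*n zero    = ℕ.z≤n
n≤n*n (suc n) = ℕ.m≤m*n (suc n) (suc n)

squares : ∀ n → Enum (λ x → x ℤ.* x ≡ + n)
squares n = carve (box n) (λ x → x ℤ.* x ℤ.≟ + n)
  (λ x eq → subst (∣ x ∣ ℕ.≤_) (ℤ.+-injective (trans (sym (square x)) eq)) (n≤n*n ∣ x ∣))

twoSquares : ∀ n → Enum (λ (x , y) → x ℤ.* x ℤ.+ y ℤ.* y ≡ + n)
twoSquares n = carve (box n ⋉ λ _ → box n) (λ (x , y) → x ℤ.* x ℤ.+ y ℤ.* y ℤ.≟ + n) bound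
  where
  bound : ∀ (xy : ℤ × ℤ) → let (x , y) = xy in x ℤ.* x ℤ.+ y ℤ.* y ≡ + n → ∣ x ∣ ℕ.≤ n × ∣ y ∣ ℕ.≤ n
  bound (x , y) eq with refl ← ℤ.+-injective (trans (sym (cong₂ ℤ._+_ (square x) (square y))) eq) =
    ℕ.≤-trans (n≤n*n ∣ x ∣) (ℕ.m≤m+n _ _) , ℕ.≤-trans (n≤n*n ∣ y ∣) (ℕ.m≤n+m _ (∣ x ∣ ℕ.* ∣ x ∣))

∑ᴱ-if : {A : Set} {P Q : A → Set} (E : Enum P) (Q? : ∀ a → Dec (Q a)) (w : A → ℤ) →
  ∑ᴱ E (λ a → if does (Q? a) then w a else 0ℤ) ≡ ∑ᴱ (E ∩ Q?) w
∑ᴱ-if E Q? w = go (list E)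
  where
  go : ∀ xs → sumOver (λ a → if does (Q? a) then w a else 0ℤ) xs ≡ sumOver w (filter Q? xs)
  go [] = refl
  go (x ∷ xs) with Q? x
  ... | yes _ = cong (ℤ._+_ (w x)) (go xs)
  ... | no _  = trans (ℤ.+-identityˡ _) (go xs)

-- The window of shifted indices in the definition contains every root, because |x| ≤ x². From here
-- on φ is handled as a sum over all integer roots.
φ-squares : ∀ n → φ[-q] n ≡ ∑ᴱ (squares n) ε
φ-squares n = begin
  φ[-q] n ≡⟨⟩
  ∑[ i < suc (2 ℕ.* n) ] w (toℕ i) ≡⟨ ∑-below (suc (2 ℕ.* n)) w ⟩
  ∑ᴱ E w ≡⟨ ∑ᴱ-if E Q? (ε ∘ (_⊖ n)) ⟩
  ∑ᴱ (E ∩ Q?) (ε ∘ (_⊖ n)) ≡⟨ reindex (E ∩ Q?) (squares n) (_⊖ n) (λ x → ∣ x ℤ.+ + n ∣) {ε ∘ (_⊖ n)} {ε}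
        (λ _ → proj₂) from (λ i _ → back i) forth (λ _ _ → refl) ⟩
  ∑ᴱ (squares n) ε ∎
  where
  open ≡-Reasoning
  E = below (suc (2 ℕ.* n))
  Q? : ∀ i → Dec ((i ⊖ n) ℤ.* (i ⊖ n) ≡ + n)
  Q? i = (i ⊖ n) ℤ.* (i ⊖ n) ℤ.≟ + n
  w : ℕ → ℤ
  w i = if does (Q? i) then ε (i ⊖ n) else 0ℤ
  back : ∀ i → ∣ (i ⊖ n) ℤ.+ + n ∣ ≡ i
  back i = cong ∣_∣ (trans (cong (ℤ._+ + n) (sym (ℤ.m-n≡m⊖n i n))) (cancel (+ i) (+ n)))
    where
    cancel : ∀ a b → a ℤ.- b ℤ.+ b ≡ a
    cancel = solve-∀
  shifted : ∀ x → ∣ x ∣ ℕ.≤ n → + ∣ x ℤ.+ + n ∣ ≡ x ℤ.+ + n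
  shifted (+ m)    _   = refl
  shifted -[1+ m ] m<n = trans (cong (λ y → + ∣ y ∣) (ℤ.⊖-≥ m<n)) (sym (ℤ.⊖-≥ m<n))
  bound : ∀ x → x ℤ.* x ≡ + n → ∣ x ∣ ℕ.≤ n
  bound x eq = subst (∣ x ∣ ℕ.≤_) (ℤ.+-injective (trans (sym (square x)) eq)) (n≤n*n ∣ x ∣)
  forth : ∀ x → x ℤ.* x ≡ + n → ∣ x ℤ.+ + n ∣ ⊖ n ≡ x
  forth x eq = trans (sym (ℤ.m-n≡m⊖n ∣ x ℤ.+ + n ∣ n)) (trans (cong (ℤ._- + n) (shifted x (bound x eq)))
    (cancel x (+ n)))
    where
    cancel : ∀ a b → a ℤ.+ b ℤ.- b ≡ a
    cancel = solve-∀
  from : ∀ x → x ℤ.* x ≡ + n →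
    ∣ x ℤ.+ + n ∣ ℕ.< suc (2 ℕ.* n) × (∣ x ℤ.+ + n ∣ ⊖ n) ℤ.* (∣ x ℤ.+ + n ∣ ⊖ n) ≡ + n
  from x eq = ℕ.s≤s (begin-≤ x (bound x eq)) , trans (cong (λ y → y ℤ.* y) (forth x eq)) eq
    where
    begin-≤ : ∀ x → ∣ x ∣ ℕ.≤ n → ∣ x ℤ.+ + n ∣ ℕ.≤ 2 ℕ.* n
    begin-≤ x b = ℕ.≤-trans (ℤ.∣i+j∣≤∣i∣+∣j∣ x (+ n)) (ℕ.+-mono-≤ b (ℕ.≤-reflexive (sym (ℕ.+-identityʳ n))))

module _ {A B : Set} {P : ℕ → A → Set} {Q : ℕ → B → Set} {R : ℕ → A × B → Set}
  (E : ∀ n → Enum (P n)) (F : ∀ n → Enum (Q n)) (G : ∀ n → Enum (R n))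
  (deg : A → ℕ) (deg-unique : ∀ i a → P i a → i ≡ deg a)
  (join : ∀ i j a b → P i a → Q j b → R (i ℕ.+ j) (a , b))
  (part : ∀ n a b → R n (a , b) → ∃ λ j → deg a ℕ.+ j ≡ n × P (deg a) a × Q j b)
  where

  convolution : ∀ (w : A → ℤ) (v : B → ℤ) n →
    ((λ i → ∑ᴱ (E i) w) · (λ j → ∑ᴱ (F j) v)) n ≡ ∑ᴱ (G n) (λ (a , b) → w a ℤ.* v b)
  convolution w v n = begin
    ((λ i → ∑ᴱ (E i) w) · (λ j → ∑ᴱ (F j) v)) n ≡⟨ ·-∑ (λ i → ∑ᴱ (E i) w) (λ j → ∑ᴱ (F j) v) n ⟩
    ∑ᴱ (below (suc n)) (λ i → ∑ᴱ (E i) w ℤ.* ∑ᴱ (F (n ℕ.∸ i)) v)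
      ≡⟨ ∑ᴱ-cong (below (suc n)) (λ i _ → product i) ⟩
    ∑ᴱ (below (suc n)) (λ i → ∑ᴱ (EF i) wv)
      ≡⟨ ∑ᴱ-⋉ (below (suc n)) EF (λ (_ , ab) → wv ab) ⟨
    ∑ᴱ (below (suc n) ⋉ EF) (λ (_ , ab) → wv ab)
      ≡⟨ reindex (below (suc n) ⋉ EF) (G n) proj₂ (λ (a , b) → deg a , a , b) {λ (_ , ab) → wv ab} {wv} to
        from
           back (λ _ _ → refl) (λ _ _ → refl) ⟩
    ∑ᴱ (G n) wv ∎
    where
    open ≡-Reasoning
    EF : ∀ i → Enum (λ (a , b) → P i a × Q (n ℕ.∸ i) b)
    EF i = E i ⋉ λ _ → F (n ℕ.∸ i)
    wv : A × B → ℤ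
    wv (a , b) = w a ℤ.* v b
    product : ∀ i → ∑ᴱ (E i) w ℤ.* ∑ᴱ (F (n ℕ.∸ i)) v ≡ ∑ᴱ (EF i) wv
    product i = sym (trans (∑ᴱ-⋉ (E i) (λ _ → F (n ℕ.∸ i)) wv)
      (trans (∑ᴱ-cong (E i) (λ a _ → ∑ᴱ-* (F (n ℕ.∸ i)) (w a) v)) (∑ᴱ-*ʳ (E i) (∑ᴱ (F (n ℕ.∸ i)) v) w)))
    back : ∀ (iab : ℕ × A × B) → let (i , a , b) = iab in
      i ℕ.< suc n × P i a × Q (n ℕ.∸ i) b → (deg a , a , b) ≡ (i , a , b)
    back (i , ab) (_ , p , _) = cong (_, ab) (sym (deg-unique i _ p))
    to : ∀ (iab : ℕ × A × B) → let (i , a , b) = iab in i ℕ.< suc n × P i a × Q (n ℕ.∸ i) b → R n (a , b)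
    to (i , a , b) (ℕ.s≤s i≤n , p , q) = subst (λ k → R k (a , b)) (ℕ.m+[n∸m]≡n i≤n) (join i _ a b p q)
    from : ∀ (ab : A × B) → let (a , b) = ab in R n (a , b) → deg a ℕ.< suc n × P (deg a) a × Q (n ℕ.∸ deg a) b
    from (a , b) r with j , refl , p , q ← part n a b r =
      ℕ.s≤s (ℕ.m≤m+n (deg a) j) , p , subst (λ k → Q k b) (sym (ℕ.m+n∸m≡n (deg a) j)) q

-- Sums of two squares

-- Exact quotient, with junk value 0.
quo : ℤ → ℤ → ℤ
quo k x with k ℤ.∣? x
... | yes (divides q _) = q
... | no _              = 0ℤ

quo-exact : ∀ {k x} → k ℤ.∣ x → k ℤ.* quo k x ≡ x
quo-exact {k} {x} k∣x with k ℤ.∣? x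
... | yes (divides q eq) = trans (ℤ.*-comm k q) (sym eq)
... | no k∤x             = contradiction k∣x k∤x

quo-unique : ∀ k .{{_ : ℤ.NonZero k}} {q x} → x ≡ k ℤ.* q → quo k x ≡ q
quo-unique k {q} {x} eq = ℤ.*-cancelˡ-≡
  k (quo k x) q (trans (quo-exact (divides q (trans eq (ℤ.*-comm k q)))) eq)

-- States b ≡ c a modulo k through an explicit multiple `d` of k, so that each use reduces to a
-- polynomial identity for the ring solver.
∣-combine : ∀ {k a b} c d → b ≡ c ℤ.* a ℤ.+ d ℤ.* k → k ℤ.∣ a → k ℤ.∣ b
∣-combine c d refl k∣a = ℤ.∣m∣n⇒∣m+n (ℤ.∣n⇒∣m*n c k∣a) (ℤ.∣n⇒∣m*n d ℤ.∣-refl)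

euclid₅ : ∀ a b → + 5 ℤ.∣ a ℤ.* b → + 5 ℤ.∣ a ⊎ + 5 ℤ.∣ b
euclid₅ a b 5∣ab = [ inj₁ ∘ ℤ.∣ᵤ⇒∣ , inj₂ ∘ ℤ.∣ᵤ⇒∣ ]′
  (euclidsLemma ∣ a ∣ ∣ b ∣ (from-yes (prime? 5)) (subst (5 ℕ.∣_) (ℤ.abs-* a b) (ℤ.∣⇒∣ᵤ 5∣ab)))

εε : ℤ × ℤ → ℤ
εε (x , y) = ε x ℤ.* ε y

φ²-squares : ∀ n → (φ · φ) n ≡ ∑ᴱ (twoSquares n) εε
φ²-squares n = trans (·-cong φ-squares φ-squares n)
  (convolution squares squares twoSquares (λ x → ∣ x ∣ ℕ.* ∣ x ∣) deg-unique join part ε ε n)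
  where
  deg-unique : ∀ i x → x ℤ.* x ≡ + i → i ≡ ∣ x ∣ ℕ.* ∣ x ∣
  deg-unique i x eq = ℤ.+-injective (trans (sym eq) (square x))
  join : ∀ i j x y → x ℤ.* x ≡ + i → y ℤ.* y ≡ + j → x ℤ.* x ℤ.+ y ℤ.* y ≡ + (i ℕ.+ j)
  join _ _ _ _ = cong₂ ℤ._+_
  part : ∀ n x y → x ℤ.* x ℤ.+ y ℤ.* y ≡ + n →
    ∃ λ j → ∣ x ∣ ℕ.* ∣ x ∣ ℕ.+ j ≡ n × x ℤ.* x ≡ + (∣ x ∣ ℕ.* ∣ x ∣) × y ℤ.* y ≡ + j
  part n x y eq = ∣ y ∣ ℕ.* ∣ y ∣ , ℤ.+-injective (trans (sym (cong₂ ℤ._+_ (square x) (square y))) eq) ,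
    square x , square y

-- A point of ℤ[i] of norm divisible by 5 is divisible by 2 + i or by 2 − i, and by both exactly
-- when it is divisible by 5.
module Gaussian where

  -- The quotient of x + iy by 2 + i is ((y + 2x) + i(2y - x))/5. One condition suffices, because 2y
  -- - x ≡ 2(y + 2x) modulo 5.
  by2+i? : ∀ xy → Dec (+ 5 ℤ.∣ (proj₂ xy ℤ.+ + 2 ℤ.* proj₁ xy))
  by2+i? (x , y) = + 5 ℤ.∣? (y ℤ.+ + 2 ℤ.* x)

  part : ℕ → ℤ
  part n = ∑ᴱ (twoSquares n ∩ by2+i?) εε

  rest : ℕ → ℤ
  rest n = ∑ᴱ (twoSquares n ∩ (λ xy → ¬? (by2+i? xy))) εε

  -- Division by 2 + i, of norm 5, is a bijection onto the points of norm n. Signs survive since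
  -- modulo 2 the factor 2 + i is i, which merely swaps the coordinates.
  part-quintuple : ∀ n → part (5 ℕ.* n) ≡ (φ · φ) n
  part-quintuple n = trans
    (reindex (twoSquares (5 ℕ.* n) ∩ by2+i?) (twoSquares n) f g {εε} {εε} to from gf fg weight)
    (sym (φ²-squares n))
    where
    f g : ℤ × ℤ → ℤ × ℤ
    f (x , y) = quo (+ 5) (y ℤ.+ + 2 ℤ.* x) , quo (+ 5) (+ 2 ℤ.* y ℤ.- x)
    g (s , t) = + 2 ℤ.* s ℤ.- t , s ℤ.+ + 2 ℤ.* t
    In Out : ℤ × ℤ → Set
    In (x , y) = x ℤ.* x ℤ.+ y ℤ.* y ≡ + (5 ℕ.* n) × + 5 ℤ.∣ (y ℤ.+ + 2 ℤ.* x)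
    Out (s , t) = s ℤ.* s ℤ.+ t ℤ.* t ≡ + n
    gf : ∀ xy → In xy → g (f xy) ≡ xy
    gf (x , y) (_ , 5∣) = cong₂ _,_
      (ℤ.*-cancelˡ-≡ (+ 5) _ _ (begin
        + 5 ℤ.* (+ 2 ℤ.* s ℤ.- t)                         ≡⟨ l₁ s t ⟩
        + 2 ℤ.* (+ 5 ℤ.* s) ℤ.- + 5 ℤ.* t                 ≡⟨ cong₂ (λ a b → + 2 ℤ.* a ℤ.- b) 5s 5t ⟩
        + 2 ℤ.* (y ℤ.+ + 2 ℤ.* x) ℤ.- (+ 2 ℤ.* y ℤ.- x)   ≡⟨ l₂ x y ⟩
        + 5 ℤ.* x                                         ∎))
      (ℤ.*-cancelˡ-≡ (+ 5) _ _ (begin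
        + 5 ℤ.* (s ℤ.+ + 2 ℤ.* t)                         ≡⟨ l₃ s t ⟩
        + 5 ℤ.* s ℤ.+ + 2 ℤ.* (+ 5 ℤ.* t)                 ≡⟨ cong₂ (λ a b → a ℤ.+ + 2 ℤ.* b) 5s 5t ⟩
        y ℤ.+ + 2 ℤ.* x ℤ.+ + 2 ℤ.* (+ 2 ℤ.* y ℤ.- x)     ≡⟨ l₄ x y ⟩
        + 5 ℤ.* y                                         ∎))
      where
      open ≡-Reasoning
      s = proj₁ (f (x , y))
      t = proj₂ (f (x , y))
      comb : ∀ x y → + 2 ℤ.* y ℤ.- x ≡ + 2 ℤ.* (y ℤ.+ + 2 ℤ.* x) ℤ.+ (ℤ.- x) ℤ.* + 5
      comb = solve-∀
      5s : + 5 ℤ.* s ≡ y ℤ.+ + 2 ℤ.* x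
      5s = quo-exact 5∣
      5t : + 5 ℤ.* t ≡ + 2 ℤ.* y ℤ.- x
      5t = quo-exact (∣-combine (+ 2) (ℤ.- x) (comb x y) 5∣)
      l₁ : ∀ s t → + 5 ℤ.* (+ 2 ℤ.* s ℤ.- t) ≡ + 2 ℤ.* (+ 5 ℤ.* s) ℤ.- + 5 ℤ.* t
      l₁ = solve-∀
      l₂ : ∀ x y → + 2 ℤ.* (y ℤ.+ + 2 ℤ.* x) ℤ.- (+ 2 ℤ.* y ℤ.- x) ≡ + 5 ℤ.* x
      l₂ = solve-∀
      l₃ : ∀ s t → + 5 ℤ.* (s ℤ.+ + 2 ℤ.* t) ≡ + 5 ℤ.* s ℤ.+ + 2 ℤ.* (+ 5 ℤ.* t)
      l₃ = solve-∀
      l₄ : ∀ x y → y ℤ.+ + 2 ℤ.* x ℤ.+ + 2 ℤ.* (+ 2 ℤ.* y ℤ.- x) ≡ + 5 ℤ.* y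
      l₄ = solve-∀
    norm : ∀ s t → (+ 2 ℤ.* s ℤ.- t) ℤ.* (+ 2 ℤ.* s ℤ.- t) ℤ.+ (s ℤ.+ + 2 ℤ.* t) ℤ.* (s ℤ.+ + 2 ℤ.* t) ≡
      + 5 ℤ.* (s ℤ.* s ℤ.+ t ℤ.* t)
    norm = solve-∀
    to : ∀ xy → In xy → Out (f xy)
    to xy@(x , y) p@(eq , _) = ℤ.*-cancelˡ-≡ (+ 5) _ _ (begin
      + 5 ℤ.* (s ℤ.* s ℤ.+ t ℤ.* t)       ≡⟨ norm s t ⟨
      _                                   ≡⟨ cong (λ (x , y) → x ℤ.* x ℤ.+ y ℤ.* y) (gf xy p) ⟩
      x ℤ.* x ℤ.+ y ℤ.* y                 ≡⟨ eq ⟩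
      + (5 ℕ.* n)                         ≡⟨ ℤ.pos-* 5 n ⟩
      + 5 ℤ.* + n                         ∎)
      where
      open ≡-Reasoning
      s = proj₁ (f xy)
      t = proj₂ (f xy)
    l₅ : ∀ s t → s ℤ.+ + 2 ℤ.* t ℤ.+ + 2 ℤ.* (+ 2 ℤ.* s ℤ.- t) ≡ + 5 ℤ.* s
    l₅ = solve-∀
    l₆ : ∀ s t → + 2 ℤ.* (s ℤ.+ + 2 ℤ.* t) ℤ.- (+ 2 ℤ.* s ℤ.- t) ≡ + 5 ℤ.* t
    l₆ = solve-∀
    from : ∀ st → Out st → In (g st)
    from (s , t) eq = trans (norm s t) (trans (cong (+ 5 ℤ.*_) eq) (sym (ℤ.pos-* 5 n))) ,
      divides s (trans (l₅ s t) (ℤ.*-comm (+ 5) s))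
    fg : ∀ st → Out st → f (g st) ≡ st
    fg (s , t) _ = cong₂ _,_ (quo-unique (+ 5) (l₅ s t)) (quo-unique (+ 5) (l₆ s t))
    εε-g : ∀ st → εε (g st) ≡ εε st
    εε-g (s , t) = begin
      ε (+ 2 ℤ.* s ℤ.- t) ℤ.* ε (s ℤ.+ + 2 ℤ.* t)
        ≡⟨ cong₂ ℤ._*_ (ε-- (+ 2 ℤ.* s) t) (ε-+ s (+ 2 ℤ.* t)) ⟩
      (ε (+ 2 ℤ.* s) ℤ.* ε t) ℤ.* (ε s ℤ.* ε (+ 2 ℤ.* t))
        ≡⟨ cong₂ (λ a b → (a ℤ.* ε t) ℤ.* (ε s ℤ.* b)) (ε-double s) (ε-double t) ⟩
      (1ℤ ℤ.* ε t) ℤ.* (ε s ℤ.* 1ℤ)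
        ≡⟨ l₇ (ε s) (ε t) ⟩
      ε s ℤ.* ε t ∎
      where
      open ≡-Reasoning
      l₇ : ∀ a b → (1ℤ ℤ.* b) ℤ.* (a ℤ.* 1ℤ) ≡ a ℤ.* b
      l₇ = solve-∀
    weight : ∀ xy → In xy → εε xy ≡ εε (f xy)
    weight xy p = trans (cong εε (sym (gf xy p))) (εε-g (f xy))

  part-empty : ∀ {n} → ¬ 5 ℕ.∣ n → part n ≡ 0ℤ
  part-empty {n} 5∤n = ∑ᴱ-empty (twoSquares n ∩ by2+i?) λ (s , t) (eq , 5∣) →
    5∤n (ℤ.∣⇒∣ᵤ (subst (+ 5 ℤ.∣_) eq (∣-combine (t ℤ.- + 2 ℤ.* s) (s ℤ.* s) (lemma s t) 5∣)))
    where
    lemma : ∀ s t → s ℤ.* s ℤ.+ t ℤ.* t ≡ (t ℤ.- + 2 ℤ.* s) ℤ.* (t ℤ.+ + 2 ℤ.* s) ℤ.+ s ℤ.* s ℤ.* + 5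
    lemma = solve-∀

  -- A point of norm divisible by 5 that 2 + i does not divide is divisible by 2 - i. Since 2 + i
  -- and 2 - i are coprime, dividing by 2 - i keeps indivisibility by 2 + i.
  rest-quintuple : ∀ n → rest (5 ℕ.* n) ≡ rest n
  rest-quintuple n =
    reindex (twoSquares (5 ℕ.* n) ∩ (λ xy → ¬? (by2+i? xy))) (twoSquares n ∩ (λ xy → ¬? (by2+i? xy))) f g
      {εε} {εε} to from gf fg weight
    where
    f g : ℤ × ℤ → ℤ × ℤ
    f (x , y) = quo (+ 5) (+ 2 ℤ.* x ℤ.- y) , quo (+ 5) (x ℤ.+ + 2 ℤ.* y)
    g (s , t) = + 2 ℤ.* s ℤ.+ t , + 2 ℤ.* t ℤ.- s
    In Out : ℤ × ℤ → Set
    In (x , y) = x ℤ.* x ℤ.+ y ℤ.* y ≡ + (5 ℕ.* n) × ¬ + 5 ℤ.∣ (y ℤ.+ + 2 ℤ.* x)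
    Out (s , t) = s ℤ.* s ℤ.+ t ℤ.* t ≡ + n × ¬ + 5 ℤ.∣ (t ℤ.+ + 2 ℤ.* s)
    by2-i : ∀ x y → In (x , y) → + 5 ℤ.∣ (+ 2 ℤ.* x ℤ.- y)
    by2-i x y (eq , 5∤) with euclid₅ (y ℤ.+ + 2 ℤ.* x) (+ 2 ℤ.* x ℤ.- y)
      (∣-combine -1ℤ (x ℤ.* x) (lemma x y)
        (divides (+ n) (trans eq (trans (ℤ.pos-* 5 n) (ℤ.*-comm (+ 5) (+ n))))))
      where
      lemma : ∀ x y → (y ℤ.+ + 2 ℤ.* x) ℤ.* (+ 2 ℤ.* x ℤ.- y) ≡ -1ℤ ℤ.* (x ℤ.* x ℤ.+ y ℤ.* y)
        ℤ.+ x ℤ.* x ℤ.* + 5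
      lemma = solve-∀
    ... | inj₁ 5∣ = contradiction 5∣ 5∤
    ... | inj₂ 5∣ = 5∣
    gf : ∀ xy → In xy → g (f xy) ≡ xy
    gf (x , y) p = cong₂ _,_
      (ℤ.*-cancelˡ-≡ (+ 5) _ _ (begin
        + 5 ℤ.* (+ 2 ℤ.* s ℤ.+ t)                         ≡⟨ l₁ s t ⟩
        + 2 ℤ.* (+ 5 ℤ.* s) ℤ.+ + 5 ℤ.* t                 ≡⟨ cong₂ (λ a b → + 2 ℤ.* a ℤ.+ b) 5s 5t ⟩
        + 2 ℤ.* (+ 2 ℤ.* x ℤ.- y) ℤ.+ (x ℤ.+ + 2 ℤ.* y)   ≡⟨ l₂ x y ⟩
        + 5 ℤ.* x                                         ∎))
      (ℤ.*-cancelˡ-≡ (+ 5) _ _ (begin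
        + 5 ℤ.* (+ 2 ℤ.* t ℤ.- s)                         ≡⟨ l₃ s t ⟩
        + 2 ℤ.* (+ 5 ℤ.* t) ℤ.- + 5 ℤ.* s                 ≡⟨ cong₂ (λ a b → + 2 ℤ.* b ℤ.- a) 5s 5t ⟩
        + 2 ℤ.* (x ℤ.+ + 2 ℤ.* y) ℤ.- (+ 2 ℤ.* x ℤ.- y)   ≡⟨ l₄ x y ⟩
        + 5 ℤ.* y                                         ∎))
      where
      open ≡-Reasoning
      s = proj₁ (f (x , y))
      t = proj₂ (f (x , y))
      comb : ∀ x y → x ℤ.+ + 2 ℤ.* y ≡ (ℤ.- + 2) ℤ.* (+ 2 ℤ.* x ℤ.- y) ℤ.+ x ℤ.* + 5
      comb = solve-∀
      5s : + 5 ℤ.* s ≡ + 2 ℤ.* x ℤ.- y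
      5s = quo-exact (by2-i x y p)
      5t : + 5 ℤ.* t ≡ x ℤ.+ + 2 ℤ.* y
      5t = quo-exact (∣-combine (ℤ.- + 2) x (comb x y) (by2-i x y p))
      l₁ : ∀ s t → + 5 ℤ.* (+ 2 ℤ.* s ℤ.+ t) ≡ + 2 ℤ.* (+ 5 ℤ.* s) ℤ.+ + 5 ℤ.* t
      l₁ = solve-∀
      l₂ : ∀ x y → + 2 ℤ.* (+ 2 ℤ.* x ℤ.- y) ℤ.+ (x ℤ.+ + 2 ℤ.* y) ≡ + 5 ℤ.* x
      l₂ = solve-∀
      l₃ : ∀ s t → + 5 ℤ.* (+ 2 ℤ.* t ℤ.- s) ≡ + 2 ℤ.* (+ 5 ℤ.* t) ℤ.- + 5 ℤ.* s
      l₃ = solve-∀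
      l₄ : ∀ x y → + 2 ℤ.* (x ℤ.+ + 2 ℤ.* y) ℤ.- (+ 2 ℤ.* x ℤ.- y) ≡ + 5 ℤ.* y
      l₄ = solve-∀
    norm : ∀ s t → (+ 2 ℤ.* s ℤ.+ t) ℤ.* (+ 2 ℤ.* s ℤ.+ t) ℤ.+ (+ 2 ℤ.* t ℤ.- s) ℤ.* (+ 2 ℤ.* t ℤ.- s) ≡
      + 5 ℤ.* (s ℤ.* s ℤ.+ t ℤ.* t)
    norm = solve-∀
    -- Multiplication by 2 - i multiplies the test quantity y + 2x by 4 modulo 5. As 4 is a unit,
    -- `c₁` and `c₂` transfer divisibility in both directions.
    c₁ : ∀ s t → + 2 ℤ.* t ℤ.- s ℤ.+ + 2 ℤ.* (+ 2 ℤ.* s ℤ.+ t) ≡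
      + 4 ℤ.* (t ℤ.+ + 2 ℤ.* s) ℤ.+ (ℤ.- s) ℤ.* + 5
    c₁ = solve-∀
    c₂ : ∀ s t → t ℤ.+ + 2 ℤ.* s ≡ + 4 ℤ.* (+ 2 ℤ.* t ℤ.- s ℤ.+ + 2 ℤ.* (+ 2 ℤ.* s ℤ.+ t))
      ℤ.+ (ℤ.- (+ 3 ℤ.* t ℤ.+ + 2 ℤ.* s)) ℤ.* + 5
    c₂ = solve-∀
    to : ∀ xy → In xy → Out (f xy)
    to xy@(x , y) p@(eq , 5∤) = ℤ.*-cancelˡ-≡ (+ 5) _ _ (begin
      + 5 ℤ.* (s ℤ.* s ℤ.+ t ℤ.* t)       ≡⟨ norm s t ⟨
      _                                   ≡⟨ cong (λ (x , y) → x ℤ.* x ℤ.+ y ℤ.* y) (gf xy p) ⟩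
      x ℤ.* x ℤ.+ y ℤ.* y                 ≡⟨ eq ⟩
      + (5 ℕ.* n)                         ≡⟨ ℤ.pos-* 5 n ⟩
      + 5 ℤ.* + n                         ∎) ,
      λ 5∣ → 5∤ (subst (λ (x , y) → + 5 ℤ.∣ (y ℤ.+ + 2 ℤ.* x)) (gf xy p)
        (∣-combine (+ 4) (ℤ.- s) (c₁ s t) 5∣))
      where
      open ≡-Reasoning
      s = proj₁ (f xy)
      t = proj₂ (f xy)
    from : ∀ st → Out st → In (g st)
    from (s , t) (eq , 5∤) = trans (norm s t) (trans (cong (+ 5 ℤ.*_) eq) (sym (ℤ.pos-* 5 n))) ,
      λ 5∣ → 5∤ (∣-combine (+ 4) (ℤ.- (+ 3 ℤ.* t ℤ.+ + 2 ℤ.* s)) (c₂ s t) 5∣)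
    l₅ : ∀ s t → + 2 ℤ.* (+ 2 ℤ.* s ℤ.+ t) ℤ.- (+ 2 ℤ.* t ℤ.- s) ≡ + 5 ℤ.* s
    l₅ = solve-∀
    l₆ : ∀ s t → + 2 ℤ.* s ℤ.+ t ℤ.+ + 2 ℤ.* (+ 2 ℤ.* t ℤ.- s) ≡ + 5 ℤ.* t
    l₆ = solve-∀
    fg : ∀ st → Out st → f (g st) ≡ st
    fg (s , t) _ = cong₂ _,_ (quo-unique (+ 5) (l₅ s t)) (quo-unique (+ 5) (l₆ s t))
    εε-g : ∀ st → εε (g st) ≡ εε st
    εε-g (s , t) = begin
      ε (+ 2 ℤ.* s ℤ.+ t) ℤ.* ε (+ 2 ℤ.* t ℤ.- s)
        ≡⟨ cong₂ ℤ._*_ (ε-+ (+ 2 ℤ.* s) t) (ε-- (+ 2 ℤ.* t) s) ⟩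
      (ε (+ 2 ℤ.* s) ℤ.* ε t) ℤ.* (ε (+ 2 ℤ.* t) ℤ.* ε s)
        ≡⟨ cong₂ (λ a b → (a ℤ.* ε t) ℤ.* (b ℤ.* ε s)) (ε-double s) (ε-double t) ⟩
      (1ℤ ℤ.* ε t) ℤ.* (1ℤ ℤ.* ε s)
        ≡⟨ l₇ (ε s) (ε t) ⟩
      ε s ℤ.* ε t ∎
      where
      open ≡-Reasoning
      l₇ : ∀ a b → (1ℤ ℤ.* b) ℤ.* (1ℤ ℤ.* a) ≡ a ℤ.* b
      l₇ = solve-∀
    weight : ∀ xy → In xy → εε xy ≡ εε (f xy)
    weight xy p = trans (cong εε (sym (gf xy p))) (εε-g (f xy))

  part≈dilate : part ≈ dilate 5 (φ · φ)
  part≈dilate = dilate-unique part-quintuple part-empty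

-- At 5n, `part` is the full sum over norm n, while `rest` is the sum over norm n minus `part n`;
-- and `part` itself is the dilated series.
φ²-quintuple : extract 5 (φ · φ) ≈ κ (+ 2) · (φ · φ) ⊟ dilate 5 (φ · φ)
φ²-quintuple = coefficientwise λ n → begin
  (φ · φ) (5 ℕ.* n)                          ≡⟨ φ²-squares (5 ℕ.* n) ⟩
  ∑ᴱ (twoSquares (5 ℕ.* n)) εε          ≡⟨ ∑ᴱ-split (twoSquares (5 ℕ.* n)) by2+i? εε ⟩
  part (5 ℕ.* n) ℤ.+ rest (5 ℕ.* n)     ≡⟨ cong₂ ℤ._+_ (part-quintuple n) (rest-quintuple n) ⟩
  (φ · φ) n ℤ.+ rest n
    ≡⟨ lemma ((φ · φ) n) (part n) (rest n) (trans (φ²-squares n) (∑ᴱ-split (twoSquares n) by2+i? εε)) ⟩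
  + 2 ℤ.* (φ · φ) n ℤ.- part n
    ≡⟨ cong₂ (λ a b → a ℤ.- b) (sym (κ-· (+ 2) (φ · φ) n)) (at part≈dilate n) ⟩
  (κ (+ 2) · (φ · φ) ⊟ dilate 5 (φ · φ)) n        ∎
  where
  open ≡-Reasoning
  open Gaussian
  solved : ∀ p r → (p ℤ.+ r) ℤ.+ r ≡ + 2 ℤ.* (p ℤ.+ r) ℤ.- p
  solved = solve-∀
  lemma : ∀ a p r → a ≡ p ℤ.+ r → a ℤ.+ r ≡ + 2 ℤ.* a ℤ.- p
  lemma _ p r refl = solved p r

-- Squares modulo 4 and 5, and the coefficients of φ.

φ-zero : ∀ n → (∀ m → m ℕ.* m ≢ n) → φ n ≡ 0ℤ
φ-zero n ¬square = trans (φ-squares n)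
  (∑ᴱ-empty (squares n) λ x eq → ¬square ∣ x ∣ (ℤ.+-injective (trans (sym (square x)) eq)))

square-mod : ∀ k .{{_ : NonZero k}} m → (m ℕ.* m) % k ≡ ((m % k) ℕ.* (m % k)) % k
square-mod k m = %-distribˡ-* m m k

square-mod-5 : ∀ m → (m ℕ.* m) % 5 ≡ 0 ⊎ (m ℕ.* m) % 5 ≡ 1 ⊎ (m ℕ.* m) % 5 ≡ 4
square-mod-5 m = subst (λ r → r ≡ 0 ⊎ r ≡ 1 ⊎ r ≡ 4) (sym (square-mod 5 m)) (cases (m % 5) (m%n<n m 5))
  where
  cases : ∀ r → r ℕ.< 5 → (r ℕ.* r) % 5 ≡ 0 ⊎ (r ℕ.* r) % 5 ≡ 1 ⊎ (r ℕ.* r) % 5 ≡ 4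
  cases 0 _ = inj₁ refl
  cases 1 _ = inj₂ (inj₁ refl)
  cases 2 _ = inj₂ (inj₂ refl)
  cases 3 _ = inj₂ (inj₂ refl)
  cases 4 _ = inj₂ (inj₁ refl)
  cases (suc (suc (suc (suc (suc _))))) (ℕ.s≤s (ℕ.s≤s (ℕ.s≤s (ℕ.s≤s (ℕ.s≤s ())))))

square-mod-4 : ∀ m → (m ℕ.* m) % 4 ≡ 0 ⊎ (m ℕ.* m) % 4 ≡ 1
square-mod-4 m = subst (λ r → r ≡ 0 ⊎ r ≡ 1) (sym (square-mod 4 m)) (cases (m % 4) (m%n<n m 4))
  where
  cases : ∀ r → r ℕ.< 4 → (r ℕ.* r) % 4 ≡ 0 ⊎ (r ℕ.* r) % 4 ≡ 1
  cases 0 _ = inj₁ refl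
  cases 1 _ = inj₂ refl
  cases 2 _ = inj₁ refl
  cases 3 _ = inj₂ refl
  cases (suc (suc (suc (suc _)))) (ℕ.s≤s (ℕ.s≤s (ℕ.s≤s (ℕ.s≤s ()))))

φ-mod-5 : ∀ n → n % 5 ≢ 0 → n % 5 ≢ 1 → n % 5 ≢ 4 → φ n ≡ 0ℤ
φ-mod-5 n ≢0 ≢1 ≢4 = φ-zero n λ { m refl → [ ≢0 , [ ≢1 , ≢4 ]′ ]′ (square-mod-5 m) }

φ-mod-4 : ∀ n → n % 4 ≢ 0 → n % 4 ≢ 1 → φ n ≡ 0ℤ
φ-mod-4 n ≢0 ≢1 = φ-zero n λ { m refl → [ ≢0 , ≢1 ]′ (square-mod-4 m) }

-- A square divisible by 5 is divisible by 25, and the odd factor 5 in the root does not affect its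
-- sign.
φ-quintuple : extract 5 φ ≈ φ₅
φ-quintuple = dilate-unique multiple (λ {n} 5∤n → φ-zero (5 ℕ.* n) λ m eq → 5∤n (nonmultiple n m eq))
  where
  prime₅ : Prime 5
  prime₅ = from-yes (prime? 5)
  root : ∀ n m → m ℕ.* m ≡ 5 ℕ.* n → 5 ℕ.∣ m
  root n m eq = [ id , id ]′ (euclidsLemma m m prime₅ (subst (5 ℕ.∣_) (sym eq) (ℕ.m∣m*n n)))
  nonmultiple : ∀ n m → m ℕ.* m ≡ 5 ℕ.* n → 5 ℕ.∣ n
  nonmultiple n m eq with ℕ.divides k refl ← root n m eq =
    ℕ.divides (k ℕ.* k) (ℕ.*-cancelˡ-≡ n (k ℕ.* k ℕ.* 5) 5 (trans (sym eq) (lemma k)))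
    where
    lemma : ∀ k → k ℕ.* 5 ℕ.* (k ℕ.* 5) ≡ 5 ℕ.* (k ℕ.* k ℕ.* 5)
    lemma = ℕ.solve-∀
  multiple : ∀ n → extract 5 φ (5 ℕ.* n) ≡ φ n
  multiple n = trans (φ-squares (5 ℕ.* (5 ℕ.* n))) (trans
    (reindex (squares (5 ℕ.* (5 ℕ.* n))) (squares n) (quo (+ 5)) (+ 5 ℤ.*_) {ε} {ε} to from gf fg
      (λ x p → trans (cong ε (sym (gf x p))) (ε-quintuple (quo (+ 5) x))))
    (sym (φ-squares n)))
    where
    norm : ∀ s → + 5 ℤ.* s ℤ.* (+ 5 ℤ.* s) ≡ + 25 ℤ.* (s ℤ.* s)
    norm = solve-∀
    25n : + (5 ℕ.* (5 ℕ.* n)) ≡ + 25 ℤ.* + n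
    25n = trans (ℤ.pos-* 5 (5 ℕ.* n))
      (trans (cong (+ 5 ℤ.*_) (ℤ.pos-* 5 n)) (sym (ℤ.*-assoc (+ 5) (+ 5) (+ n))))
    gf : ∀ x → x ℤ.* x ≡ + (5 ℕ.* (5 ℕ.* n)) → + 5 ℤ.* quo (+ 5) x ≡ x
    gf x eq = quo-exact {+ 5} {x}
      (ℤ.∣ᵤ⇒∣ (root (5 ℕ.* n) ∣ x ∣ (ℤ.+-injective (trans (sym (square x)) eq))))
    fg : ∀ s → s ℤ.* s ≡ + n → quo (+ 5) (+ 5 ℤ.* s) ≡ s
    fg s _ = quo-unique (+ 5) refl
    to : ∀ x → x ℤ.* x ≡ + (5 ℕ.* (5 ℕ.* n)) → quo (+ 5) x ℤ.* quo (+ 5) x ≡ + n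
    to x eq = ℤ.*-cancelˡ-≡ (+ 25) (s ℤ.* s) (+ n)
      (trans (sym (norm s)) (trans (cong (λ y → y ℤ.* y) (gf x eq)) (trans eq 25n)))
      where s = quo (+ 5) x
    from : ∀ s → s ℤ.* s ≡ + n → + 5 ℤ.* s ℤ.* (+ 5 ℤ.* s) ≡ + (5 ℕ.* (5 ℕ.* n))
    from s eq = trans (norm s) (trans (cong (+ 25 ℤ.*_) eq) (sym 25n))

positiveRoots : ∀ n → Enum (λ x → x ℤ.* x ≡ + n × 0ℤ ℤ.< x)
positiveRoots n = squares n ∩ (0ℤ ℤ.<?_)

φ-positiveRoots : ∀ n → φ (suc n) ≡ + 2 ℤ.* ∑ᴱ (positiveRoots (suc n)) ε
φ-positiveRoots n = begin
  φ (suc n)                    ≡⟨ φ-squares (suc n) ⟩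
  ∑ᴱ (squares (suc n)) ε           ≡⟨ ∑ᴱ-split (squares (suc n)) (0ℤ ℤ.<?_) ε ⟩
  positive ℤ.+ ∑ᴱ negatives ε
    ≡⟨ cong (ℤ._+_ positive) (reindex negatives (positiveRoots (suc n)) ℤ.-_ ℤ.-_ {ε} {ε} to from
                                        (λ x _ → ℤ.neg-involutive x) (λ x _ → ℤ.neg-involutive x)
                                          (λ x _ → sym (ε-neg x))) ⟩
  positive ℤ.+ positive            ≡⟨ double positive ⟩
  + 2 ℤ.* positive                 ∎
  where
  open ≡-Reasoning
  negatives = squares (suc n) ∩ (λ x → ¬? (0ℤ ℤ.<? x))
  positive = ∑ᴱ (positiveRoots (suc n)) ε
  double : ∀ a → a ℤ.+ a ≡ + 2 ℤ.* a
  double = solve-∀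
  to : ∀ x → x ℤ.* x ≡ + suc n × ¬ 0ℤ ℤ.< x → ℤ.- x ℤ.* ℤ.- x ≡ + suc n × 0ℤ ℤ.< ℤ.- x
  to (+ zero)   (() , _)
  to +[1+ m ]   (_ , x≤0) = contradiction (ℤ.+<+ ℕ.z<s) x≤0
  to -[1+ m ]   (eq , _)  = eq , ℤ.+<+ ℕ.z<s
  from : ∀ x → x ℤ.* x ≡ + suc n × 0ℤ ℤ.< x → ℤ.- x ℤ.* ℤ.- x ≡ + suc n × ¬ 0ℤ ℤ.< ℤ.- x
  from +[1+ m ] (eq , _) = eq , λ ()
  from (+ zero) (() , _)

φ-even : ∀ n → + 2 ℤ.∣ φ (suc n)
φ-even n = divides (∑ᴱ (positiveRoots (suc n)) ε) (trans (φ-positiveRoots n) (ℤ.*-comm (+ 2) _))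

-- Rotation by 45°, i.e. multiplication by 1 + i.
φ²-double : ∀ n → (φ · φ) (2 ℕ.* n) ≡ sgn n ℤ.* (φ · φ) n
φ²-double n = begin
  (φ · φ) (2 ℕ.* n)                                    ≡⟨ φ²-squares (2 ℕ.* n) ⟩
  ∑ᴱ (twoSquares (2 ℕ.* n)) εε
    ≡⟨ reindex (twoSquares (2 ℕ.* n)) (twoSquares n) f g {εε} {λ xy → sgn n ℤ.* εε xy} to from gf fg weight
    ⟩
  ∑ᴱ (twoSquares n) (λ xy → sgn n ℤ.* εε xy)      ≡⟨ ∑ᴱ-* (twoSquares n) (sgn n) εε ⟩
  sgn n ℤ.* ∑ᴱ (twoSquares n) εε                  ≡⟨ cong (sgn n ℤ.*_) (φ²-squares n) ⟨
  sgn n ℤ.* (φ · φ) n                                  ∎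
  where
  open ≡-Reasoning
  f g : ℤ × ℤ → ℤ × ℤ
  f (x , y) = quo (+ 2) (x ℤ.+ y) , quo (+ 2) (x ℤ.- y)
  g (s , t) = s ℤ.+ t , s ℤ.- t
  In Out : ℤ × ℤ → Set
  In (x , y) = x ℤ.* x ℤ.+ y ℤ.* y ≡ + (2 ℕ.* n)
  Out (s , t) = s ℤ.* s ℤ.+ t ℤ.* t ≡ + n
  norm : ∀ s t → (s ℤ.+ t) ℤ.* (s ℤ.+ t) ℤ.+ (s ℤ.- t) ℤ.* (s ℤ.- t) ≡ + 2 ℤ.* (s ℤ.* s ℤ.+ t ℤ.* t)
  norm = solve-∀
  euclid₂ : ∀ a → + 2 ℤ.∣ a ℤ.* a → + 2 ℤ.∣ a
  euclid₂ a 2∣aa = ℤ.∣ᵤ⇒∣ ([ id ,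
    id ]′ (euclidsLemma ∣ a ∣ ∣ a ∣ (from-yes (prime? 2)) (subst (2 ℕ.∣_) (ℤ.abs-* a a) (ℤ.∣⇒∣ᵤ 2∣aa))))
  even : ∀ x y → In (x , y) → + 2 ℤ.∣ (x ℤ.+ y)
  even x y eq = euclid₂ (x ℤ.+ y) (∣-combine 1ℤ (x ℤ.* y) (lemma x y)
    (divides (+ n) (trans eq (trans (ℤ.pos-* 2 n) (ℤ.*-comm (+ 2) (+ n))))))
    where
    lemma : ∀ x y → (x ℤ.+ y) ℤ.* (x ℤ.+ y) ≡ 1ℤ ℤ.* (x ℤ.* x ℤ.+ y ℤ.* y) ℤ.+ x ℤ.* y ℤ.* + 2
    lemma = solve-∀
  gf : ∀ xy → In xy → g (f xy) ≡ xy
  gf (x , y) eq = cong₂ _,_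
    (ℤ.*-cancelˡ-≡ (+ 2) _ _ (trans (l₁ s t) (trans (cong₂ ℤ._+_ 2s 2t) (l₂ x y))))
    (ℤ.*-cancelˡ-≡ (+ 2) _ _ (trans (l₃ s t) (trans (cong₂ ℤ._-_ 2s 2t) (l₄ x y))))
    where
    s = quo (+ 2) (x ℤ.+ y)
    t = quo (+ 2) (x ℤ.- y)
    2s : + 2 ℤ.* s ≡ x ℤ.+ y
    2s = quo-exact (even x y eq)
    comb : ∀ x y → x ℤ.- y ≡ 1ℤ ℤ.* (x ℤ.+ y) ℤ.+ (ℤ.- y) ℤ.* + 2
    comb = solve-∀
    2t : + 2 ℤ.* t ≡ x ℤ.- y
    2t = quo-exact (∣-combine 1ℤ (ℤ.- y) (comb x y) (even x y eq))
    l₁ : ∀ s t → + 2 ℤ.* (s ℤ.+ t) ≡ + 2 ℤ.* s ℤ.+ + 2 ℤ.* t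
    l₁ = solve-∀
    l₂ : ∀ x y → (x ℤ.+ y) ℤ.+ (x ℤ.- y) ≡ + 2 ℤ.* x
    l₂ = solve-∀
    l₃ : ∀ s t → + 2 ℤ.* (s ℤ.- t) ≡ + 2 ℤ.* s ℤ.- + 2 ℤ.* t
    l₃ = solve-∀
    l₄ : ∀ x y → (x ℤ.+ y) ℤ.- (x ℤ.- y) ≡ + 2 ℤ.* y
    l₄ = solve-∀
  to : ∀ xy → In xy → Out (f xy)
  to xy@(x , y) eq = ℤ.*-cancelˡ-≡ (+ 2) _ _ (begin
    + 2 ℤ.* (s ℤ.* s ℤ.+ t ℤ.* t) ≡⟨ norm s t ⟨
    _                             ≡⟨ cong (λ (x , y) → x ℤ.* x ℤ.+ y ℤ.* y) (gf xy eq) ⟩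
    x ℤ.* x ℤ.+ y ℤ.* y           ≡⟨ eq ⟩
    + (2 ℕ.* n)                   ≡⟨ ℤ.pos-* 2 n ⟩
    + 2 ℤ.* + n                   ∎)
    where
    s = proj₁ (f xy)
    t = proj₂ (f xy)
  from : ∀ st → Out st → In (g st)
  from (s , t) eq = trans (norm s t) (trans (cong (+ 2 ℤ.*_) eq) (sym (ℤ.pos-* 2 n)))
  fg : ∀ st → Out st → f (g st) ≡ st
  fg (s , t) _ = cong₂ _,_ (quo-unique (+ 2) (l₅ s t)) (quo-unique (+ 2) (l₆ s t))
    where
    l₅ : ∀ s t → s ℤ.+ t ℤ.+ (s ℤ.- t) ≡ + 2 ℤ.* s
    l₅ = solve-∀
    l₆ : ∀ s t → s ℤ.+ t ℤ.- (s ℤ.- t) ≡ + 2 ℤ.* t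
    l₆ = solve-∀
  unit : ∀ st → Out st → εε (g st) ≡ sgn n ℤ.* εε st
  unit (s , t) eq = begin
    ε (s ℤ.+ t) ℤ.* ε (s ℤ.- t)               ≡⟨ cong₂ ℤ._*_ (ε-+ s t) (ε-- s t) ⟩
    (ε s ℤ.* ε t) ℤ.* (ε s ℤ.* ε t)           ≡⟨ cong (ℤ._* (ε s ℤ.* ε t)) norm-sign ⟨
    sgn n ℤ.* (ε s ℤ.* ε t)                   ∎
    where
    -- Since s² + t² and s + t have the same parity, one of the two equal factors ε s ε t may be
    -- renamed `sgn n`.
    norm-sign : sgn n ≡ ε s ℤ.* ε t
    norm-sign = begin
      ε (+ n)                                 ≡⟨ cong ε eq ⟨
      ε (s ℤ.* s ℤ.+ t ℤ.* t)                 ≡⟨ cong ε (cong₂ ℤ._+_ (square s) (square t)) ⟩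
      sgn (∣ s ∣ ℕ.* ∣ s ∣ ℕ.+ ∣ t ∣ ℕ.* ∣ t ∣) ≡⟨ sgn-+ (∣ s ∣ ℕ.* ∣ s ∣) (∣ t ∣ ℕ.* ∣ t ∣) ⟩
      sgn (∣ s ∣ ℕ.* ∣ s ∣) ℤ.* sgn (∣ t ∣ ℕ.* ∣ t ∣) ≡⟨ cong₂ ℤ._*_ (sgn-* ∣ s ∣) (sgn-* ∣ t ∣) ⟩
      ε s ℤ.* ε t                             ∎
  weight : ∀ xy → In xy → εε xy ≡ sgn n ℤ.* εε (f xy)
  weight xy p = trans (cong εε (sym (gf xy p))) (unit (f xy) (to xy p))

-- Divisor sums

Positive : ℤ → Set
Positive x = 0ℤ ℤ.< x

pattern pos = ℤ.+<+ (ℕ.s≤s ℕ.z≤n)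

Odd : ℤ → Set
Odd x = ε x ≡ -1ℤ

-- Positive divisors are kept as integers because Liouville's transformations subtract them from one
-- another.
Divisors : ℕ → ℤ × ℤ → Set
Divisors n (d , k) = Positive d × Positive k × Odd k × d ℤ.* k ≡ + n

divisors : ∀ n → Enum (Divisors n)
divisors n = carve (box n ⋉ λ _ → box n)
  (λ (d , k) → 0ℤ ℤ.<? d ×-dec 0ℤ ℤ.<? k ×-dec ε k ℤ.≟ -1ℤ ×-dec d ℤ.* k ℤ.≟ + n) bound
  where
  bound : ∀ dk → Divisors n dk → ∣ proj₁ dk ∣ ℕ.≤ n × ∣ proj₂ dk ∣ ℕ.≤ n
  bound (+[1+ d ] , +[1+ k ]) (pos , pos , _ , refl) = ℕ.m≤m*n (suc d) (suc k) , ℕ.m≤n*m (suc k) (suc d)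

-- Only odd codivisors occur because q^d/(1 - q^d) + q^d/(1 + q^d) is twice the sum of q^(dk) over
-- odd k > 0; this is what the product for φ contributes to its logarithmic derivative.
σ : Series
σ n = ∑ᴱ (divisors n) proj₁

pos-cancel₅ : ∀ x → Positive (+ 5 ℤ.* x) → Positive x
pos-cancel₅ x = ℤ.*-cancelˡ-<-nonNeg {0ℤ} {x} (+ 5)

pos-scale₅ : ∀ x → Positive x → Positive (+ 5 ℤ.* x)
pos-scale₅ x = ℤ.*-monoˡ-<-pos (+ 5)

module HeckeDivisors where

  5∣d? : ∀ (dk : ℤ × ℤ) → Dec (+ 5 ℤ.∣ proj₁ dk)
  5∣d? (d , _) = + 5 ℤ.∣? d

  part rest : ℕ → ℤ
  part n = ∑ᴱ (divisors n ∩ 5∣d?) proj₁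
  rest n = ∑ᴱ (divisors n ∩ (λ dk → ¬? (5∣d? dk))) proj₁

  scaleˡ : ∀ d k n → d ℤ.* k ≡ + n → + 5 ℤ.* d ℤ.* k ≡ + (5 ℕ.* n)
  scaleˡ d k n eq = trans (ℤ.*-assoc (+ 5) d k) (trans (cong (+ 5 ℤ.*_) eq) (sym (ℤ.pos-* 5 n)))

  unscaleˡ : ∀ d k n → + 5 ℤ.* d ℤ.* k ≡ + (5 ℕ.* n) → d ℤ.* k ≡ + n
  unscaleˡ d k n eq = ℤ.*-cancelˡ-≡
    (+ 5) (d ℤ.* k) (+ n) (trans (sym (ℤ.*-assoc (+ 5) d k)) (trans eq (ℤ.pos-* 5 n)))

  commute : ∀ d k → d ℤ.* (+ 5 ℤ.* k) ≡ + 5 ℤ.* d ℤ.* k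
  commute = solve-∀

  part-quintuple : ∀ n → part (5 ℕ.* n) ≡ + 5 ℤ.* σ n
  part-quintuple n = trans
    (reindex (divisors (5 ℕ.* n) ∩ 5∣d?) (divisors n) f g {proj₁} {λ dk → + 5 ℤ.* proj₁ dk} to from gf fg
      (λ (d , k) (_ , 5∣d) → sym (quo-exact 5∣d)))
    (∑ᴱ-* (divisors n) (+ 5) proj₁)
    where
    f g : ℤ × ℤ → ℤ × ℤ
    f (d , k) = quo (+ 5) d , k
    g (d , k) = + 5 ℤ.* d , k
    In : ℤ × ℤ → Set
    In (d , k) = Divisors (5 ℕ.* n) (d , k) × + 5 ℤ.∣ d
    to : ∀ dk → In dk → Divisors n (f dk)
    to (d , k) ((0<d , 0<k , odd , eq) , 5∣d) =
      pos-cancel₅ _ (subst Positive (sym (quo-exact 5∣d)) 0<d) , 0<k , odd ,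
      unscaleˡ (quo (+ 5) d) k n (trans (cong (ℤ._* k) (quo-exact 5∣d)) eq)
    from : ∀ dk → Divisors n dk → In (g dk)
    from (d , k) (0<d , 0<k , odd , eq) = (pos-scale₅ d 0<d , 0<k , odd , scaleˡ d k n eq) ,
      divides d (ℤ.*-comm (+ 5) d)
    gf : ∀ dk → In dk → g (f dk) ≡ dk
    gf (d , k) (_ , 5∣d) = cong (_, k) (quo-exact 5∣d)
    fg : ∀ dk → Divisors n dk → f (g dk) ≡ dk
    fg (d , k) _ = cong (_, k) (quo-unique (+ 5) refl)

  part-empty : ∀ {n} → ¬ 5 ℕ.∣ n → part n ≡ 0ℤ
  part-empty {n} 5∤n = ∑ᴱ-empty (divisors n ∩ 5∣d?) λ (d , k) ((_ , _ , _ , eq) , 5∣d) →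
    5∤n (ℤ.∣⇒∣ᵤ (subst (+ 5 ℤ.∣_) eq (ℤ.∣m⇒∣m*n k 5∣d)))

  rest-quintuple : ∀ n → rest (5 ℕ.* n) ≡ rest n
  rest-quintuple n =
    reindex (divisors (5 ℕ.* n) ∩ (λ dk → ¬? (5∣d? dk))) (divisors n ∩ (λ dk → ¬? (5∣d? dk))) f g {proj₁}
      {proj₁}
      to from gf fg (λ _ _ → refl)
    where
    f g : ℤ × ℤ → ℤ × ℤ
    f (d , k) = d , quo (+ 5) k
    g (d , k) = d , + 5 ℤ.* k
    In Out : ℤ × ℤ → Set
    In (d , k) = Divisors (5 ℕ.* n) (d , k) × ¬ + 5 ℤ.∣ d
    Out (d , k) = Divisors n (d , k) × ¬ + 5 ℤ.∣ d
    5∣k : ∀ d k → In (d , k) → + 5 ℤ.∣ k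
    5∣k d k ((_ , _ , _ , eq) , 5∤d) with euclid₅ d k
      (divides (+ n) (trans eq (trans (ℤ.pos-* 5 n) (ℤ.*-comm (+ 5) (+ n)))))
    ... | inj₁ 5∣d = contradiction 5∣d 5∤d
    ... | inj₂ p   = p
    to : ∀ dk → In dk → Out (f dk)
    to (d , k) p@((0<d , 0<k , odd , eq) , 5∤d) = let 5k = quo-exact (5∣k d k p) in
      (0<d , pos-cancel₅ _ (subst Positive (sym 5k) 0<k) ,
      trans (sym (ε-quintuple (quo (+ 5) k))) (trans (cong ε 5k) odd) ,
      unscaleˡ d (quo (+ 5) k) n (trans (sym (commute d (quo (+ 5) k))) (trans (cong (d ℤ.*_) 5k) eq))) ,
        5∤d
    from : ∀ dk → Out dk → In (g dk)
    from (d , k) ((0<d , 0<k , odd , eq) , 5∤d) =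
      (0<d , pos-scale₅ k 0<k , trans (ε-quintuple k) odd , trans (commute d k) (scaleˡ d k n eq)) , 5∤d
    gf : ∀ dk → In dk → g (f dk) ≡ dk
    gf (d , k) p = cong (d ,_) (quo-exact (5∣k d k p))
    fg : ∀ dk → Out dk → f (g dk) ≡ dk
    fg (d , k) _ = cong (d ,_) (quo-unique (+ 5) refl)

  5σ : Series
  5σ n = + 5 ℤ.* σ n

  part≈dilate : part ≈ dilate 5 5σ
  part≈dilate = dilate-unique part-quintuple part-empty

-- The weight-two Hecke relation at 5, with eigenvalue 1 + 5. Among dk = 5n, the pairs with 5
-- dividing d give 5σ(n); the others arise from dk = n with 5 not dividing d by k ↦ 5k, and these
-- sum to σ(n) - 5σ(n/5).
σ-quintuple : extract 5 σ ≈ κ (+ 6) · σ ⊟ κ (+ 5) · dilate 5 σ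
σ-quintuple = coefficientwise λ n → begin
  σ (5 ℕ.* n)                            ≡⟨ ∑ᴱ-split (divisors (5 ℕ.* n)) 5∣d? proj₁ ⟩
  part (5 ℕ.* n) ℤ.+ rest (5 ℕ.* n)      ≡⟨ cong₂ ℤ._+_ (part-quintuple n) (rest-quintuple n) ⟩
  + 5 ℤ.* σ n ℤ.+ rest n
    ≡⟨ lemma (σ n) (part n) (rest n) (∑ᴱ-split (divisors n) 5∣d? proj₁) ⟩
  + 6 ℤ.* σ n ℤ.- part n
    ≡⟨ cong₂ (λ a b → a ℤ.- b) (sym (κ-· (+ 6) σ n)) (at part≈5dilate n) ⟩
  (κ (+ 6) · σ ⊟ κ (+ 5) · dilate 5 σ) n ∎
  where
  open ≡-Reasoning
  open HeckeDivisors
  solved : ∀ p r → + 5 ℤ.* (p ℤ.+ r) ℤ.+ r ≡ + 6 ℤ.* (p ℤ.+ r) ℤ.- p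
  solved = solve-∀
  lemma : ∀ a p r → a ≡ p ℤ.+ r → + 5 ℤ.* a ℤ.+ r ≡ + 6 ℤ.* a ℤ.- p
  lemma _ p r refl = solved p r
  part≈5dilate : part ≈ κ (+ 5) · dilate 5 σ
  part≈5dilate = ≈-trans part≈dilate (≈-trans (dilate-cong {5} (coefficientwise λ n → sym (κ-· (+ 5) σ n)))
    (≈-trans (dilate-· {5} (κ (+ 5)) σ) (·-congʳ (dilate 5 σ) (dilate-κ {5} (+ 5)))))

-- Liouville's method

Triple : Set
Triple = ℤ × ℤ × ℤ

Triples : ℕ → Triple → Set
Triples n (x , d , k) = Positive d × Positive k × Odd k × x ℤ.* x ℤ.+ d ℤ.* k ≡ + n

triples : ∀ n → Enum (Triples n)
triples n = carve (box n ⋉ λ _ → box n ⋉ λ _ → box n)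
  (λ (x , d , k) → 0ℤ ℤ.<? d ×-dec 0ℤ ℤ.<? k ×-dec ε k ℤ.≟ -1ℤ ×-dec x ℤ.* x ℤ.+ d ℤ.* k ℤ.≟ + n) bound
  where
  bound : ∀ xdk → Triples n xdk → let (x , d , k) = xdk in ∣ x ∣ ℕ.≤ n × ∣ d ∣ ℕ.≤ n × ∣ k ∣ ℕ.≤ n
  bound (x , +[1+ d ] , +[1+ k ]) (pos , pos , _ , eq)
    with refl ← ℤ.+-injective (trans (sym (cong (ℤ._+ + (suc d ℕ.* suc k)) (square x))) eq) =
    ℕ.≤-trans (n≤n*n ∣ x ∣) (ℕ.m≤m+n _ (suc d ℕ.* suc k)) ,
    ℕ.≤-trans (ℕ.m≤m*n (suc d) (suc k)) (ℕ.m≤n+m _ (∣ x ∣ ℕ.* ∣ x ∣)) ,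
    ℕ.≤-trans (ℕ.m≤n*m (suc k) (suc d)) (ℕ.m≤n+m _ (∣ x ∣ ℕ.* ∣ x ∣))

φσ-triples : ∀ n → (φ · σ) n ≡ ∑ᴱ (triples n) (λ (x , d , k) → ε x ℤ.* d)
φσ-triples n = trans (·-cong {g = σ} {g′ = σ} φ-squares (λ _ → refl) n)
  (convolution squares divisors triples (λ x → ∣ x ∣ ℕ.* ∣ x ∣) deg-unique join part ε proj₁ n)
  where
  deg-unique : ∀ i x → x ℤ.* x ≡ + i → i ≡ ∣ x ∣ ℕ.* ∣ x ∣
  deg-unique i x eq = ℤ.+-injective (trans (sym eq) (square x))
  join : ∀ i j x dk → x ℤ.* x ≡ + i → Divisors j dk → Triples (i ℕ.+ j) (x , dk)
  join _ _ _ _ eq (0<d , 0<k , odd , eq′) = 0<d , 0<k , odd , cong₂ ℤ._+_ eq eq′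
  part : ∀ n x dk → Triples n (x , dk) →
    ∃ λ j → ∣ x ∣ ℕ.* ∣ x ∣ ℕ.+ j ≡ n × x ℤ.* x ≡ + (∣ x ∣ ℕ.* ∣ x ∣) × Divisors j dk
  part n x (+[1+ d ] , +[1+ k ]) (pos , pos , odd , eq) = suc d ℕ.* suc k ,
    ℤ.+-injective (trans (sym (cong (ℤ._+ + (suc d ℕ.* suc k)) (square x))) eq) , square x , pos , pos ,
      odd , refl

negation-fixed : ∀ i → i ≡ ℤ.- i → i ≡ 0ℤ
negation-fixed (+ zero) _  = refl
negation-fixed +[1+ n ] ()
negation-fixed -[1+ n ] ()

odd-half : ∀ n → sgn n ≡ -1ℤ → n ≡ suc (2 ℕ.* ⌊ n /2⌋)
odd-half (suc zero)    _   = refl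
odd-half (suc (suc n)) odd = cong (suc ∘ suc) (trans (odd-half n (trans (sym (sgn-suc-suc n)) odd))
  (sym (ℕ.+-suc ⌊ n /2⌋ _)))

half-odd : ∀ j → ⌊ suc (2 ℕ.* j) /2⌋ ≡ j
half-odd zero    = refl
half-odd (suc j) = cong suc (trans (cong ⌊_/2⌋ (ℕ.+-suc j (j ℕ.+ 0))) (half-odd j))

∑ᴱ-below-const : ∀ m c → ∑ᴱ (below m) (λ _ → c) ≡ + m ℤ.* c
∑ᴱ-below-const m c = trans (∑ᴱ-const (below m) c) (cong (ℤ._* c) (go m id))
  where
  go : ∀ m (f : ℕ → ℕ) → sumOver (λ _ → 1ℤ) (applyUpTo f m) ≡ + m
  go zero    f = refl
  go (suc m) f = cong (ℤ._+_ 1ℤ) (go m (f ∘ suc))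

-- The sum of (−1)ˣ d over all x² + dk = n with d, k > 0 and k odd equals that of (−1)ˣ (d + x).
-- Triples with d + 2x ≠ k cancel under transformations preserving x² + dk.
module Liouville (n : ℕ) where

  T = triples n

  gap : Triple → ℤ
  gap (x , d , k) = d ℤ.+ + 2 ℤ.* x ℤ.- k

  -- `W` is the weight ε x · d occurring in φσ plus `X`, which is odd in x and so sums to 0. The
  -- point of d + x is that the transformation above the boundary preserves it and those below turn
  -- it, up to sign, into the new x.
  W X : Triple → ℤ
  W (x , d , k) = ε x ℤ.* (d ℤ.+ x)
  X (x , d , k) = ε x ℤ.* x

  Above Below Level Even : Triple → Set
  Above t = Positive (gap t)
  Below t = Positive (ℤ.- gap t)
  Level t = gap t ≡ 0ℤ
  Even (x , d , k) = ε d ≡ 1ℤ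

  above? : ∀ t → Dec (Above t)
  above? t = 0ℤ ℤ.<? gap t
  below? : ∀ t → Dec (Below t)
  below? t = 0ℤ ℤ.<? (ℤ.- gap t)
  level? : ∀ t → Dec (Level t)
  level? t = gap t ℤ.≟ 0ℤ
  even? : ∀ t → Dec (Even t)
  even? (x , d , k) = ε d ℤ.≟ 1ℤ

  reflect : Triple → Triple
  reflect (x , d , k) = ℤ.- x , d , k

  reflect-involutive : ∀ t → reflect (reflect t) ≡ t
  reflect-involutive (x , d , k) = cong (_, d , k) (ℤ.neg-involutive x)

  reflect-T : ∀ t → Triples n t → Triples n (reflect t)
  reflect-T (x , d , k) (0<d , 0<k , odd , eq) = 0<d , 0<k , odd , trans (lemma x (d ℤ.* k)) eq
    where
    lemma : ∀ x y → ℤ.- x ℤ.* ℤ.- x ℤ.+ y ≡ x ℤ.* x ℤ.+ y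
    lemma = solve-∀

  X-reflect : ∀ t → X t ≡ ℤ.- X (reflect t)
  X-reflect (x , d , k) = trans (lemma (ε x) x) (cong (λ e → ℤ.- (e ℤ.* ℤ.- x)) (sym (ε-neg x)))
    where
    lemma : ∀ e x → e ℤ.* x ≡ ℤ.- (e ℤ.* ℤ.- x)
    lemma = solve-∀

  ∑X≡0 : ∑ᴱ T X ≡ 0ℤ
  ∑X≡0 = negation-fixed _ (trans
    (reindex T T reflect reflect {X} {λ t → ℤ.- X t} reflect-T reflect-T (λ t _ → reflect-involutive t)
      (λ t _ → reflect-involutive t) (λ t _ → X-reflect t))
    (∑ᴱ-neg T X))

  ∑X-even≡0 : ∑ᴱ (T ∩ even?) X ≡ 0ℤ
  ∑X-even≡0 = negation-fixed _ (trans
    (reindex (T ∩ even?) (T ∩ even?) reflect reflect {X} {λ t → ℤ.- X t}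
      (λ t (p , e) → reflect-T t p , e) (λ t (p , e) → reflect-T t p , e)
      (λ t _ → reflect-involutive t) (λ t _ → reflect-involutive t) (λ t _ → X-reflect t))
    (∑ᴱ-neg (T ∩ even?) X))

  gap-split : ∀ (w : Triple → ℤ) {P : Triple → Set} (E : Enum P) →
    ∑ᴱ E w ≡ ∑ᴱ (E ∩ above?) w ℤ.+ (∑ᴱ (E ∩ level?) w ℤ.+ ∑ᴱ (E ∩ below?) w)
  gap-split w {P} E = begin
    ∑ᴱ E w ≡⟨ ∑ᴱ-split E above? w ⟩
    ∑ᴱ (E ∩ above?) w ℤ.+ ∑ᴱ E′ w ≡⟨ cong (ℤ._+_ (∑ᴱ (E ∩ above?) w)) (∑ᴱ-split E′ level? w) ⟩
    ∑ᴱ (E ∩ above?) w ℤ.+ (∑ᴱ (E′ ∩ level?) w ℤ.+ ∑ᴱ (E′ ∩ (λ t → ¬? (level? t))) w)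
      ≡⟨ cong (ℤ._+_ (∑ᴱ (E ∩ above?) w)) (cong₂ ℤ._+_
           (same (E′ ∩ level?) (E ∩ level?) (λ _ ((p , _) , l) → p , l) level)
           (same (E′ ∩ (λ t → ¬? (level? t))) (E ∩ below?) remaining below′)) ⟩
    ∑ᴱ (E ∩ above?) w ℤ.+ (∑ᴱ (E ∩ level?) w ℤ.+ ∑ᴱ (E ∩ below?) w) ∎
    where
    open ≡-Reasoning
    E′ = E ∩ (λ t → ¬? (above? t))
    level : ∀ t → P t × Level t → (P t × ¬ Above t) × Level t
    level t (p , l) = (p , λ a → ℤ.<-irrefl (sym l) a) , l
    remaining : ∀ t → (P t × ¬ Above t) × ¬ Level t → P t × Below t
    remaining t ((p , ¬a) , ¬l) with ℤ.<-cmp 0ℤ (gap t)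
    ... | tri< a _ _ = contradiction a ¬a
    ... | tri≈ _ l _ = contradiction (sym l) ¬l
    ... | tri> _ _ b = p , ℤ.neg-mono-< b
    below′ : ∀ t → P t × Below t → (P t × ¬ Above t) × ¬ Level t
    below′ t (p , b) = (p , λ a → ℤ.<-asym a (ℤ.neg-cancel-< b)) , λ l → ℤ.<-irrefl (sym (cong ℤ.-_ l)) b

  -- (x, d, k) ↦ (k − x, d + 2x − k, k) preserves x² + dk and d + x but flips (−1)ˣ, since k is odd.
  above≡0 : ∑ᴱ (T ∩ above?) W ≡ 0ℤ
  above≡0 = negation-fixed _ (trans
    (reindex (T ∩ above?) (T ∩ above?) f f {W} {λ t → ℤ.- W t} to to (λ t _ → ff t) (λ t _ → ff t) weight)
    (∑ᴱ-neg (T ∩ above?) W))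
    where
    f : Triple → Triple
    f t@(x , d , k) = k ℤ.- x , gap t , k
    ff : ∀ t → f (f t) ≡ t
    ff (x , d , k) = cong₂ (λ a b → a , b , k) (l₁ x k) (l₂ x d k)
      where
      l₁ : ∀ x k → k ℤ.- (k ℤ.- x) ≡ x
      l₁ = solve-∀
      l₂ : ∀ x d k → (d ℤ.+ + 2 ℤ.* x ℤ.- k) ℤ.+ + 2 ℤ.* (k ℤ.- x) ℤ.- k ≡ d
      l₂ = solve-∀
    to : ∀ t → Triples n t × Above t → Triples n (f t) × Above (f t)
    to t@(x , d , k) ((0<d , 0<k , odd , eq) , a) = (a , 0<k , odd , trans (l₁ x d k) eq) ,
      subst Positive (sym (cong (proj₁ ∘ proj₂) (ff t))) 0<d
      where
      l₁ : ∀ x d k → (k ℤ.- x) ℤ.* (k ℤ.- x) ℤ.+ (d ℤ.+ + 2 ℤ.* x ℤ.- k) ℤ.* k ≡ x ℤ.* x ℤ.+ d ℤ.* k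
      l₁ = solve-∀
    weight : ∀ t → Triples n t × Above t → W t ≡ ℤ.- W (f t)
    weight (x , d , k) ((_ , _ , odd , _) , _) = trans (l₁ (ε x) x d k)
      (cong (λ e → ℤ.- (e ℤ.* (d ℤ.+ + 2 ℤ.* x ℤ.- k ℤ.+ (k ℤ.- x))))
        (sym (trans (ε-- k x) (cong (ℤ._* ε x) odd))))
      where
      l₁ : ∀ e x d k → e ℤ.* (d ℤ.+ x) ≡ ℤ.- (-1ℤ ℤ.* e ℤ.* (d ℤ.+ + 2 ℤ.* x ℤ.- k ℤ.+ (k ℤ.- x)))
      l₁ = solve-∀

  -- As k is odd, the gap and d have opposite parity. This decides which of the new entries produced
  -- from the gap may serve as odd codivisors.
  ε-gap : ∀ t → Triples n t → let (x , d , k) = t in ε (gap t) ≡ ℤ.- ε d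
  ε-gap (x , d , k) (_ , _ , odd , _) = begin
    ε (d ℤ.+ + 2 ℤ.* x ℤ.- k)             ≡⟨ ε-- (d ℤ.+ + 2 ℤ.* x) k ⟩
    ε (d ℤ.+ + 2 ℤ.* x) ℤ.* ε k
      ≡⟨ cong₂ ℤ._*_ (trans (ε-+ d (+ 2 ℤ.* x)) (cong (ε d ℤ.*_) (ε-double x))) odd ⟩
    ε d ℤ.* 1ℤ ℤ.* -1ℤ                    ≡⟨ lemma (ε d) ⟩
    ℤ.- ε d                               ∎
    where
    open ≡-Reasoning
    lemma : ∀ e → e ℤ.* 1ℤ ℤ.* -1ℤ ≡ ℤ.- e
    lemma = solve-∀

  ε-gap′ : ∀ t → Triples n t → let (x , d , k) = t in ε (ℤ.- gap t) ≡ ℤ.- ε d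
  ε-gap′ t p = trans (ε-neg (gap t)) (ε-gap t p)

  -- For even d the negated gap is odd and can replace k. The new first entry -(x + d) has the sign
  -- of x, so `W` becomes -`X`.
  below-even : ∑ᴱ (T ∩ below? ∩ even?) W ≡ ℤ.- ∑ᴱ (T ∩ below? ∩ even?) X
  below-even = trans
    (reindex (T ∩ below? ∩ even?) (T ∩ below? ∩ even?) f f {W} {λ t → ℤ.- X t} to to (λ t _ → ff t)
      (λ t _ → ff t) weight)
    (∑ᴱ-neg (T ∩ below? ∩ even?) X)
    where
    f : Triple → Triple
    f t@(x , d , k) = ℤ.- (x ℤ.+ d) , d , ℤ.- gap t
    ff : ∀ t → f (f t) ≡ t
    ff (x , d , k) = cong₂ (λ a b → a , d , b) (l₁ x d) (l₂ x d k)
      where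
      l₁ : ∀ x d → ℤ.- (ℤ.- (x ℤ.+ d) ℤ.+ d) ≡ x
      l₁ = solve-∀
      l₂ : ∀ x d k → ℤ.- (d ℤ.+ + 2 ℤ.* ℤ.- (x ℤ.+ d) ℤ.- ℤ.- (d ℤ.+ + 2 ℤ.* x ℤ.- k)) ≡ k
      l₂ = solve-∀
    to : ∀ t → (Triples n t × Below t) × Even t → (Triples n (f t) × Below (f t)) × Even (f t)
    to t@(x , d , k) ((p@(0<d , 0<k , odd , eq) , b) , e) =
      ((0<d , b , trans (ε-gap′ t p) (cong ℤ.-_ e) , trans (l₁ x d k) eq) ,
        subst Positive (sym (cong (proj₂ ∘ proj₂) (ff t))) 0<k) , e
      where
      l₁ : ∀ x d k → ℤ.- (x ℤ.+ d) ℤ.* ℤ.- (x ℤ.+ d) ℤ.+ d ℤ.* ℤ.- (d ℤ.+ + 2 ℤ.* x ℤ.- k) ≡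
        x ℤ.* x ℤ.+ d ℤ.* k
      l₁ = solve-∀
    weight : ∀ t → (Triples n t × Below t) × Even t → W t ≡ ℤ.- X (f t)
    weight (x , d , k) (_ , e) = trans (l₁ (ε x) x d)
      (cong (λ e → ℤ.- (e ℤ.* ℤ.- (x ℤ.+ d)))
        (sym (trans (ε-neg (x ℤ.+ d)) (trans (ε-+ x d) (cong (ε x ℤ.*_) e)))))
      where
      l₁ : ∀ e x d → e ℤ.* (d ℤ.+ x) ≡ ℤ.- (e ℤ.* 1ℤ ℤ.* ℤ.- (x ℤ.+ d))
      l₁ = solve-∀

  not-even : ∀ d → ¬ ε d ≡ 1ℤ → ε d ≡ -1ℤ
  not-even d ¬e = [ (λ e → contradiction e ¬e) , id ]′ (sgn-cases ∣ d ∣)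

  -- For odd d the negated gap is even, so the roles change: it becomes the new d, and the old d
  -- becomes the odd codivisor. The image lies above the boundary, with d even, and `W` again
  -- becomes -`X`.
  below-odd : ∑ᴱ (T ∩ below? ∩ (λ t → ¬? (even? t))) W ≡ ℤ.- ∑ᴱ (T ∩ above? ∩ even?) X
  below-odd = trans
    (reindex (T ∩ below? ∩ (λ t → ¬? (even? t))) (T ∩ above? ∩ even?) f g {W} {λ t → ℤ.- X t} to from
      (λ t _ → gf t) (λ t _ → fg t) weight)
    (∑ᴱ-neg (T ∩ above? ∩ even?) X)
    where
    f g : Triple → Triple
    f t@(x , d , k) = x ℤ.+ d , ℤ.- gap t , d
    g t@(x , d , k) = x ℤ.- k , k , gap t
    gf : ∀ t → g (f t) ≡ t
    gf (x , d , k) = cong₂ (λ a b → a , d , b) (l₁ x d) (l₂ x d k)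
      where
      l₁ : ∀ x d → x ℤ.+ d ℤ.- d ≡ x
      l₁ = solve-∀
      l₂ : ∀ x d k → ℤ.- (d ℤ.+ + 2 ℤ.* x ℤ.- k) ℤ.+ + 2 ℤ.* (x ℤ.+ d) ℤ.- d ≡ k
      l₂ = solve-∀
    fg : ∀ t → f (g t) ≡ t
    fg (x , d , k) = cong₂ (λ a b → a , b , k) (l₁ x k) (l₂ x d k)
      where
      l₁ : ∀ x d → x ℤ.- d ℤ.+ d ≡ x
      l₁ = solve-∀
      l₂ : ∀ x d k → ℤ.- (k ℤ.+ + 2 ℤ.* (x ℤ.- k) ℤ.- (d ℤ.+ + 2 ℤ.* x ℤ.- k)) ≡ d
      l₂ = solve-∀
    to : ∀ t → (Triples n t × Below t) × ¬ Even t → (Triples n (f t) × Above (f t)) × Even (f t)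
    to t@(x , d , k) ((p@(0<d , 0<k , odd , eq) , b) , ¬e) =
      ((b , 0<d , not-even d ¬e , trans (l₁ x d k) eq) , subst Positive (sym (cong (proj₂ ∘ proj₂) (gf t)))
        0<k) ,
      trans (ε-gap′ t p) (cong ℤ.-_ (not-even d ¬e))
      where
      l₁ : ∀ x d k → (x ℤ.+ d) ℤ.* (x ℤ.+ d) ℤ.+ ℤ.- (d ℤ.+ + 2 ℤ.* x ℤ.- k) ℤ.* d ≡ x ℤ.* x ℤ.+ d ℤ.* k
      l₁ = solve-∀
    from : ∀ t → (Triples n t × Above t) × Even t → (Triples n (g t) × Below (g t)) × ¬ Even (g t)
    from t@(x , d , k) ((p@(0<d , 0<k , odd , eq) , a) , e) =
      ((0<k , a , trans (ε-gap t p) (cong ℤ.-_ e) , trans (l₁ x d k) eq) ,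
        subst Positive (sym (cong (proj₁ ∘ proj₂) (fg t))) 0<d) ,
      λ e′ → contradiction (trans (sym odd) e′) λ ()
      where
      l₁ : ∀ x d k → (x ℤ.- k) ℤ.* (x ℤ.- k) ℤ.+ k ℤ.* (d ℤ.+ + 2 ℤ.* x ℤ.- k) ≡ x ℤ.* x ℤ.+ d ℤ.* k
      l₁ = solve-∀
    weight : ∀ t → (Triples n t × Below t) × ¬ Even t → W t ≡ ℤ.- X (f t)
    weight (x , d , k) (_ , ¬e) = trans (l₁ (ε x) x d)
      (cong (λ e → ℤ.- (e ℤ.* (x ℤ.+ d))) (sym (trans (ε-+ x d) (cong (ε x ℤ.*_) (not-even d ¬e)))))
      where
      l₁ : ∀ e x d → e ℤ.* (d ℤ.+ x) ≡ ℤ.- (e ℤ.* -1ℤ ℤ.* (x ℤ.+ d))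
      l₁ = solve-∀

  -- The two halves together are minus the sum of `X` over all triples with even d, as none of these
  -- lies on the boundary; that sum vanishes by x ↦ -x.
  below≡0 : ∑ᴱ (T ∩ below?) W ≡ 0ℤ
  below≡0 = begin
    ∑ᴱ (T ∩ below?) W ≡⟨ ∑ᴱ-split (T ∩ below?) even? W ⟩
    ∑ᴱ (T ∩ below? ∩ even?) W ℤ.+ ∑ᴱ (T ∩ below? ∩ (λ t → ¬? (even? t))) W
      ≡⟨ cong₂ ℤ._+_ below-even below-odd ⟩
    ℤ.- c ℤ.+ ℤ.- a ≡⟨ lemma a c ⟩
    ℤ.- (a ℤ.+ (0ℤ ℤ.+ c)) ≡⟨ cong ℤ.-_ (begin
      a ℤ.+ (0ℤ ℤ.+ c) ≡⟨ cong₂ ℤ._+_ (same (T ∩ above? ∩ even?) (T ∩ even? ∩ above?) swap swap)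
           (cong₂ ℤ._+_ (sym (∑ᴱ-empty (T ∩ even? ∩ level?) noLevel))
             (same (T ∩ below? ∩ even?) (T ∩ even? ∩ below?) swap swap)) ⟩
      ∑ᴱ (T ∩ even? ∩ above?) X ℤ.+ (∑ᴱ (T ∩ even? ∩ level?) X ℤ.+ ∑ᴱ (T ∩ even? ∩ below?) X)
        ≡⟨ gap-split X (T ∩ even?) ⟨
      ∑ᴱ (T ∩ even?) X ≡⟨ ∑X-even≡0 ⟩
      0ℤ ∎) ⟩
    0ℤ ∎
    where
    open ≡-Reasoning
    a = ∑ᴱ (T ∩ above? ∩ even?) X
    c = ∑ᴱ (T ∩ below? ∩ even?) X
    lemma : ∀ a c → ℤ.- c ℤ.+ ℤ.- a ≡ ℤ.- (a ℤ.+ (0ℤ ℤ.+ c))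
    lemma = solve-∀
    swap : ∀ {P Q R : Triple → Set} t → (P t × Q t) × R t → (P t × R t) × Q t
    swap t ((p , q) , r) = (p , r) , q
    noLevel : ∀ t → ¬ ((Triples n t × Even t) × Level t)
    noLevel t ((p , e) , l) = contradiction (trans (sym (cong ε l)) (trans (ε-gap t p) (cong ℤ.-_ e))) λ ()

  Roots : ℤ → Set
  Roots s = s ℤ.* s ≡ + n × Positive s

  roots : Enum Roots
  roots = positiveRoots n

  positive-difference : ∀ a b → Positive (b ℤ.- a) → a ℤ.< b
  positive-difference a b p = subst₂ ℤ._<_ (ℤ.+-identityʳ a) (lemma a b) (ℤ.+-monoʳ-< a p)
    where
    lemma : ∀ a b → a ℤ.+ (b ℤ.- a) ≡ b
    lemma = solve-∀

  -- On the boundary, n = (x + d)² and d runs through the odd numbers between 0 and 2(x + d).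
  level-sum : ∑ᴱ (T ∩ level?) W ≡ ℤ.- (+ n ℤ.* ∑ᴱ roots ε)
  level-sum = begin
    ∑ᴱ (T ∩ level?) W
      ≡⟨ reindex (T ∩ level?) (roots ⋉ (λ s → below ∣ s ∣)) f g {W} {λ (s , _) → ℤ.- (ε s ℤ.* s)} to from gf
        fg weight ⟩
    ∑ᴱ (roots ⋉ (λ s → below ∣ s ∣)) (λ (s , _) → ℤ.- (ε s ℤ.* s))
      ≡⟨ ∑ᴱ-⋉ roots (λ s → below ∣ s ∣) (λ (s , _) → ℤ.- (ε s ℤ.* s)) ⟩
    ∑ᴱ roots (λ s → ∑ᴱ (below ∣ s ∣) (λ _ → ℤ.- (ε s ℤ.* s)))
      ≡⟨ ∑ᴱ-cong roots count ⟩
    ∑ᴱ roots (λ s → ℤ.- + n ℤ.* ε s)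
      ≡⟨ ∑ᴱ-* roots (ℤ.- + n) ε ⟩
    ℤ.- + n ℤ.* ∑ᴱ roots ε
      ≡⟨ ℤ.neg-distribˡ-* (+ n) (∑ᴱ roots ε) ⟨
    ℤ.- (+ n ℤ.* ∑ᴱ roots ε) ∎
    where
    open ≡-Reasoning
    count : ∀ s → Roots s → ∑ᴱ (below ∣ s ∣) (λ _ → ℤ.- (ε s ℤ.* s)) ≡ ℤ.- + n ℤ.* ε s
    count s (eq , 0<s) = begin
      ∑ᴱ (below ∣ s ∣) (λ _ → ℤ.- (ε s ℤ.* s)) ≡⟨ ∑ᴱ-below-const ∣ s ∣ (ℤ.- (ε s ℤ.* s)) ⟩
      + ∣ s ∣ ℤ.* ℤ.- (ε s ℤ.* s)              ≡⟨ cong (ℤ._* ℤ.- (ε s ℤ.* s)) (ℤ.0≤i⇒+∣i∣≡i (ℤ.<⇒≤ 0<s)) ⟩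
      s ℤ.* ℤ.- (ε s ℤ.* s)                    ≡⟨ lemma (ε s) s ⟩
      ℤ.- (s ℤ.* s) ℤ.* ε s                    ≡⟨ cong (λ m → ℤ.- m ℤ.* ε s) eq ⟩
      ℤ.- + n ℤ.* ε s                          ∎
      where
      lemma : ∀ e s → s ℤ.* ℤ.- (e ℤ.* s) ≡ ℤ.- (s ℤ.* s) ℤ.* e
      lemma = solve-∀
    odd : ℕ → ℤ
    odd j = 1ℤ ℤ.+ + 2 ℤ.* + j
    odd≡suc : ∀ j → odd j ≡ + suc (2 ℕ.* j)
    odd≡suc j = cong (ℤ._+_ 1ℤ) (sym (ℤ.pos-* 2 j))
    f : Triple → ℤ × ℕ
    f (x , d , k) = x ℤ.+ d , ⌊ ∣ d ∣ /2⌋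
    g : ℤ × ℕ → Triple
    g (s , j) = s ℤ.- odd j , odd j , + 2 ℤ.* s ℤ.- odd j
    k-from-level : ∀ x d k → Level (x , d , k) → k ≡ d ℤ.+ + 2 ℤ.* x
    k-from-level x d k l = sym (ℤ.i-j≡0⇒i≡j (d ℤ.+ + 2 ℤ.* x) k l)
    ε-level : ∀ t → Triples n t × Level t → ε (proj₁ (proj₂ t)) ≡ -1ℤ
    ε-level t@(x , d , k) (p , l) = trans (sym (ℤ.neg-involutive (ε d)))
      (cong ℤ.-_ (trans (sym (ε-gap t p)) (cong ε l)))
    odd-d : ∀ t → Triples n t × Level t → odd (proj₂ (f t)) ≡ proj₁ (proj₂ t)
    odd-d t@(x , +[1+ d ] , k) p@((pos , _) , _) =
      trans (odd≡suc ⌊ suc d /2⌋) (cong +_ (sym (odd-half (suc d) (ε-level t p))))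
    gf : ∀ t → Triples n t × Level t → g (f t) ≡ t
    gf t@(x , d , k) p@(_ , l) = trans
      (cong (λ o → x ℤ.+ d ℤ.- o , o , + 2 ℤ.* (x ℤ.+ d) ℤ.- o) (odd-d t p))
      (cong₂ (λ a b → a , d , b) (l₁ x d) (trans (l₂ x d) (sym (k-from-level x d k l))))
      where
      l₁ : ∀ x d → x ℤ.+ d ℤ.- d ≡ x
      l₁ = solve-∀
      l₂ : ∀ x d → + 2 ℤ.* (x ℤ.+ d) ℤ.- d ≡ d ℤ.+ + 2 ℤ.* x
      l₂ = solve-∀
    fg : ∀ sj → Roots (proj₁ sj) × proj₂ sj ℕ.< ∣ proj₁ sj ∣ → f (g sj) ≡ sj
    fg (s , j) _ = cong₂ _,_ (l₁ s (odd j)) (trans (cong (λ o → ⌊ ∣ o ∣ /2⌋) (odd≡suc j)) (half-odd j))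
      where
      l₁ : ∀ s o → s ℤ.- o ℤ.+ o ≡ s
      l₁ = solve-∀
    to : ∀ t → Triples n t × Level t → Roots (proj₁ (f t)) × proj₂ (f t) ℕ.< ∣ proj₁ (f t) ∣
    to t@(x , d , k) p@((0<d , 0<k , _ , eq) , l) =
      (trans (trans (l₁ x d) (cong (λ k → x ℤ.* x ℤ.+ d ℤ.* k) (sym k≡))) eq , 0<s) , j<s
      where
      s = x ℤ.+ d
      j = ⌊ ∣ d ∣ /2⌋
      k≡ = k-from-level x d k l
      l₁ : ∀ x d → (x ℤ.+ d) ℤ.* (x ℤ.+ d) ≡ x ℤ.* x ℤ.+ d ℤ.* (d ℤ.+ + 2 ℤ.* x)
      l₁ = solve-∀
      l₂ : ∀ x d → d ℤ.+ + 2 ℤ.* x ℤ.+ d ≡ + 2 ℤ.* (x ℤ.+ d)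
      l₂ = solve-∀
      l₃ : ∀ x d → d ℤ.+ + 2 ℤ.* x ≡ + 2 ℤ.* (x ℤ.+ d) ℤ.- d
      l₃ = solve-∀
      0<s : Positive s
      0<s = ℤ.*-cancelˡ-<-nonNeg {0ℤ} {s} (+ 2) (subst Positive (trans (cong (ℤ._+ d) k≡) (l₂ x d))
        (ℤ.+-mono-< 0<k 0<d))
      odd<2s : odd j ℤ.< + 2 ℤ.* s
      odd<2s = subst (ℤ._< + 2 ℤ.* s) (sym (odd-d t p))
        (positive-difference d (+ 2 ℤ.* s) (subst Positive (trans k≡ (l₃ x d)) 0<k))
      -- From 2j < 2j + 1 = d < 2s, where d < 2s expresses the positivity of k = 2s - d.
      j<s : j ℕ.< ∣ s ∣
      j<s = ℤ.drop‿+<+ (subst (+ j ℤ.<_) (sym (ℤ.0≤i⇒+∣i∣≡i (ℤ.<⇒≤ 0<s)))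
        (ℤ.*-cancelˡ-<-nonNeg {+ j} {s} (+ 2) (ℤ.<-trans (ℤ.suc[i]≤j⇒i<j {+ 2 ℤ.* + j} ℤ.≤-refl) odd<2s)))
    from : ∀ sj → Roots (proj₁ sj) × proj₂ sj ℕ.< ∣ proj₁ sj ∣ → Triples n (g sj) × Level (g sj)
    from (+[1+ m ] , j) ((eq , pos) , ℕ.s≤s j≤m) =
      (subst Positive (sym (odd≡suc j)) pos , subst Positive (sym k≡) pos , odd-k , trans (l₁ s (odd j)) eq)
        , l₂ s (odd j)
      where
      s = +[1+ m ]
      -- With s = m + 1 and d = 2j + 1, the codivisor 2s - d equals 2(m - j) + 1, visibly odd and
      -- positive.
      r = m ℕ.∸ j
      l₁ : ∀ s o → (s ℤ.- o) ℤ.* (s ℤ.- o) ℤ.+ o ℤ.* (+ 2 ℤ.* s ℤ.- o) ≡ s ℤ.* s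
      l₁ = solve-∀
      l₂ : ∀ s o → o ℤ.+ + 2 ℤ.* (s ℤ.- o) ℤ.- (+ 2 ℤ.* s ℤ.- o) ≡ 0ℤ
      l₂ = solve-∀
      l₃ : ∀ j r → + 2 ℤ.* (1ℤ ℤ.+ (j ℤ.+ r)) ℤ.- (1ℤ ℤ.+ + 2 ℤ.* j) ≡ 1ℤ ℤ.+ + 2 ℤ.* r
      l₃ = solve-∀
      k≡ : + 2 ℤ.* s ℤ.- odd j ≡ + suc (2 ℕ.* r)
      k≡ = trans (cong (λ m → + 2 ℤ.* +[1+ m ] ℤ.- odd j) (sym (ℕ.m+[n∸m]≡n j≤m)))
        (trans (l₃ (+ j) (+ r)) (odd≡suc r))
      ε-odd : ∀ i → ε (odd i) ≡ -1ℤ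
      ε-odd i = trans (ε-+ 1ℤ (+ 2 ℤ.* + i)) (cong (-1ℤ ℤ.*_) (ε-double (+ i)))
      odd-k : Odd (+ 2 ℤ.* s ℤ.- odd j)
      odd-k = trans (cong ε (trans k≡ (sym (odd≡suc r)))) (ε-odd r)
    weight : ∀ t → Triples n t × Level t → W t ≡ ℤ.- (ε (proj₁ (f t)) ℤ.* proj₁ (f t))
    weight t@(x , d , k) p = trans (l₁ (ε x) x d)
      (cong (λ e → ℤ.- (e ℤ.* (x ℤ.+ d))) (sym (trans (ε-+ x d) (cong (ε x ℤ.*_) (ε-level t p)))))
      where
      l₁ : ∀ e x d → e ℤ.* (d ℤ.+ x) ≡ ℤ.- (e ℤ.* -1ℤ ℤ.* (x ℤ.+ d))
      l₁ = solve-∀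

  φσ-roots : (φ · σ) n ≡ ℤ.- (+ n ℤ.* ∑ᴱ roots ε)
  φσ-roots = begin
    (φ · σ) n                        ≡⟨ φσ-triples n ⟩
    ∑ᴱ T (λ (x , d , k) → ε x ℤ.* d)     ≡⟨ ℤ.+-identityʳ _ ⟨
    ∑ᴱ T (λ (x , d , k) → ε x ℤ.* d) ℤ.+ 0ℤ ≡⟨ cong (ℤ._+_ (∑ᴱ T (λ (x , d , k) → ε x ℤ.* d))) ∑X≡0 ⟨
    ∑ᴱ T (λ (x , d , k) → ε x ℤ.* d) ℤ.+ ∑ᴱ T X ≡⟨ ∑ᴱ-+ T (λ (x , d , k) → ε x ℤ.* d) X ⟨
    ∑ᴱ T (λ (x , d , k) → ε x ℤ.* d ℤ.+ ε x ℤ.* x)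
      ≡⟨ ∑ᴱ-cong T (λ (x , d , k) _ → sym (ℤ.*-distribˡ-+ (ε x) d x)) ⟩
    ∑ᴱ T W                               ≡⟨ gap-split W T ⟩
    ∑ᴱ (T ∩ above?) W ℤ.+ (∑ᴱ (T ∩ level?) W ℤ.+ ∑ᴱ (T ∩ below?) W)
      ≡⟨ cong₂ ℤ._+_ above≡0 (cong₂ ℤ._+_ level-sum below≡0) ⟩
    0ℤ ℤ.+ (ℤ.- (+ n ℤ.* ∑ᴱ roots ε) ℤ.+ 0ℤ) ≡⟨ trans (ℤ.+-identityˡ _) (ℤ.+-identityʳ _) ⟩
    ℤ.- (+ n ℤ.* ∑ᴱ roots ε)             ∎
    where open ≡-Reasoning

-- The logarithmic derivative of φ(−q) = ∏ (1 − qⁿ)/(1 + qⁿ).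
Λ : Series
Λ = κ (ℤ.- + 2) · σ

Θ-φ : Θ φ ≈ φ · Λ
Θ-φ = ≈-trans (coefficientwise scaled)
  (solve 2 (λ f s → con (ℤ.- + 2) :* (f :* s) := f :* (con (ℤ.- + 2) :* s)) ≈-refl φ σ)
  where
  scaled : Θ φ ≗ κ (ℤ.- + 2) · (φ · σ)
  scaled n = begin
    + n ℤ.* φ n                               ≡⟨ doubled n ⟩
    + n ℤ.* (+ 2 ℤ.* ∑ᴱ (positiveRoots n) ε)       ≡⟨ lemma (+ n) (∑ᴱ (positiveRoots n) ε) ⟩
    ℤ.- + 2 ℤ.* ℤ.- (+ n ℤ.* ∑ᴱ (positiveRoots n) ε) ≡⟨ cong (ℤ.- + 2 ℤ.*_) (Liouville.φσ-roots n) ⟨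
    ℤ.- + 2 ℤ.* (φ · σ) n                      ≡⟨ κ-· (ℤ.- + 2) (φ · σ) n ⟨
    (κ (ℤ.- + 2) · (φ · σ)) n                  ∎
    where
    open ≡-Reasoning
    doubled : ∀ n → + n ℤ.* φ n ≡ + n ℤ.* (+ 2 ℤ.* ∑ᴱ (positiveRoots n) ε)
    -- The coefficient φ(0) = 1 is not twice a sum over positive roots; the factor n = 0 makes the
    -- equation true here.
    doubled zero    = refl
    doubled (suc n) = cong (+ suc n ℤ.*_) (φ-positiveRoots n)
    lemma : ∀ m p → m ℤ.* (+ 2 ℤ.* p) ≡ ℤ.- + 2 ℤ.* ℤ.- (m ℤ.* p)
    lemma = solve-∀

-- The 5-dissection of φ(−q)

open import Relation.Binary.Reasoning.Setoid seriesSetoid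

·-cancelˡ : ∀ f {g h} → f 0 ≡ 1ℤ → f · g ≈ f · h → g ≈ h
·-cancelˡ f {g} {h} f₀≡1 eq = begin
  g               ≈⟨ recover g ⟨
  f⁻¹ · (f · g)   ≈⟨ ·-congˡ f⁻¹ eq ⟩
  f⁻¹ · (f · h)   ≈⟨ recover h ⟩
  h               ∎
  where
  f⁻¹ = 1ˢ ⊘ f
  recover : ∀ g → f⁻¹ · (f · g) ≈ g
  recover g = begin
    f⁻¹ · (f · g) ≈⟨ coefficientwise (·-assoc f⁻¹ f g) ⟨
    (f⁻¹ · f) · g ≈⟨ ·-congʳ g (coefficientwise λ n → trans (·-⊛ f⁻¹ f n) (⊘-⊛ 1ˢ f f₀≡1 n)) ⟩
    1ˢ · g        ≈⟨ coefficientwise (·-identityˡ g) ⟩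
    g             ∎

κ-cancel : ∀ c .{{_ : ℤ.NonZero c}} {f g} → κ c · f ≈ κ c · g → f ≈ g
κ-cancel c {f} {g} eq = coefficientwise λ n →
  ℤ.*-cancelˡ-≡ c (f n) (g n) (trans (sym (κ-· c f n)) (trans (at eq n) (κ-· c g n)))

↑-cong : ∀ k {f g} → f ≈ g → f ↑ k ≈ g ↑ k
↑-cong zero    eq = ≈-refl
↑-cong (suc k) eq = *-cong eq (↑-cong k eq)

1ˢ≈κ1 : 1ˢ ≈ κ 1ℤ
1ˢ≈κ1 = coefficientwise λ { zero → refl ; (suc n) → refl }

dilate-↑ : ∀ {m} .{{_ : NonZero m}} f k → dilate m (f ↑ k) ≈ dilate m f ↑ k
dilate-↑ {m} f zero = begin
  dilate m 1ˢ       ≈⟨ dilate-cong {m} 1ˢ≈κ1 ⟩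
  dilate m (κ 1ℤ)   ≈⟨ dilate-κ {m} 1ℤ ⟩
  κ 1ℤ              ≈⟨ 1ˢ≈κ1 ⟨
  1ˢ                ∎
dilate-↑ {m} f (suc k) = ≈-trans (dilate-· {m} f (f ↑ k)) (·-congˡ (dilate m f) (dilate-↑ {m} f k))

dilate-κ· : ∀ {m} .{{_ : NonZero m}} c f → dilate m (κ c · f) ≈ κ c · dilate m f
dilate-κ· {m} c f = ≈-trans (dilate-· {m} (κ c) f) (·-congʳ (dilate m f) (dilate-κ {m} c))

extract-κ· : ∀ m c f → extract m (κ c · f) ≈ κ c · extract m f
extract-κ· m c f = coefficientwise λ n → trans (κ-· c f (m ℕ.* n)) (sym (κ-· c (extract m f) n))

Θ-κ· : ∀ c f → Θ (κ c · f) ≈ κ c · Θ f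
Θ-κ· c f = begin
  Θ (κ c · f)                    ≈⟨ Θ-· (κ c) f ⟩
  Θ (κ c) · f ⊞ κ c · Θ f        ≈⟨ ⊞-congʳ (κ c · Θ f) (·-congʳ f (Θ-κ c)) ⟩
  0ˢ · f ⊞ κ c · Θ f             ≈⟨ ⊞-congʳ (κ c · Θ f) (coefficientwise (·-zeroˡ f)) ⟩
  0ˢ ⊞ κ c · Θ f                 ≈⟨ coefficientwise (λ n → ℤ.+-identityˡ ((κ c · Θ f) n)) ⟩
  κ c · Θ f                      ∎

Θ-↑ : ∀ f k → Θ (f ↑ suc k) ≈ κ (+ suc k) · (f ↑ k · Θ f)
Θ-↑ f zero = begin
  Θ (f · 1ˢ)              ≈⟨ Θ-· f 1ˢ ⟩
  Θ f · 1ˢ ⊞ f · Θ 1ˢ     ≈⟨ ⊞-congˡ (Θ f · 1ˢ) (·-congˡ f Θ1≈0) ⟩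
  Θ f · 1ˢ ⊞ f · κ 0ℤ     ≈⟨ ⊞-congʳ (f · κ 0ℤ) (·-congˡ (Θ f) 1ˢ≈κ1) ⟩
  Θ f · κ 1ℤ ⊞ f · κ 0ℤ   ≈⟨ solve 2 (λ f f′ → f′ :* con 1ℤ :+ f :* con 0ℤ := con 1ℤ :* (con 1ℤ :* f′))
    ≈-refl f (Θ f) ⟩
  κ 1ℤ · (κ 1ℤ · Θ f)     ≈⟨ ·-congˡ (κ 1ℤ) (·-congʳ (Θ f) 1ˢ≈κ1) ⟨
  κ 1ℤ · (1ˢ · Θ f)       ∎
  where
  Θ1≈0 : Θ 1ˢ ≈ κ 0ℤ
  Θ1≈0 = coefficientwise λ { zero → refl ; (suc n) → ℤ.*-zeroʳ (+ suc n) }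
Θ-↑ f (suc k) = begin
  Θ (f · f ↑ suc k)                                        ≈⟨ Θ-· f (f ↑ suc k) ⟩
  Θ f · f ↑ suc k ⊞ f · Θ (f ↑ suc k)
    ≈⟨ ⊞-congˡ (Θ f · f ↑ suc k) (·-congˡ f (Θ-↑ f k)) ⟩
  Θ f · f ↑ suc k ⊞ f · (κ (+ suc k) · (f ↑ k · Θ f))
    ≈⟨ solve 4 (λ f f′ p c → f′ :* (f :* p) :+ f :* (c :* (p :* f′)) := (con 1ℤ :+ c) :* ((f :* p) :* f′))
      ≈-refl f (Θ f) (f ↑ k) (κ (+ suc k)) ⟩
  (κ 1ℤ ⊞ κ (+ suc k)) · (f ↑ suc k · Θ f)                 ≈⟨ ·-congʳ (f ↑ suc k · Θ f) κ-suc ⟩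
  κ (+ suc (suc k)) · (f ↑ suc k · Θ f)                    ∎
  where
  κ-suc : κ 1ℤ ⊞ κ (+ suc k) ≈ κ (+ suc (suc k))
  κ-suc = coefficientwise λ { zero → refl ; (suc n) → refl }

-- The difference h satisfies Θ h = h M with M(0) = 0, so n h(n) involves only h(i) with i < n. As ℤ
-- has no torsion, h vanishes by strong induction.
logarithmic-unique : ∀ M {f g} → M 0 ≡ 0ℤ → Θ f ≈ f · M → Θ g ≈ g · M → f 0 ≡ g 0 → f ≈ g
logarithmic-unique M {f} {g} M₀≡0 Θf Θg f₀≡g₀ = coefficientwise λ n →
  ℤ.i-j≡0⇒i≡j (f n) (g n) (<-rec (λ n → h n ≡ 0ℤ) vanish n)
  where
  h = f ⊟ g
  Θh : Θ h ≈ h · M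
  Θh = begin
    Θ (f ⊟ g)         ≈⟨ Θ-⊞ f (⊝ g) ⟩
    Θ f ⊞ Θ (⊝ g)     ≈⟨ ⊞-congˡ (Θ f) (Θ-⊝ g) ⟩
    Θ f ⊟ Θ g         ≈⟨ ⊞-cong Θf (⊝-cong Θg) ⟩
    f · M ⊟ g · M     ≈⟨ solve 3 (λ f g m → f :* m :- g :* m := (f :- g) :* m) ≈-refl f g M ⟩
    h · M             ∎
  vanish : ∀ n → (∀ {i} → i ℕ.< n → h i ≡ 0ℤ) → h n ≡ 0ℤ
  vanish zero    _   = ℤ.i≡j⇒i-j≡0 f₀≡g₀
  vanish (suc n) rec = ℤ.*-cancelˡ-≡ (+ suc n) (h (suc n)) 0ℤ
    (trans (at Θh (suc n)) (trans (·-∑ h M (suc n)) (trans (∑ᴱ-zero (below (suc (suc n))) zeroTerm)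
      (sym (ℤ.*-zeroʳ (+ suc n))))))
    where
    zeroTerm : ∀ i → i ℕ.< suc (suc n) → h i ℤ.* M (suc n ℕ.∸ i) ≡ 0ℤ
    zeroTerm i (ℕ.s≤s i≤) with i ℕ.≟ suc n
    ... | yes refl = trans (cong (h (suc n) ℤ.*_) (trans (cong M (ℕ.n∸n≡0 n)) M₀≡0)) (ℤ.*-zeroʳ (h (suc n)))
    ... | no i≢    = cong (ℤ._* M (suc n ℕ.∸ i)) (rec (ℕ.≤∧≢⇒< i≤ i≢))

residue : (m : ℕ) .{{_ : NonZero m}} → ℕ → Series → Series
residue m r f n = if does (n % m ℕ.≟ r) then f n else 0ℤ

module _ {m : ℕ} .{{_ : NonZero m}} where

  Supp-residue : ∀ r f → Supp m r (residue m r f)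
  Supp-residue r f n n≢r = cong (λ b → if b then f n else 0ℤ) (dec-false (n % m ℕ.≟ r) n≢r)

  residue-eq : ∀ {r} f n → n % m ≡ r → residue m r f n ≡ f n
  residue-eq {r} f n n≡r = cong (λ b → if b then f n else 0ℤ) (dec-true (n % m ℕ.≟ r) n≡r)

-- The terms that U discards. As with `_≈_`, the record keeps the series visible to unification.
record Off (f : Series) : Set where
  constructor off
  field vanishes : extract 5 f ≈ 0ˢ
open Off public

infixr 5 _⊞ᴼ_
_⊞ᴼ_ : ∀ {f g} → Off f → Off g → Off (f ⊞ g)
off p ⊞ᴼ off q = off (coefficientwise λ n → cong₂ ℤ._+_ (at p n) (at q n))

Off-· : ∀ {r s t f g} → (r ℕ.+ s) % 5 ≡ suc t → Supp 5 r f → Supp 5 s g → Off (f · g)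
Off-· {r} {s} {t} {f} {g} r+s F G =
  off (extract-Supp {5} {suc t} (λ ()) (Supp-· {5} {r} {s} {suc t} {f} {g} r+s F G))

extract-mod-Off : ∀ {f} g {h} → f ≈ g ⊞ h → Off h → extract 5 f ≈ extract 5 g
extract-mod-Off g f≈g+h (off p) = coefficientwise λ n →
  trans (at f≈g+h (5 ℕ.* n)) (trans (cong (ℤ._+_ (g (5 ℕ.* n))) (at p n)) (ℤ.+-identityʳ _))

a u v w : Series
a = residue 5 0 φ
u = residue 5 1 φ
v = residue 5 4 φ
w = extract 5 (u · v)

Supp-a : Supp 5 0 a
Supp-a = Supp-residue 0 φ
Supp-u : Supp 5 1 u
Supp-u = Supp-residue 1 φ
Supp-v : Supp 5 4 v
Supp-v = Supp-residue 4 φ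

φ-dissection : φ ≈ a ⊞ u ⊞ v
φ-dissection = coefficientwise split
  where
  split : ∀ n → φ n ≡ (a ⊞ u ⊞ v) n
  split n with n % 5 ℕ.≟ 0 | n % 5 ℕ.≟ 1 | n % 5 ℕ.≟ 4
  ... | yes n≡0 | _ | _ = sym
    (trans (cong₂ ℤ._+_ (cong₂ ℤ._+_ (residue-eq φ n n≡0)
    (Supp-u n (λ eq → contradiction (trans (sym n≡0) eq) λ ())))
      (Supp-v n (λ eq → contradiction (trans (sym n≡0) eq) λ ())))
        (trans (ℤ.+-identityʳ (φ n ℤ.+ 0ℤ)) (ℤ.+-identityʳ (φ n))))
  ... | no n≢0 | yes n≡1 | _ = sym (trans (cong₂ ℤ._+_ (cong₂ ℤ._+_ (Supp-a n n≢0) (residue-eq φ n n≡1))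
      (Supp-v n (λ eq → contradiction (trans (sym n≡1) eq) λ ())))
        (trans (ℤ.+-identityʳ (0ℤ ℤ.+ φ n)) (ℤ.+-identityˡ (φ n))))
  ... | no n≢0 | no n≢1 | yes n≡4 =
    sym (trans (cong₂ ℤ._+_ (cong₂ ℤ._+_ (Supp-a n n≢0) (Supp-u n n≢1)) (residue-eq φ n n≡4))
    (ℤ.+-identityˡ (φ n)))
  ... | no n≢0 | no n≢1 | no n≢4 = trans (φ-mod-5 n n≢0 n≢1 n≢4)
      (sym (cong₂ ℤ._+_ (cong₂ ℤ._+_ (Supp-a n n≢0) (Supp-u n n≢1)) (Supp-v n n≢4)))

a≈dilate : a ≈ dilate 5 φ₅
a≈dilate = ≈-trans (dilate-extract Supp-a) (dilate-cong {5} (≈-trans extract-a φ-quintuple))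
  where
  extract-a : extract 5 a ≈ extract 5 φ
  extract-a = coefficientwise λ n → residue-eq φ (5 ℕ.* n) (n∣m⇒m%n≡0 (5 ℕ.* n) 5 (m∣m*n n))

uv≈dilate : u · v ≈ dilate 5 w
uv≈dilate = dilate-extract (Supp-· refl Supp-u Supp-v)

Off-κ· : ∀ c {f} → Off f → Off (κ c · f)
Off-κ· c {f} (off p) = off (coefficientwise λ n →
  trans (κ-· c f (5 ℕ.* n)) (trans (cong (c ℤ.*_) (at p n)) (ℤ.*-zeroʳ c)))

extract-a· : ∀ f → extract 5 (a · f) ≈ φ₅ · extract 5 f
extract-a· f = ≈-trans (extract-cong 5 (·-congʳ f a≈dilate)) (extract-· {5} φ₅ f)

extract-a : extract 5 a ≈ φ₅
extract-a = ≈-trans (extract-cong 5 a≈dilate) (extract-dilate {5} φ₅)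

-- In (a + u + v)² only a² and 2uv have exponents divisible by 5, so φ₅² + 2w = U(φ²), and
-- `φ²-quintuple` evaluates the right side as 2φ² - φ₅².
w-value : w ≈ φ · φ ⊟ φ₅ · φ₅
w-value = κ-cancel (+ 2) (begin
  κ (+ 2) · w
    ≈⟨ solve 2 (λ p w → con (+ 2) :* w := (p :* p :+ con (+ 2) :* w) :- p :* p) ≈-refl φ₅ w ⟩
  (φ₅ · φ₅ ⊞ κ (+ 2) · w) ⊟ φ₅ · φ₅
    ≈⟨ ⊞-congʳ (⊝ (φ₅ · φ₅)) (begin
      φ₅ · φ₅ ⊞ κ (+ 2) · w
        ≈⟨ ⊞-cong (·-congˡ φ₅ extract-a) (extract-κ· 5 (+ 2) (u · v)) ⟨
      φ₅ · extract 5 a ⊞ extract 5 (κ (+ 2) · (u · v))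
        ≈⟨ ⊞-congʳ (extract 5 (κ (+ 2) · (u · v))) (extract-a· a) ⟨
      extract 5 (a · a ⊞ κ (+ 2) · (u · v))
        ≈⟨ extract-mod-Off (a · a ⊞ κ (+ 2) · (u · v)) dissected rest ⟨
      extract 5 (φ · φ)                                    ≈⟨ φ²-quintuple ⟩
      κ (+ 2) · (φ · φ) ⊟ dilate 5 (φ · φ)
        ≈⟨ ⊞-congˡ (κ (+ 2) · (φ · φ)) (⊝-cong (dilate-· {5} φ φ)) ⟩
      κ (+ 2) · (φ · φ) ⊟ φ₅ · φ₅                            ∎) ⟩
  (κ (+ 2) · (φ · φ) ⊟ φ₅ · φ₅) ⊟ φ₅ · φ₅
    ≈⟨ solve 2 (λ p f → (con (+ 2) :* (f :* f) :- p :* p) :- p :* p := con (+ 2) :* (f :* f :- p :* p))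
      ≈-refl φ₅ φ ⟩
  κ (+ 2) · (φ · φ ⊟ φ₅ · φ₅) ∎)
  where
  dissected : φ · φ ≈ (a · a ⊞ κ (+ 2) · (u · v))
    ⊞ (κ (+ 2) · (a · u) ⊞ (κ (+ 2) · (a · v) ⊞ (u · u ⊞ v · v)))
  dissected = ≈-trans (*-cong φ-dissection φ-dissection)
    (solve 3 (λ a u v → (a :+ u :+ v) :* (a :+ u :+ v) :=
      (a :* a :+ con (+ 2) :* (u :* v))
        :+ (con (+ 2) :* (a :* u) :+ (con (+ 2) :* (a :* v) :+ (u :* u :+ v :* v)))) ≈-refl a u v)
  rest : Off (κ (+ 2) · (a · u) ⊞ (κ (+ 2) · (a · v) ⊞ (u · u ⊞ v · v)))
  rest = Off-κ· (+ 2) (Off-· refl Supp-a Supp-u) ⊞ᴼ Off-κ· (+ 2) (Off-· refl Supp-a Supp-v)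
    ⊞ᴼ Off-· refl Supp-u Supp-u ⊞ᴼ Off-· refl Supp-v Supp-v

-- Among the cubic monomials in a, u, v only a³ and auv have exponents divisible by 5.
extract-φ³ : extract 5 (φ · (φ · φ)) ≈ φ₅ · (φ₅ · φ₅) ⊞ κ (+ 6) · (φ₅ · w)
extract-φ³ = begin
  extract 5 (φ · (φ · φ)) ≈⟨ extract-mod-Off (a · (a · a) ⊞ κ (+ 6) · (a · (u · v))) dissected rest ⟩
  extract 5 (a · (a · a)) ⊞ extract 5 (κ (+ 6) · (a · (u · v)))
    ≈⟨ ⊞-cong (≈-trans (extract-a· (a · a)) (·-congˡ φ₅ (≈-trans (extract-a· a) (·-congˡ φ₅ extract-a))))
              (≈-trans (extract-κ· 5 (+ 6) (a · (u · v))) (·-congˡ (κ (+ 6)) (extract-a· (u · v)))) ⟩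
  φ₅ · (φ₅ · φ₅) ⊞ κ (+ 6) · (φ₅ · w) ∎
  where
  others : Series
  others = κ (+ 3) · ((a · a) · u)
    ⊞ (κ (+ 3) · ((a · a) · v) ⊞ (κ (+ 3) · (a · (u · u)) ⊞ (κ (+ 3) · (a · (v · v))
    ⊞ (u · (u · u) ⊞ (κ (+ 3) · (u · (u · v)) ⊞ (κ (+ 3) · (u · (v · v)) ⊞ v · (v · v)))))))
  dissected : φ · (φ · φ) ≈ (a · (a · a) ⊞ κ (+ 6) · (a · (u · v))) ⊞ others
  dissected = ≈-trans (*-cong φ-dissection (*-cong φ-dissection φ-dissection))
    (solve 3 (λ a u v → let f = a :+ u :+ v in f :* (f :* f) :=
      (a :* (a :* a) :+ con (+ 6) :* (a :* (u :* v)))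
        :+ (con (+ 3) :* ((a :* a) :* u) :+ (con (+ 3) :* ((a :* a) :* v)
      :+ (con (+ 3) :* (a :* (u :* u))
        :+ (con (+ 3) :* (a :* (v :* v)) :+ (u :* (u :* u) :+ (con (+ 3) :* (u :* (u :* v))
      :+ (con (+ 3) :* (u :* (v :* v)) :+ v :* (v :* v)))))))))
      ≈-refl a u v)
  aa : Supp 5 0 (a · a)
  aa = Supp-· refl Supp-a Supp-a
  uu : Supp 5 2 (u · u)
  uu = Supp-· refl Supp-u Supp-u
  vv : Supp 5 3 (v · v)
  vv = Supp-· refl Supp-v Supp-v
  uv : Supp 5 0 (u · v)
  uv = Supp-· refl Supp-u Supp-v
  rest : Off others
  rest = Off-κ· (+ 3) (Off-· refl aa Supp-u) ⊞ᴼ Off-κ· (+ 3) (Off-· refl aa Supp-v)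
    ⊞ᴼ Off-κ· (+ 3) (Off-· refl Supp-a uu) ⊞ᴼ Off-κ· (+ 3) (Off-· refl Supp-a vv)
    ⊞ᴼ Off-· refl Supp-u uu ⊞ᴼ Off-κ· (+ 3) (Off-· refl Supp-u uv)
    ⊞ᴼ Off-κ· (+ 3) (Off-· refl Supp-u vv) ⊞ᴼ Off-· refl Supp-v vv

-- The norm of φ and its cofactor.

Supp-1 : Supp 5 0 1ˢ
Supp-1 zero    n≢0 = contradiction refl n≢0
Supp-1 (suc n) _   = refl

Supp-↑ : ∀ k {r f} → Supp 5 r f → Supp 5 ((k ℕ.* r) % 5) (f ↑ k)
Supp-↑ zero              s = Supp-1
Supp-↑ (suc k) {r} {f} s = Supp-· {5} {r} {(k ℕ.* r) % 5} {f = f} {f ↑ k} (sym reduce) s (Supp-↑ k s)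
  where
  reduce : (r ℕ.+ k ℕ.* r) % 5 ≡ (r ℕ.+ (k ℕ.* r) % 5) % 5
  reduce = trans (%-distribˡ-+ r (k ℕ.* r) 5)
    (trans (cong (λ x → (r % 5 ℕ.+ x) % 5) (sym (m%n%n≡m%n (k ℕ.* r) 5)))
    (sym (%-distribˡ-+ r ((k ℕ.* r) % 5) 5)))

-- `cofactor` is the product of a + ζu + ζ⁻¹v over the four fifth roots of unity ζ ≠ 1, sorted so
-- that `C₀` to `C₄` collect the exponents 0 to 4 modulo 5. `cofactor₀` is `C₀` read in q instead of
-- q⁵.
t C₀ C₁ C₂ C₃ C₄ cofactor Norm norm cofactor₀ : Series
t = u · v
C₀ = a ↑ 4 ⊟ κ (+ 3) · (a ↑ 2 · t) ⊞ t ↑ 2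
C₁ = v ↑ 4 ⊟ a ↑ 3 · u ⊞ κ (+ 2) · (a · (t · u))
C₂ = a ↑ 2 · u ↑ 2 ⊟ a · v ↑ 3 ⊟ t · u ↑ 2
C₃ = a ↑ 2 · v ↑ 2 ⊟ a · u ↑ 3 ⊟ t · v ↑ 2
C₄ = u ↑ 4 ⊟ a ↑ 3 · v ⊞ κ (+ 2) · (a · (t · v))
cofactor = C₀ ⊞ (C₁ ⊞ (C₂ ⊞ (C₃ ⊞ C₄)))
-- The norm ∏ (a + ζu + ζ⁻¹v) over the fifth roots of unity ζ.
Norm = a ↑ 5 ⊟ κ (+ 5) · (a ↑ 3 · t) ⊞ κ (+ 5) · (a · t ↑ 2) ⊞ (u ↑ 5 ⊞ v ↑ 5)
norm = extract 5 Norm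
cofactor₀ = φ₅ ↑ 4 ⊟ κ (+ 3) · (φ₅ ↑ 2 · w) ⊞ w ↑ 2

Supp-t : Supp 5 0 t
Supp-t = Supp-· refl Supp-u Supp-v

Supp-C₁ : Supp 5 1 C₁
Supp-C₁ = Supp-⊞ (Supp-⊟ (Supp-↑ 4 Supp-v) (Supp-· refl (Supp-↑ 3 Supp-a) Supp-u))
  (Supp-κ· (+ 2) (Supp-· refl Supp-a (Supp-· refl Supp-t Supp-u)))

Supp-C₂ : Supp 5 2 C₂
Supp-C₂ = Supp-⊟ (Supp-⊟ (Supp-· refl (Supp-↑ 2 Supp-a) (Supp-↑ 2 Supp-u))
  (Supp-· refl Supp-a (Supp-↑ 3 Supp-v)))
  (Supp-· refl Supp-t (Supp-↑ 2 Supp-u))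

Supp-C₃ : Supp 5 3 C₃
Supp-C₃ = Supp-⊟ (Supp-⊟ (Supp-· refl (Supp-↑ 2 Supp-a) (Supp-↑ 2 Supp-v))
  (Supp-· refl Supp-a (Supp-↑ 3 Supp-u)))
  (Supp-· refl Supp-t (Supp-↑ 2 Supp-v))

Supp-C₄ : Supp 5 4 C₄
Supp-C₄ = Supp-⊞ (Supp-⊟ (Supp-↑ 4 Supp-u) (Supp-· refl (Supp-↑ 3 Supp-a) Supp-v))
  (Supp-κ· (+ 2) (Supp-· refl Supp-a (Supp-· refl Supp-t Supp-v)))

Supp-C₀ : Supp 5 0 C₀
Supp-C₀ = Supp-⊞ (Supp-⊟ (Supp-↑ 4 Supp-a) (Supp-κ· (+ 3) (Supp-· refl (Supp-↑ 2 Supp-a) Supp-t)))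
  (Supp-↑ 2 Supp-t)

Supp-Norm : Supp 5 0 Norm
Supp-Norm = Supp-⊞ (Supp-⊞ (Supp-⊟ (Supp-↑ 5 Supp-a) (Supp-κ· (+ 5) (Supp-· refl (Supp-↑ 3 Supp-a) Supp-t)))
  (Supp-κ· (+ 5) (Supp-· refl Supp-a (Supp-↑ 2 Supp-t)))) (Supp-⊞ (Supp-↑ 5 Supp-u) (Supp-↑ 5 Supp-v))

Norm-factors : φ · cofactor ≈ Norm
Norm-factors = ≈-trans (·-congʳ cofactor φ-dissection) (factors a u v)
  where
  factors : ∀ a u v → let t = u · v in
    (a ⊞ u ⊞ v) · ((a ↑ 4 ⊟ κ (+ 3) · (a ↑ 2 · t) ⊞ t ↑ 2)
      ⊞ ((v ↑ 4 ⊟ a ↑ 3 · u ⊞ κ (+ 2) · (a · (t · u)))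
      ⊞ ((a ↑ 2 · u ↑ 2 ⊟ a · v ↑ 3 ⊟ t · u ↑ 2)
      ⊞ ((a ↑ 2 · v ↑ 2 ⊟ a · u ↑ 3 ⊟ t · v ↑ 2)
      ⊞ (u ↑ 4 ⊟ a ↑ 3 · v ⊞ κ (+ 2) · (a · (t · v)))))))
    ≈ a ↑ 5 ⊟ κ (+ 5) · (a ↑ 3 · t) ⊞ κ (+ 5) · (a · t ↑ 2) ⊞ (u ↑ 5 ⊞ v ↑ 5)
  factors = solve 3 (λ a u v → let t = u :* v in
    (a :+ u :+ v) :* ((a :^ 4 :- con (+ 3) :* (a :^ 2 :* t) :+ t :^ 2)
      :+ ((v :^ 4 :- a :^ 3 :* u :+ con (+ 2) :* (a :* (t :* u)))
      :+ ((a :^ 2 :* u :^ 2 :- a :* v :^ 3 :- t :* u :^ 2)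
      :+ ((a :^ 2 :* v :^ 2 :- a :* u :^ 3 :- t :* v :^ 2)
      :+ (u :^ 4 :- a :^ 3 :* v :+ con (+ 2) :* (a :* (t :* v)))))))
    := a :^ 5 :- con (+ 5) :* (a :^ 3 :* t) :+ con (+ 5) :* (a :* t :^ 2) :+ (u :^ 5 :+ v :^ 5)) ≈-refl

Norm≈dilate : Norm ≈ dilate 5 norm
Norm≈dilate = dilate-extract Supp-Norm

extract-cofactor : extract 5 cofactor ≈ cofactor₀
extract-cofactor = begin
  extract 5 cofactor ≈⟨ extract-mod-Off C₀ ≈-refl (Off-Supp Supp-C₁ ⊞ᴼ Off-Supp Supp-C₂ ⊞ᴼ Off-Supp Supp-C₃
    ⊞ᴼ Off-Supp Supp-C₄) ⟩
  extract 5 C₀       ≈⟨ extract-cong 5 C₀≈dilate ⟩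
  extract 5 (dilate 5 cofactor₀) ≈⟨ extract-dilate {5} cofactor₀ ⟩
  cofactor₀                  ∎
  where
  Off-Supp : ∀ {r f} → Supp 5 (suc r) f → Off f
  Off-Supp {r} {f} s = off (extract-Supp {5} {suc r} {f} (λ ()) s)
  C₀≈dilate : C₀ ≈ dilate 5 cofactor₀
  C₀≈dilate = begin
    a ↑ 4 ⊟ κ (+ 3) · (a ↑ 2 · t) ⊞ t ↑ 2
      ≈⟨ ⊞-cong (⊞-cong (↑-cong 4 a≈dilate)
        (⊝-cong (·-congˡ (κ (+ 3)) (*-cong (↑-cong 2 a≈dilate) uv≈dilate)))) (↑-cong 2 uv≈dilate) ⟩
    dilate 5 φ₅ ↑ 4 ⊟ κ (+ 3) · (dilate 5 φ₅ ↑ 2 · dilate 5 w) ⊞ dilate 5 w ↑ 2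
      ≈⟨ ⊞-cong (⊞-cong (dilate-↑ {5} φ₅ 4)
        (⊝-cong (·-congˡ (κ (+ 3)) (·-congʳ (dilate 5 w) (dilate-↑ {5} φ₅ 2))))) (dilate-↑ {5} w 2) ⟨
    dilate 5 (φ₅ ↑ 4) ⊟ κ (+ 3) · (dilate 5 (φ₅ ↑ 2) · dilate 5 w) ⊞ dilate 5 (w ↑ 2)
      ≈⟨ ⊞-congʳ (dilate 5 (w ↑ 2))
        (⊞-congˡ (dilate 5 (φ₅ ↑ 4))
        (⊝-cong (≈-trans (dilate-κ· {5} (+ 3) (φ₅ ↑ 2 · w)) (·-congˡ (κ (+ 3)) (dilate-· {5} (φ₅ ↑ 2) w)))))
        ⟨
    dilate 5 (φ₅ ↑ 4) ⊟ dilate 5 (κ (+ 3) · (φ₅ ↑ 2 · w)) ⊞ dilate 5 (w ↑ 2)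
      ≈⟨ ⊞-congʳ (dilate 5 (w ↑ 2)) (⊞-congˡ (dilate 5 (φ₅ ↑ 4)) (dilate-⊝ {5} (κ (+ 3) · (φ₅ ↑ 2 · w)))) ⟨
    dilate 5 (φ₅ ↑ 4) ⊞ dilate 5 (⊝ (κ (+ 3) · (φ₅ ↑ 2 · w))) ⊞ dilate 5 (w ↑ 2)
      ≈⟨ ⊞-congʳ (dilate 5 (w ↑ 2)) (dilate-⊞ {5} (φ₅ ↑ 4) (⊝ (κ (+ 3) · (φ₅ ↑ 2 · w)))) ⟨
    dilate 5 (φ₅ ↑ 4 ⊟ κ (+ 3) · (φ₅ ↑ 2 · w)) ⊞ dilate 5 (w ↑ 2)
      ≈⟨ dilate-⊞ {5} (φ₅ ↑ 4 ⊟ κ (+ 3) · (φ₅ ↑ 2 · w)) (w ↑ 2) ⟨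
    dilate 5 cofactor₀ ∎

-- The part of Θ φ · cofactor with exponents divisible by 5: each of Θ a, Θ u, Θ v meets the class
-- of `cofactor` complementary to its own.
diagonal : Series
diagonal = Θ a · C₀ ⊞ Θ u · C₄ ⊞ Θ v · C₁

-- The partial derivatives of the norm polynomial in a, u, v are 5C₀, 5C₄ and 5C₁. This is the trace
-- form of the derivative of a norm.
Θ-Norm : Θ Norm ≈ κ (+ 5) · diagonal
Θ-Norm = begin
  Θ Norm ≈⟨ Θ-⊞⊞ (Θ-⊞⊞ (Θ-⊟⊟ (Θ-↑ a 4) (Θ-κ·· (+ 5) (Θ-·· (a ↑ 3) t (Θ-↑ a 2) (Θ-· u v))))
           (Θ-κ·· (+ 5) (Θ-·· a (t ↑ 2) ≈-refl
             (≈-trans (Θ-↑ t 1) (·-congˡ (κ (+ 2)) (·-congˡ (t ↑ 1) (Θ-· u v)))))))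
         (Θ-⊞⊞ (Θ-↑ u 4) (Θ-↑ v 4)) ⟩
  κ (+ 5) · (a ↑ 4 · Θ a) ⊟ κ (+ 5) · ((κ (+ 3) · (a ↑ 2 · Θ a)) · t ⊞ a ↑ 3 · t′)
    ⊞ κ (+ 5) · (Θ a · t ↑ 2 ⊞ a · (κ (+ 2) · (t ↑ 1 · t′)))
    ⊞ (κ (+ 5) · (u ↑ 4 · Θ u) ⊞ κ (+ 5) · (v ↑ 4 · Θ v)) ≈⟨ collect a u v (Θ a) (Θ u) (Θ v) ⟩
  κ (+ 5) · diagonal ∎
  where
  t′ = Θ u · v ⊞ u · Θ v
  Θ-⊞⊞ : ∀ {f g f′ g′} → Θ f ≈ f′ → Θ g ≈ g′ → Θ (f ⊞ g) ≈ f′ ⊞ g′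
  Θ-⊞⊞ {f} {g} p q = ≈-trans (Θ-⊞ f g) (⊞-cong p q)
  Θ-⊟⊟ : ∀ {f g f′ g′} → Θ f ≈ f′ → Θ g ≈ g′ → Θ (f ⊟ g) ≈ f′ ⊟ g′
  Θ-⊟⊟ {f} {g} p q = ≈-trans (Θ-⊞ f (⊝ g)) (⊞-cong p (≈-trans (Θ-⊝ g) (⊝-cong q)))
  Θ-κ·· : ∀ cofactor₀ {f f′} → Θ f ≈ f′ → Θ (κ cofactor₀ · f) ≈ κ cofactor₀ · f′
  Θ-κ·· cofactor₀ {f} p = ≈-trans (Θ-κ· cofactor₀ f) (·-congˡ (κ cofactor₀) p)
  Θ-·· : ∀ f g {f′ g′} → Θ f ≈ f′ → Θ g ≈ g′ → Θ (f · g) ≈ f′ · g ⊞ f · g′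
  Θ-·· f g p q = ≈-trans (Θ-· f g) (⊞-cong (·-congʳ g p) (·-congˡ f q))
  collect : ∀ a u v a′ u′ v′ → let t = u · v ; t′ = u′ · v ⊞ u · v′ in
    κ (+ 5) · (a ↑ 4 · a′) ⊟ κ (+ 5) · ((κ (+ 3) · (a ↑ 2 · a′)) · t ⊞ a ↑ 3 · t′)
      ⊞ κ (+ 5) · (a′ · t ↑ 2 ⊞ a · (κ (+ 2) · (t ↑ 1 · t′)))
      ⊞ (κ (+ 5) · (u ↑ 4 · u′) ⊞ κ (+ 5) · (v ↑ 4 · v′))
    ≈ κ (+ 5) · (a′ · (a ↑ 4 ⊟ κ (+ 3) · (a ↑ 2 · t) ⊞ t ↑ 2)
      ⊞ u′ · (u ↑ 4 ⊟ a ↑ 3 · v ⊞ κ (+ 2) · (a · (t · v)))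
      ⊞ v′ · (v ↑ 4 ⊟ a ↑ 3 · u ⊞ κ (+ 2) · (a · (t · u))))
  collect = solve 6 (λ a u v a′ u′ v′ → let t = u :* v ; t′ = u′ :* v :+ u :* v′ in
    con (+ 5) :* (a :^ 4 :* a′) :- con (+ 5) :* ((con (+ 3) :* (a :^ 2 :* a′)) :* t :+ a :^ 3 :* t′)
      :+ con (+ 5) :* (a′ :* t :^ 2 :+ a :* (con (+ 2) :* (t :^ 1 :* t′)))
      :+ (con (+ 5) :* (u :^ 4 :* u′) :+ con (+ 5) :* (v :^ 4 :* v′))
    := con (+ 5) :* (a′ :* (a :^ 4 :- con (+ 3) :* (a :^ 2 :* t) :+ t :^ 2)
      :+ u′ :* (u :^ 4 :- a :^ 3 :* v :+ con (+ 2) :* (a :* (t :* v)))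
      :+ v′ :* (v :^ 4 :- a :^ 3 :* u :+ con (+ 2) :* (a :* (t :* u))))) ≈-refl

-- The Hecke relation for ā₅

extract-Λ : extract 5 Λ ≈ κ (+ 6) · Λ ⊟ κ (+ 5) · dilate 5 Λ
extract-Λ = begin
  extract 5 Λ ≈⟨ extract-κ· 5 (ℤ.- + 2) σ ⟩
  κ (ℤ.- + 2) · extract 5 σ ≈⟨ ·-congˡ (κ (ℤ.- + 2)) σ-quintuple ⟩
  κ (ℤ.- + 2) · (κ (+ 6) · σ ⊟ κ (+ 5) · dilate 5 σ)
    ≈⟨ regroup σ (dilate 5 σ) ⟩
  κ (+ 6) · Λ ⊟ κ (+ 5) · (κ (ℤ.- + 2) · dilate 5 σ)
    ≈⟨ ⊞-congˡ (κ (+ 6) · Λ) (⊝-cong (·-congˡ (κ (+ 5)) (dilate-κ· {5} (ℤ.- + 2) σ))) ⟨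
  κ (+ 6) · Λ ⊟ κ (+ 5) · dilate 5 Λ ∎
  where
  regroup : ∀ s d → κ (ℤ.- + 2) · (κ (+ 6) · s ⊟ κ (+ 5) · d) ≈ κ (+ 6) · (κ (ℤ.- + 2) · s) ⊟ κ
    (+ 5) · (κ (ℤ.- + 2) · d)
  regroup = solve 2 (λ s d → con (ℤ.- + 2) :* (con (+ 6) :* s :- con (+ 5) :* d) :=
    con (+ 6) :* (con (ℤ.- + 2) :* s) :- con (+ 5) :* (con (ℤ.- + 2) :* d)) ≈-refl

·-rotate : ∀ f g h → (f · g) · h ≈ (f · h) · g
·-rotate = solve 3 (λ f g h → (f :* g) :* h := (f :* h) :* g) ≈-refl

Θφ-cofactor : Θ φ · cofactor ≈ dilate 5 norm · Λ
Θφ-cofactor = begin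
  Θ φ · cofactor      ≈⟨ ·-congʳ cofactor Θ-φ ⟩
  (φ · Λ) · cofactor  ≈⟨ ·-rotate φ Λ cofactor ⟩
  (φ · cofactor) · Λ  ≈⟨ ·-congʳ Λ (≈-trans Norm-factors Norm≈dilate) ⟩
  dilate 5 norm · Λ      ∎

Θφ-dissection : Θ φ ≈ Θ a ⊞ Θ u ⊞ Θ v
Θφ-dissection = ≈-trans (Θ-cong φ-dissection) (≈-trans (Θ-⊞ (a ⊞ u) v) (⊞-congʳ (Θ v) (Θ-⊞ a u)))

extract-diagonal : extract 5 diagonal ≈ extract 5 (Θ φ · cofactor)
extract-diagonal = ≈-sym (extract-mod-Off diagonal dissected rest)
  where
  others : Series
  others = Θ a · C₁ ⊞ (Θ a · C₂ ⊞ (Θ a · C₃ ⊞ (Θ a · C₄ ⊞ (Θ u · C₀ ⊞ (Θ u · C₁ ⊞ (Θ u · C₂ ⊞ (Θ u · C₃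
    ⊞ (Θ v · C₀ ⊞ (Θ v · C₂ ⊞ (Θ v · C₃ ⊞ Θ v · C₄))))))))))
  expand : ∀ a u v c₀ c₁ c₂ c₃ c₄ → (a ⊞ u ⊞ v) · (c₀ ⊞ (c₁ ⊞ (c₂ ⊞ (c₃ ⊞ c₄)))) ≈
    (a · c₀ ⊞ u · c₄ ⊞ v · c₁)
    ⊞ (a · c₁ ⊞ (a · c₂ ⊞ (a · c₃ ⊞ (a · c₄ ⊞ (u · c₀ ⊞ (u · c₁ ⊞ (u · c₂ ⊞ (u · c₃
    ⊞ (v · c₀ ⊞ (v · c₂ ⊞ (v · c₃ ⊞ v · c₄)))))))))))
  expand = solve 8 (λ a u v c₀ c₁ c₂ c₃ c₄ → (a :+ u :+ v) :* (c₀ :+ (c₁ :+ (c₂ :+ (c₃ :+ c₄)))) :=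
    (a :* c₀ :+ u :* c₄ :+ v :* c₁)
    :+ (a :* c₁ :+ (a :* c₂ :+ (a :* c₃ :+ (a :* c₄ :+ (u :* c₀ :+ (u :* c₁ :+ (u :* c₂ :+ (u :* c₃
    :+ (v :* c₀ :+ (v :* c₂ :+ (v :* c₃ :+ v :* c₄)))))))))))) ≈-refl
  dissected : Θ φ · cofactor ≈ diagonal ⊞ others
  dissected = ≈-trans (·-congʳ cofactor Θφ-dissection) (expand (Θ a) (Θ u) (Θ v) C₀ C₁ C₂ C₃ C₄)
  A′ : Supp 5 0 (Θ a)
  A′ = Supp-Θ Supp-a
  U′ : Supp 5 1 (Θ u)
  U′ = Supp-Θ Supp-u
  V′ : Supp 5 4 (Θ v)
  V′ = Supp-Θ Supp-v
  rest : Off others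
  rest = Off-· refl A′ Supp-C₁ ⊞ᴼ Off-· refl A′ Supp-C₂ ⊞ᴼ Off-· refl A′ Supp-C₃ ⊞ᴼ Off-· refl A′ Supp-C₄
    ⊞ᴼ Off-· refl U′ Supp-C₀ ⊞ᴼ Off-· refl U′ Supp-C₁ ⊞ᴼ Off-· refl U′ Supp-C₂ ⊞ᴼ Off-· refl U′ Supp-C₃
    ⊞ᴼ Off-· refl V′ Supp-C₀ ⊞ᴼ Off-· refl V′ Supp-C₂ ⊞ᴼ Off-· refl V′ Supp-C₃ ⊞ᴼ Off-· refl V′ Supp-C₄

-- The 5 from the trace cancels the 5 that appears when Θ passes through U. What remains is U of
-- norm(q⁵) Λ, from which the norm is pulled out.
Θ-norm : Θ norm ≈ norm · extract 5 Λ
Θ-norm = κ-cancel (+ 5) (begin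
  κ (+ 5) · Θ norm                              ≈⟨ extract-Θ 5 Norm ⟨
  extract 5 (Θ Norm)                            ≈⟨ extract-cong 5 Θ-Norm ⟩
  extract 5 (κ (+ 5) · diagonal)             ≈⟨ extract-κ· 5 (+ 5) diagonal ⟩
  κ (+ 5) · extract 5 diagonal               ≈⟨ ·-congˡ (κ (+ 5)) extract-diagonal ⟩
  κ (+ 5) · extract 5 (Θ φ · cofactor)       ≈⟨ ·-congˡ (κ (+ 5)) (extract-cong 5 Θφ-cofactor) ⟩
  κ (+ 5) · extract 5 (dilate 5 norm · Λ)       ≈⟨ ·-congˡ (κ (+ 5)) (extract-· {5} norm Λ) ⟩
  κ (+ 5) · (norm · extract 5 Λ)                ∎)

Θ-φ₅ : Θ φ₅ ≈ κ (+ 5) · (φ₅ · dilate 5 Λ)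
Θ-φ₅ = ≈-trans (Θ-dilate 5 φ) (·-congˡ (κ (+ 5)) (≈-trans (dilate-cong {5} Θ-φ) (dilate-· {5} φ Λ)))

opaque
  unfolding _·_

  Λ₀ : (κ (+ 6) · Λ) 0 ≡ 0ℤ
  Λ₀ = refl

  norm·φ₅₀ : (norm · φ₅) 0 ≡ (φ ↑ 6) 0
  norm·φ₅₀ = refl

  φ⁶₀ : (φ ↑ 6) 0 ≡ 1ℤ
  φ⁶₀ = refl

-- The logarithmic derivative on the left is U Λ + 5Λ(q⁵), which the Hecke relation turns into 6Λ,
-- that of φ⁶. Multiplying by φ₅ instead of dividing keeps both sides polynomial.
norm·φ₅≈φ⁶ : norm · φ₅ ≈ φ ↑ 6
norm·φ₅≈φ⁶ = logarithmic-unique (κ (+ 6) · Λ) Λ₀ Θ-norm·φ₅ Θ-φ⁶ norm·φ₅₀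
  where
  Θ-norm·φ₅ : Θ (norm · φ₅) ≈ (norm · φ₅) · (κ (+ 6) · Λ)
  Θ-norm·φ₅ = begin
    Θ (norm · φ₅)                      ≈⟨ Θ-· norm φ₅ ⟩
    Θ norm · φ₅ ⊞ norm · Θ φ₅
      ≈⟨ ⊞-cong (·-congʳ φ₅ (≈-trans Θ-norm (·-congˡ norm extract-Λ))) (·-congˡ norm Θ-φ₅) ⟩
    (norm · (κ (+ 6) · Λ ⊟ κ (+ 5) · dilate 5 Λ)) · φ₅ ⊞ norm · (κ (+ 5) · (φ₅ · dilate 5 Λ))
      ≈⟨ regroup norm φ₅ Λ (dilate 5 Λ) ⟩
    (norm · φ₅) · (κ (+ 6) · Λ)        ∎
    where
    regroup : ∀ n p l d → (n · (κ (+ 6) · l ⊟ κ (+ 5) · d)) · p ⊞ n · (κ (+ 5) · (p · d)) ≈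
      (n · p) · (κ (+ 6) · l)
    regroup = solve 4 (λ n p l d → (n :* (con (+ 6) :* l :- con (+ 5) :* d)) :* p
      :+ n :* (con (+ 5) :* (p :* d)) := (n :* p) :* (con (+ 6) :* l)) ≈-refl
  Θ-φ⁶ : Θ (φ ↑ 6) ≈ φ ↑ 6 · (κ (+ 6) · Λ)
  Θ-φ⁶ = begin
    Θ (φ ↑ 6)                          ≈⟨ Θ-↑ φ 5 ⟩
    κ (+ 6) · (φ ↑ 5 · Θ φ)            ≈⟨ ·-congˡ (κ (+ 6)) (·-congˡ (φ ↑ 5) Θ-φ) ⟩
    κ (+ 6) · (φ ↑ 5 · (φ · Λ))        ≈⟨ regroup φ (φ ↑ 5) Λ ⟩
    φ ↑ 6 · (κ (+ 6) · Λ)              ∎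
    where
    regroup : ∀ f p l → κ (+ 6) · (p · (f · l)) ≈ (f · p) · (κ (+ 6) · l)
    regroup = solve 3 (λ f p l → con (+ 6) :* (p :* (f :* l)) := (f :* p) :* (con (+ 6) :* l)) ≈-refl

-- Together with ā₅ these weight-two forms span a space stable under U: writing b and c for them, ā₅
-- ↦ 5ā₅ - 5b + c, b ↦ c and c ↦ 6c - 5b.
φ₅³φ φ₅φ³ : Series
φ₅³φ = φ₅ ↑ 3 · φ
φ₅φ³ = φ₅ · φ ↑ 3

ā₅·φ : ā₅ · φ ≈ φ₅ ↑ 5
ā₅·φ = coefficientwise λ n → trans (·-⊛ ā₅ φ n) (trans (ā₅-spec n) (at (^ˢ≈↑ φ₅ 5) n))

-- Since norm(q⁵) ā₅ = φ · cofactor · ā₅ = φ₅⁵ · cofactor, applying U and multiplying by φ₅ gives φ⁶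
-- U ā₅ = φ₅ φ⁵ · cofactor₀. Substituting w = φ² - φ₅² makes cofactor₀ equal to 5φ₅⁴ - 5φ₅²φ² + φ⁴,
-- and φ₅⁵ = ā₅ φ exposes the last factor φ to cancel.
extract-ā₅ : extract 5 ā₅ ≈ κ (+ 5) · ā₅ ⊟ κ (+ 5) · φ₅³φ ⊞ φ₅φ³
extract-ā₅ = ·-cancelˡ (φ ↑ 6) φ⁶₀ (begin
  φ ↑ 6 · extract 5 ā₅                   ≈⟨ ·-congʳ (extract 5 ā₅) norm·φ₅≈φ⁶ ⟨
  (norm · φ₅) · extract 5 ā₅                  ≈⟨ pull norm φ₅ (extract 5 ā₅) ⟩
  φ₅ · (norm · extract 5 ā₅)                  ≈⟨ ·-congˡ φ₅ (extract-· {5} norm ā₅) ⟨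
  φ₅ · extract 5 (dilate 5 norm · ā₅)         ≈⟨ ·-congˡ φ₅ (extract-cong 5 cleared) ⟩
  φ₅ · extract 5 (dilate 5 (φ ↑ 5) · cofactor)
    ≈⟨ ·-congˡ φ₅ (≈-trans (extract-· {5} (φ ↑ 5) cofactor) (·-congˡ (φ ↑ 5) extract-cofactor)) ⟩
  φ₅ · (φ ↑ 5 · cofactor₀)                        ≈⟨ ·-congˡ φ₅ (·-congˡ (φ ↑ 5) c-value) ⟩
  φ₅ · (φ ↑ 5 · (φ₅ ↑ 4 ⊟ κ (+ 3) · (φ₅ ↑ 2 · (φ · φ ⊟ φ₅ · φ₅)) ⊞ (φ · φ ⊟ φ₅ · φ₅) ↑ 2))
    ≈⟨ regroup φ₅ φ (φ ↑ 5) ⟩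
  φ ↑ 5 · (κ (+ 5) · φ₅ ↑ 5 ⊟ κ (+ 5) · (φ · (φ₅ ↑ 3 · φ)) ⊞ φ · (φ₅ · φ ↑ 3))
    ≈⟨ ·-congˡ (φ ↑ 5) (⊞-congʳ (φ · φ₅φ³) (⊞-congʳ (⊝ (κ (+ 5) · (φ · φ₅³φ))) (·-congˡ (κ (+ 5)) ā₅·φ))) ⟨
  φ ↑ 5 · (κ (+ 5) · (ā₅ · φ) ⊟ κ (+ 5) · (φ · φ₅³φ) ⊞ φ · φ₅φ³)
    ≈⟨ factor φ (φ ↑ 5) ā₅ φ₅³φ φ₅φ³ ⟩
  φ ↑ 6 · (κ (+ 5) · ā₅ ⊟ κ (+ 5) · φ₅³φ ⊞ φ₅φ³) ∎)
  where
  pull : ∀ n p e → (n · p) · e ≈ p · (n · e)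
  pull = solve 3 (λ n p e → (n :* p) :* e := p :* (n :* e)) ≈-refl
  factor : ∀ f p x b c → p · (κ (+ 5) · (x · f) ⊟ κ (+ 5) · (f · b) ⊞ f · c) ≈
    (f · p) · (κ (+ 5) · x ⊟ κ (+ 5) · b ⊞ c)
  factor = solve 5 (λ f p x b c → p :* (con (+ 5) :* (x :* f) :- con (+ 5) :* (f :* b) :+ f :* c) :=
    (f :* p) :* (con (+ 5) :* x :- con (+ 5) :* b :+ c)) ≈-refl
  c-value : cofactor₀ ≈ φ₅ ↑ 4 ⊟ κ (+ 3) · (φ₅ ↑ 2 · (φ · φ ⊟ φ₅ · φ₅)) ⊞ (φ · φ ⊟ φ₅ · φ₅) ↑ 2
  c-value = ⊞-cong (⊞-congˡ (φ₅ ↑ 4) (⊝-cong (·-congˡ (κ (+ 3)) (·-congˡ (φ₅ ↑ 2) w-value))))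
    (↑-cong 2 w-value)
  regroup : ∀ p f f⁵ → p · (f⁵ · (p ↑ 4 ⊟ κ (+ 3) · (p ↑ 2 · (f · f ⊟ p · p)) ⊞ (f · f ⊟ p · p) ↑ 2))
    ≈ f⁵ · (κ (+ 5) · p ↑ 5 ⊟ κ (+ 5) · (f · (p ↑ 3 · f)) ⊞ f · (p · f ↑ 3))
  regroup = solve 3 (λ p f f⁵ →
    p :* (f⁵ :* (p :^ 4 :- con (+ 3) :* (p :^ 2 :* (f :* f :- p :* p)) :+ (f :* f :- p :* p) :^ 2))
    := f⁵ :* (con (+ 5) :* p :^ 5 :- con (+ 5) :* (f :* (p :^ 3 :* f)) :+ f :* (p :* f :^ 3))) ≈-refl
  cleared : dilate 5 norm · ā₅ ≈ dilate 5 (φ ↑ 5) · cofactor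
  cleared = begin
    dilate 5 norm · ā₅             ≈⟨ ·-congʳ ā₅ (≈-trans Norm-factors Norm≈dilate) ⟨
    (φ · cofactor) · ā₅         ≈⟨ swap φ cofactor ā₅ ⟩
    (ā₅ · φ) · cofactor         ≈⟨ ·-congʳ cofactor ā₅·φ ⟩
    φ₅ ↑ 5 · cofactor           ≈⟨ ·-congʳ cofactor (dilate-↑ {5} φ 5) ⟨
    dilate 5 (φ ↑ 5) · cofactor ∎
    where
    swap : ∀ f c x → (f · c) · x ≈ (x · f) · c
    swap = solve 3 (λ f c x → (f :* c) :* x := (x :* f) :* c) ≈-refl

extract-φ₅³φ : extract 5 φ₅³φ ≈ φ₅φ³
extract-φ₅³φ = begin
  extract 5 (φ₅ ↑ 3 · φ)               ≈⟨ extract-cong 5 (·-congʳ φ (dilate-↑ {5} φ 3)) ⟨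
  extract 5 (dilate 5 (φ ↑ 3) · φ)    ≈⟨ extract-· {5} (φ ↑ 3) φ ⟩
  φ ↑ 3 · extract 5 φ                 ≈⟨ ·-congˡ (φ ↑ 3) φ-quintuple ⟩
  φ ↑ 3 · φ₅                           ≈⟨ coefficientwise (·-comm (φ ↑ 3) φ₅) ⟩
  φ₅ · φ ↑ 3                           ∎

extract-φ₅φ³ : extract 5 φ₅φ³ ≈ κ (+ 6) · φ₅φ³ ⊟ κ (+ 5) · φ₅³φ
extract-φ₅φ³ = begin
  extract 5 (φ₅ · φ ↑ 3)               ≈⟨ extract-· {5} φ (φ ↑ 3) ⟩
  φ · extract 5 (φ ↑ 3)               ≈⟨ ·-congˡ φ (extract-cong 5 (cube φ)) ⟩
  φ · extract 5 (φ · (φ · φ))          ≈⟨ ·-congˡ φ extract-φ³ ⟩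
  φ · (φ₅ · (φ₅ · φ₅) ⊞ κ (+ 6) · (φ₅ · w))
    ≈⟨ ·-congˡ φ (⊞-congˡ (φ₅ · (φ₅ · φ₅)) (·-congˡ (κ (+ 6)) (·-congˡ φ₅ w-value))) ⟩
  φ · (φ₅ · (φ₅ · φ₅) ⊞ κ (+ 6) · (φ₅ · (φ · φ ⊟ φ₅ · φ₅))) ≈⟨ regroup φ₅ φ ⟩
  κ (+ 6) · φ₅φ³ ⊟ κ (+ 5) · φ₅³φ            ∎
  where
  cube : ∀ f → f ↑ 3 ≈ f · (f · f)
  cube = solve 1 (λ f → f :^ 3 := f :* (f :* f)) ≈-refl
  regroup : ∀ p f → f · (p · (p · p) ⊞ κ (+ 6) · (p · (f · f ⊟ p · p))) ≈
    κ (+ 6) · (p · f ↑ 3) ⊟ κ (+ 5) · (p ↑ 3 · f)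
  regroup = solve 2 (λ p f → f :* (p :* (p :* p) :+ con (+ 6) :* (p :* (f :* f :- p :* p))) :=
    con (+ 6) :* (p :* f :^ 3) :- con (+ 5) :* (p :^ 3 :* f)) ≈-refl

recurrence : extract 5 (extract 5 ā₅) ≈ κ (+ 6) · extract 5 ā₅ ⊟ κ (+ 5) · ā₅
recurrence = begin
  extract 5 (extract 5 ā₅)                                         ≈⟨ extract-cong 5 extract-ā₅ ⟩
  extract 5 (κ (+ 5) · ā₅) ⊟ extract 5 (κ (+ 5) · φ₅³φ) ⊞ extract 5 φ₅φ³
    ≈⟨ ⊞-cong (⊞-cong (≈-trans (extract-κ· 5 (+ 5) ā₅) (·-congˡ (κ (+ 5)) extract-ā₅))
                      (⊝-cong (≈-trans (extract-κ· 5 (+ 5) φ₅³φ) (·-congˡ (κ (+ 5)) extract-φ₅³φ))))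
                        extract-φ₅φ³ ⟩
  κ (+ 5) · (κ (+ 5) · ā₅ ⊟ κ (+ 5) · φ₅³φ ⊞ φ₅φ³) ⊟ κ (+ 5) · φ₅φ³ ⊞ (κ (+ 6) · φ₅φ³ ⊟ κ (+ 5) · φ₅³φ)
    ≈⟨ regroup ā₅ φ₅³φ φ₅φ³ ⟩
  κ (+ 6) · (κ (+ 5) · ā₅ ⊟ κ (+ 5) · φ₅³φ ⊞ φ₅φ³) ⊟ κ (+ 5) · ā₅
    ≈⟨ ⊞-congʳ (⊝ (κ (+ 5) · ā₅)) (·-congˡ (κ (+ 6)) extract-ā₅) ⟨
  κ (+ 6) · extract 5 ā₅ ⊟ κ (+ 5) · ā₅                             ∎
  where
  regroup : ∀ x b c → κ (+ 5) · (κ (+ 5) · x ⊟ κ (+ 5) · b ⊞ c) ⊟ κ (+ 5) · c ⊞ (κ (+ 6) · c ⊟ κ (+ 5) · b)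
    ≈ κ (+ 6) · (κ (+ 5) · x ⊟ κ (+ 5) · b ⊞ c) ⊟ κ (+ 5) · x
  regroup = solve 3 (λ x b c → con (+ 5) :* (con (+ 5) :* x :- con (+ 5) :* b :+ c) :- con (+ 5) :* c
    :+ (con (+ 6) :* c :- con (+ 5) :* b)
    := con (+ 6) :* (con (+ 5) :* x :- con (+ 5) :* b :+ c) :- con (+ 5) :* x) ≈-refl

ā₅-recurrence : ∀ n → ā₅ (5 ℕ.* (5 ℕ.* n)) ≡ + 6 ℤ.* ā₅ (5 ℕ.* n) ℤ.- + 5 ℤ.* ā₅ n
ā₅-recurrence n = trans (at recurrence n) (cong₂ ℤ._-_ (κ-· (+ 6) (extract 5 ā₅) n) (κ-· (+ 5) ā₅ n))

-- The polynomial x² - 6x + 5 has roots 1 and 5. Accordingly, under n ↦ 5n the combination 5ā₅(n) -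
-- ā₅(5n) is unchanged and ā₅(5n) - ā₅(n) is multiplied by 5; the induction passes from n to 5n.
ā₅-power : ∀ k n → + 4 ℤ.* ā₅ (5 ^ k ℕ.* n) ≡ (+ 5 ℤ.* ā₅ n ℤ.- ā₅ (5 ℕ.* n))
  ℤ.+ + (5 ^ k) ℤ.* (ā₅ (5 ℕ.* n) ℤ.- ā₅ n)
ā₅-power zero n = trans (cong (λ m → + 4 ℤ.* ā₅ m) (ℕ.+-identityʳ n)) (lemma (ā₅ n) (ā₅ (5 ℕ.* n)))
  where
  lemma : ∀ x y → + 4 ℤ.* x ≡ (+ 5 ℤ.* x ℤ.- y) ℤ.+ 1ℤ ℤ.* (y ℤ.- x)
  lemma = solve-∀
ā₅-power (suc k) n = trans (cong (λ m → + 4 ℤ.* ā₅ m) reassociate) (trans (ā₅-power k (5 ℕ.* n))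
  (trans (cong (λ z → (+ 5 ℤ.* y ℤ.- z) ℤ.+ + (5 ^ k) ℤ.* (z ℤ.- y)) (ā₅-recurrence n))
  (trans (lemma x y (+ (5 ^ k))) (cong (λ p → (+ 5 ℤ.* x ℤ.- y) ℤ.+ p ℤ.* (y ℤ.- x))
    (sym (ℤ.pos-* 5 (5 ^ k)))))))
  where
  x = ā₅ n
  y = ā₅ (5 ℕ.* n)
  reassociate : 5 ℕ.* 5 ^ k ℕ.* n ≡ 5 ^ k ℕ.* (5 ℕ.* n)
  reassociate = trans (cong (ℕ._* n) (ℕ.*-comm 5 (5 ^ k))) (ℕ.*-assoc (5 ^ k) 5 n)
  lemma : ∀ x y p → (+ 5 ℤ.* y ℤ.- (+ 6 ℤ.* y ℤ.- + 5 ℤ.* x)) ℤ.+ p ℤ.* ((+ 6 ℤ.* y ℤ.- + 5 ℤ.* x) ℤ.- y)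
    ≡ (+ 5 ℤ.* x ℤ.- y) ℤ.+ (+ 5 ℤ.* p) ℤ.* (y ℤ.- x)
  lemma = solve-∀

ā₅-mod-5^k : ∀ k n → + 4 ℤ.* ā₅ (5 ^ k ℕ.* n) ≡ + 5 ℤ.* ā₅ n ℤ.- ā₅ (5 ℕ.* n) [mod 5 ^ k ]
ā₅-mod-5^k k n = divides (ā₅ (5 ℕ.* n) ℤ.- ā₅ n)
  (trans (cong (ℤ._- rhs) (ā₅-power k n)) (lemma rhs (ā₅ (5 ℕ.* n) ℤ.- ā₅ n) (+ (5 ^ k))))
  where
  rhs = + 5 ℤ.* ā₅ n ℤ.- ā₅ (5 ℕ.* n)
  lemma : ∀ r d p → r ℤ.+ p ℤ.* d ℤ.- r ≡ d ℤ.* p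
  lemma = solve-∀

-- Congruences of series

record Div (m : ℕ) (f : Series) : Set where
  constructor div
  field at-∣ : ∀ n → + m ℤ.∣ f n
open Div

module _ {m : ℕ} where

  Div-resp : ∀ {f g} → f ≈ g → Div m f → Div m g
  Div-resp eq (div d) = div λ n → subst (+ m ℤ.∣_) (at eq n) (d n)

  Div-⊞ : ∀ {f g} → Div m f → Div m g → Div m (f ⊞ g)
  Div-⊞ (div d) (div e) = div λ n → ℤ.∣m∣n⇒∣m+n (d n) (e n)

  Div-· : ∀ f {g} → Div m g → Div m (f · g)
  Div-· f {g} (div d) = Div-resp (≈-sym factored) (div λ n → subst (+ m ℤ.∣_) (sym (κ-· (+ m) (f · g′) n))
    (ℤ.∣m⇒∣m*n ((f · g′) n) ℤ.∣-refl))
    where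
    g′ : Series
    g′ n = ℤ._∣_.quotient (d n)
    g≈ : g ≈ κ (+ m) · g′
    g≈ = coefficientwise λ n → trans (ℤ._∣_.equality (d n))
      (trans (ℤ.*-comm (g′ n) (+ m)) (sym (κ-· (+ m) g′ n)))
    pull : ∀ f c g → f · (c · g) ≈ c · (f · g)
    pull = solve 3 (λ f c g → f :* (c :* g) := c :* (f :* g)) ≈-refl
    factored : f · g ≈ κ (+ m) · (f · g′)
    factored = ≈-trans (·-congˡ f g≈) (pull f (κ (+ m)) g′)

  Div-κ : ∀ f → Div m (κ (+ m) · f)
  Div-κ f = div λ n → subst (+ m ℤ.∣_) (sym (κ-· (+ m) f n)) (ℤ.∣m⇒∣m*n (f n) ℤ.∣-refl)

  Div-dilate : ∀ {k} .{{_ : NonZero k}} {f} → Div m f → Div m (dilate k f)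
  Div-dilate {k} {f} (div d) = div λ n → go n (k ∣? n)
    where
    go : ∀ n → Dec (k ∣ n) → + m ℤ.∣ dilate k f n
    go n (no ∤) = subst (+ m ℤ.∣_) (sym (dilate-∤ {k} f ∤)) (ℤ.∣ᵤ⇒∣ (divides 0 refl))
    go n (yes (divides q refl)) =
      subst (+ m ℤ.∣_) (sym (trans (cong (dilate k f) (ℕ.*-comm q k)) (dilate-* {k} f q))) (d q)

  Div-cancel : ∀ f {g} → f 0 ≡ 1ℤ → Div m (f · g) → Div m g
  Div-cancel f {g} f₀≡1 d = Div-resp recover (Div-· (1ˢ ⊘ f) d)
    where
    recover : (1ˢ ⊘ f) · (f · g) ≈ g
    recover = begin
      (1ˢ ⊘ f) · (f · g) ≈⟨ coefficientwise (·-assoc (1ˢ ⊘ f) f g) ⟨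
      ((1ˢ ⊘ f) · f) · g ≈⟨ ·-congʳ g (coefficientwise λ n → trans (·-⊛ (1ˢ ⊘ f) f n) (⊘-⊛ 1ˢ f f₀≡1 n)) ⟩
      1ˢ · g             ≈⟨ coefficientwise (·-identityˡ g) ⟩
      g                  ∎

q : Series
q 1 = 1ℤ
q _ = 0ℤ

opaque
  unfolding _·_

  q·-zero : ∀ f → (q · f) 0 ≡ 0ℤ
  q·-zero f = refl

  q·-suc : ∀ f n → (q · f) (suc n) ≡ f n
  q·-suc f n = trans (ℤ.+-identityˡ _) (trans (⊛-cong {shift q} {1ˢ} {f} {f} shift-q (λ _ → refl) n)
    (⊛-identityˡ f n))
    where
    shift-q : shift q ≗ 1ˢ
    shift-q zero    = refl
    shift-q (suc n) = refl

  φ₅⁵₀ : (φ₅ ↑ 5) 0 ≡ 1ℤ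
  φ₅⁵₀ = refl

shift-decompose : ∀ f → f ≈ κ (f 0) ⊞ q · shift f
shift-decompose f = coefficientwise λ
  { zero    → sym (trans (cong (ℤ._+_ (f 0)) (q·-zero (shift f))) (ℤ.+-identityʳ (f 0)))
  ; (suc n) → sym (trans (ℤ.+-identityˡ _) (q·-suc (shift f) n)) }

q⁵· : Series → Series
q⁵· f = q · (q · (q · (q · (q · f))))

q⁵·-5+ : ∀ f n → q⁵· f (5 ℕ.+ n) ≡ f n
q⁵·-5+ f n = trans (q·-suc _ (4 ℕ.+ n))
  (trans (q·-suc _ (3 ℕ.+ n)) (trans (q·-suc _ (2 ℕ.+ n)) (trans (q·-suc _ (1 ℕ.+ n)) (q·-suc f n))))

q⁵·-low : ∀ f n → n ℕ.< 5 → q⁵· f n ≡ 0ℤ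
q⁵·-low f 0 _ = q·-zero _
q⁵·-low f 1 _ = trans (q·-suc _ 0) (q·-zero _)
q⁵·-low f 2 _ = trans (q·-suc _ 1) (trans (q·-suc _ 0) (q·-zero _))
q⁵·-low f 3 _ = trans (q·-suc _ 2) (trans (q·-suc _ 1) (trans (q·-suc _ 0) (q·-zero _)))
q⁵·-low f 4 _ = trans (q·-suc _ 3)
  (trans (q·-suc _ 2) (trans (q·-suc _ 1) (trans (q·-suc _ 0) (q·-zero _))))
q⁵·-low f (suc (suc (suc (suc (suc _))))) (ℕ.s≤s (ℕ.s≤s (ℕ.s≤s (ℕ.s≤s (ℕ.s≤s ())))))

dilate-shift : ∀ f → dilate 5 f ≈ κ (f 0) ⊞ q⁵· (dilate 5 (shift f))
dilate-shift f = ≈-sym (dilate-unique {5} {g = κ (f 0) ⊞ q⁵· (dilate 5 (shift f))} multiple nonmultiple)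
  where
  g = dilate 5 (shift f)
  multiple : ∀ n → (κ (f 0) ⊞ q⁵· g) (5 ℕ.* n) ≡ f n
  multiple zero    = trans (cong (ℤ._+_ (f 0)) (q⁵·-low g 0 (ℕ.s≤s ℕ.z≤n))) (ℤ.+-identityʳ (f 0))
  multiple (suc n) = trans (cong (κ (f 0) ⊞ q⁵· g) (ℕ.*-suc 5 n))
    (trans (ℤ.+-identityˡ _) (trans (q⁵·-5+ g (5 ℕ.* n)) (dilate-* {5} (shift f) n)))
  low : ∀ n → suc n ℕ.< 5 → (κ (f 0) ⊞ q⁵· g) (suc n) ≡ 0ℤ
  low n n<5 = trans (ℤ.+-identityˡ _) (q⁵·-low g (suc n) n<5)
  nonmultiple : ∀ {n} → ¬ 5 ∣ n → (κ (f 0) ⊞ q⁵· g) n ≡ 0ℤ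
  nonmultiple {0} ∤ = contradiction (divides 0 refl) ∤
  nonmultiple {1} _ = low 0 (ℕ.s≤s (ℕ.s≤s ℕ.z≤n))
  nonmultiple {2} _ = low 1 (ℕ.s≤s (ℕ.s≤s (ℕ.s≤s ℕ.z≤n)))
  nonmultiple {3} _ = low 2 (ℕ.s≤s (ℕ.s≤s (ℕ.s≤s (ℕ.s≤s ℕ.z≤n))))
  nonmultiple {4} _ = low 3 (ℕ.s≤s (ℕ.s≤s (ℕ.s≤s (ℕ.s≤s (ℕ.s≤s ℕ.z≤n)))))
  nonmultiple {suc (suc (suc (suc (suc n))))} ∤ = trans (ℤ.+-identityˡ _) (trans (q⁵·-5+ g n)
    (dilate-∤ {5} (shift f) (λ 5∣n → ∤ (∣m∣n⇒∣m+n ∣-refl 5∣n))))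

fermat₅ : ∀ c → + 5 ℤ.∣ (c ℤ.* (c ℤ.* (c ℤ.* (c ℤ.* c))) ℤ.- c)
fermat₅ c = subst (λ c → + 5 ℤ.∣ (c ℤ.* (c ℤ.* (c ℤ.* (c ℤ.* c))) ℤ.- c)) (sym (a≡a%ℕn+[a/ℕn]*n c 5))
  (subst (+ 5 ℤ.∣_) (sym (expand (+ (c %ℕ 5)) (c /ℕ 5))) (ℤ.∣m∣n⇒∣m+n (cases (c %ℕ 5) (n%ℕd<d c 5))
    (ℤ.∣n⇒∣m*n (rest (+ (c %ℕ 5)) (c /ℕ 5)) ℤ.∣-refl)))
  where
  -- One fifth of the terms of (r + 5s)⁵ - (r + 5s) that contain s.
  rest : ℤ → ℤ → ℤ
  rest r s = + 5 ℤ.* (r ℤ.* r ℤ.* r ℤ.* r ℤ.* s) ℤ.+ + 50 ℤ.* (r ℤ.* r ℤ.* r ℤ.* s ℤ.* s)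
      ℤ.+ + 250 ℤ.* (r ℤ.* r ℤ.* s ℤ.* s ℤ.* s) ℤ.+ + 625 ℤ.* (r ℤ.* s ℤ.* s ℤ.* s ℤ.* s)
        ℤ.+ + 625 ℤ.* (s ℤ.* s ℤ.* s ℤ.* s ℤ.* s) ℤ.- s
  expand : ∀ r s → let c = r ℤ.+ s ℤ.* + 5 in c ℤ.* (c ℤ.* (c ℤ.* (c ℤ.* c))) ℤ.- c
    ≡ (r ℤ.* (r ℤ.* (r ℤ.* (r ℤ.* r))) ℤ.- r) ℤ.+ (+ 5 ℤ.* (r ℤ.* r ℤ.* r ℤ.* r ℤ.* s)
      ℤ.+ + 50 ℤ.* (r ℤ.* r ℤ.* r ℤ.* s ℤ.* s)
      ℤ.+ + 250 ℤ.* (r ℤ.* r ℤ.* s ℤ.* s ℤ.* s) ℤ.+ + 625 ℤ.* (r ℤ.* s ℤ.* s ℤ.* s ℤ.* s)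
        ℤ.+ + 625 ℤ.* (s ℤ.* s ℤ.* s ℤ.* s ℤ.* s) ℤ.- s) ℤ.* + 5
  expand = solve-∀
  cases : ∀ r → r ℕ.< 5 → + 5 ℤ.∣ (+ r ℤ.* (+ r ℤ.* (+ r ℤ.* (+ r ℤ.* + r))) ℤ.- + r)
  cases 0 _ = divides (+ 0) refl
  cases 1 _ = divides (+ 0) refl
  cases 2 _ = divides (+ 6) refl
  cases 3 _ = divides (+ 48) refl
  cases 4 _ = divides (+ 204) refl
  cases (suc (suc (suc (suc (suc _))))) (ℕ.s≤s (ℕ.s≤s (ℕ.s≤s (ℕ.s≤s (ℕ.s≤s ())))))

κ-fifth : ∀ c → κ c · (κ c · (κ c · (κ c · κ c))) ≈ κ (c ℤ.* (c ℤ.* (c ℤ.* (c ℤ.* c))))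
κ-fifth c = ≈-sym (step (≈-trans (κ-product _)
  (·-congˡ (κ c) (≈-trans (κ-product _) (·-congˡ (κ c) (κ-product c))))))
  where
  κ-product : ∀ d → κ (c ℤ.* d) ≈ κ c · κ d
  κ-product d = coefficientwise λ { zero → sym (κ-· c (κ d) 0) ; (suc n) →
    trans (sym (ℤ.*-zeroʳ c)) (sym (κ-· c (κ d) (suc n))) }
  step : ∀ {d f} → κ d ≈ f → κ (c ℤ.* d) ≈ κ c · f
  step {d} p = ≈-trans (κ-product d) (·-congˡ (κ c) p)

-- Write f = c + q f′ with constant c. Modulo 5, f⁵ is c + q⁵ f′⁵ by Fermat, while f(q⁵) = c + q⁵
-- f′(q⁵). Thus coefficient n + 5 of the difference for f reduces to coefficient n of that for f′.
frobenius : ∀ f → Div 5 (f ↑ 5 ⊟ dilate 5 f)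
frobenius f = div λ n → go n f
  where
  -- One fifth of the mixed binomial terms, whose coefficients are 5, 10, 10, 5.
  mixed : Series → Series → Series
  mixed c s = c · c · c · c · s ⊞ κ (+ 2) · (c · c · c · s · s) ⊞ κ (+ 2) · (c · c · s · s · s)
    ⊞ c · s · s · s · s
  binomial : ∀ c q g d → (c ⊞ q · g) ↑ 5 ⊟ (c ⊞ q · (q · (q · (q · (q · d))))) ≈
    ((c · (c · (c · (c · c))) ⊟ c) ⊞ q · (q · (q · (q · (q · (g ↑ 5 ⊟ d)))))) ⊞ κ (+ 5) ·
      (c · c · c · c · (q · g) ⊞ κ (+ 2) · (c · c · c · (q · g) · (q · g)) ⊞ κ
        (+ 2) · (c · c · (q · g) · (q · g) · (q · g)) ⊞ c · (q · g) · (q · g) · (q · g) · (q · g))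
  binomial = solve 4 (λ c q g d → (c :+ q :* g) :^ 5 :- (c :+ q :* (q :* (q :* (q :* (q :* d))))) :=
    ((c :* (c :* (c :* (c :* c))) :- c) :+ q :* (q :* (q :* (q :* (q :* (g :^ 5 :- d)))))) :+ con (+ 5) :*
      (c :* c :* c :* c :* (q :* g) :+ con (+ 2) :* (c :* c :* c :* (q :* g) :* (q :* g)) :+ con
        (+ 2) :* (c :* c :* (q :* g) :* (q :* g) :* (q :* g))
        :+ c :* (q :* g) :* (q :* g) :* (q :* g) :* (q :* g))) ≈-refl
  ↑-cong₅ : ∀ {f g} → f ≈ g → f ↑ 5 ≈ g ↑ 5
  ↑-cong₅ = ↑-cong 5
  D : Series → Series
  D f = f ↑ 5 ⊟ dilate 5 f
  decomposed : ∀ f → D f ≈ ((κ (f 0 ℤ.* (f 0 ℤ.* (f 0 ℤ.* (f 0 ℤ.* f 0)))) ⊟ κ (f 0)) ⊞ q⁵· (D (shift f)))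
    ⊞ κ (+ 5) · mixed (κ (f 0)) (q · shift f)
  decomposed f = begin
    f ↑ 5 ⊟ dilate 5 f
      ≈⟨ ⊞-cong (↑-cong₅ (shift-decompose f)) (⊝-cong (dilate-shift f)) ⟩
    (κ (f 0) ⊞ q · shift f) ↑ 5 ⊟ (κ (f 0) ⊞ q⁵· (dilate 5 (shift f)))
      ≈⟨ binomial (κ (f 0)) q (shift f) (dilate 5 (shift f)) ⟩
    ((κ (f 0) · (κ (f 0) · (κ (f 0) · (κ (f 0) · κ (f 0)))) ⊟ κ (f 0)) ⊞ q⁵· (D (shift f))) ⊞ κ
      (+ 5) · mixed (κ (f 0)) (q · shift f)
      ≈⟨ ⊞-congʳ (κ (+ 5) · mixed (κ (f 0)) (q · shift f))
        (⊞-congʳ (q⁵· (D (shift f))) (⊞-congʳ (⊝ κ (f 0)) (κ-fifth (f 0)))) ⟩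
    ((κ (f 0 ℤ.* (f 0 ℤ.* (f 0 ℤ.* (f 0 ℤ.* f 0)))) ⊟ κ (f 0)) ⊞ q⁵· (D (shift f))) ⊞ κ (+ 5) · mixed
      (κ (f 0)) (q · shift f) ∎
  5∣0 : + 5 ℤ.∣ 0ℤ
  5∣0 = divides 0ℤ refl
  constant : ∀ f n → + 5 ℤ.∣ (κ (f 0 ℤ.* (f 0 ℤ.* (f 0 ℤ.* (f 0 ℤ.* f 0)))) ⊟ κ (f 0)) n
  constant f zero    = fermat₅ (f 0)
  constant f (suc n) = 5∣0
  assemble : ∀ f n → + 5 ℤ.∣ q⁵· (D (shift f)) n → + 5 ℤ.∣ D f n
  assemble f n d = subst (+ 5 ℤ.∣_) (sym (at (decomposed f) n))
    (ℤ.∣m∣n⇒∣m+n (ℤ.∣m∣n⇒∣m+n (constant f n) d) (at-∣ (Div-κ {5} (mixed (κ (f 0)) (q · shift f))) n))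
  low : ∀ f n → n ℕ.< 5 → + 5 ℤ.∣ D f n
  low f n n<5 = assemble f n (subst (+ 5 ℤ.∣_) (sym (q⁵·-low (D (shift f)) n n<5)) 5∣0)
  go : ∀ n f → + 5 ℤ.∣ D f n
  go 0 f = low f 0 (ℕ.s≤s ℕ.z≤n)
  go 1 f = low f 1 (ℕ.s≤s (ℕ.s≤s ℕ.z≤n))
  go 2 f = low f 2 (ℕ.s≤s (ℕ.s≤s (ℕ.s≤s ℕ.z≤n)))
  go 3 f = low f 3 (ℕ.s≤s (ℕ.s≤s (ℕ.s≤s (ℕ.s≤s ℕ.z≤n))))
  go 4 f = low f 4 (ℕ.s≤s (ℕ.s≤s (ℕ.s≤s (ℕ.s≤s (ℕ.s≤s ℕ.z≤n)))))
  go (suc (suc (suc (suc (suc n))))) f =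
    assemble f (5 ℕ.+ n) (subst (+ 5 ℤ.∣_) (sym (q⁵·-5+ (D (shift f)) n)) (go n (shift f)))

-- Doubling formulas

sgn-double : ∀ n → sgn (2 ℕ.* n) ≡ 1ℤ
sgn-double n = trans (sgn-+ n (n ℕ.+ 0)) (trans (cong (λ m → sgn n ℤ.* sgn m) (ℕ.+-identityʳ n)) (sgn-sq n))

sgn-odd : ∀ n → ¬ 2 ∣ n → sgn n ≡ -1ℤ
sgn-odd n ∤ = [ (λ even → contradiction even ¬even) , id ]′ (sgn-cases n)
  where
  parity : ∀ n → sgn n ≡ 1ℤ → 2 ∣ n
  parity zero          _  = divides 0 refl
  parity (suc (suc n)) eq = ∣m∣n⇒∣m+n ∣-refl (parity n (trans (sym (sgn-suc-suc n)) eq))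
  ¬even : ¬ sgn n ≡ 1ℤ
  ¬even eq = ∤ (parity n eq)

τ-↑ : ∀ f k → τ (f ↑ k) ≈ τ f ↑ k
τ-↑ f zero    = coefficientwise λ { zero → refl ; (suc n) → ℤ.*-zeroʳ (sgn (suc n)) }
τ-↑ f (suc k) = ≈-trans (τ-· f (f ↑ k)) (·-congˡ (τ f) (τ-↑ f k))

g α β : Series
g = τ φ
α = residue 4 0 φ
β = residue 4 1 φ

-- Adding the twist doubles the even coefficients and kills the odd ones. By `φ²-double` the even
-- coefficients of φ² are those of its twist, which is g².
φ²+g² : φ · φ ⊞ g · g ≈ κ (+ 2) · dilate 2 (g · g)
φ²+g² = ≈-trans (≈-trans (⊞-congˡ (φ · φ) (≈-sym (τ-· φ φ))) (dilate-unique {2} double odd))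
  (dilate-κ· {2} (+ 2) (g · g))
  where
  double : ∀ n → (φ · φ ⊞ τ (φ · φ)) (2 ℕ.* n) ≡ (κ (+ 2) · (g · g)) n
  double n = trans (cong₂ (λ x s → x ℤ.+ s ℤ.* x) (φ²-double n) (sgn-double n)) (trans (lemma (τ (φ · φ) n))
    (trans (cong (+ 2 ℤ.*_) (at (τ-· φ φ) n)) (sym (κ-· (+ 2) (g · g) n))))
    where
    lemma : ∀ x → x ℤ.+ 1ℤ ℤ.* x ≡ + 2 ℤ.* x
    lemma = solve-∀
  odd : ∀ {n} → ¬ 2 ∣ n → (φ · φ ⊞ τ (φ · φ)) n ≡ 0ℤ
  odd {n} ∤ = trans (cong (λ s → (φ · φ) n ℤ.+ s ℤ.* (φ · φ) n) (sgn-odd n ∤)) (lemma ((φ · φ) n))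
    where
    lemma : ∀ x → x ℤ.+ -1ℤ ℤ.* x ≡ 0ℤ
    lemma = solve-∀

sgn-mod-4 : ∀ n → sgn n ≡ sgn (n % 4)
sgn-mod-4 n = trans (cong sgn (m≡m%n+[m/n]*n n 4)) (trans (sgn-+ (n % 4) (n / 4 ℕ.* 4))
  (trans (cong (sgn (n % 4) ℤ.*_) (quadruple (n / 4))) (ℤ.*-identityʳ (sgn (n % 4)))))
  where
  quadruple : ∀ k → sgn (k ℕ.* 4) ≡ 1ℤ
  quadruple zero    = refl
  quadruple (suc k) = trans (sgn-+ 4 (k ℕ.* 4)) (trans (ℤ.*-identityˡ _) (quadruple k))

Supp-α : Supp 4 0 α
Supp-α = Supp-residue 0 φ

Supp-β : Supp 4 1 β
Supp-β = Supp-residue 1 φ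

φ≈α+β : φ ≈ α ⊞ β
φ≈α+β = coefficientwise split
  where
  split : ∀ n → φ n ≡ (α ⊞ β) n
  split n with n % 4 ℕ.≟ 0 | n % 4 ℕ.≟ 1
  ... | yes n≡0 | _ = sym (trans
    (cong₂ ℤ._+_ (residue-eq φ n n≡0) (Supp-β n (λ eq → contradiction (trans (sym n≡0) eq) λ ())))
    (ℤ.+-identityʳ (φ n)))
  ... | no n≢0 | yes n≡1 = sym (trans (cong₂ ℤ._+_ (Supp-α n n≢0) (residue-eq φ n n≡1))
    (ℤ.+-identityˡ (φ n)))
  ... | no n≢0 | no n≢1 = trans (φ-mod-4 n n≢0 n≢1) (sym (cong₂ ℤ._+_ (Supp-α n n≢0) (Supp-β n n≢1)))

g≈α-β : g ≈ α ⊟ β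
g≈α-β = ≈-trans (τ-cong φ≈α+β) (coefficientwise λ n →
  trans (ℤ.*-distribˡ-+ (sgn n) (α n) (β n)) (cong₂ ℤ._+_ (even n) (odd n)))
  where
  even : ∀ n → sgn n ℤ.* α n ≡ α n
  even n with n % 4 ℕ.≟ 0
  ... | yes n≡0 = trans (cong (ℤ._* α n) (trans (sgn-mod-4 n) (cong sgn n≡0))) (ℤ.*-identityˡ (α n))
  ... | no n≢0  = trans (cong (sgn n ℤ.*_) (Supp-α n n≢0)) (trans (ℤ.*-zeroʳ (sgn n)) (sym (Supp-α n n≢0)))
  odd : ∀ n → sgn n ℤ.* β n ≡ ℤ.- β n
  odd n with n % 4 ℕ.≟ 1
  ... | yes n≡1 = trans (cong (ℤ._* β n) (trans (sgn-mod-4 n) (cong sgn n≡1))) (ℤ.-1*i≡-i (β n))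
  ... | no n≢1  = trans (cong (sgn n ℤ.*_) (Supp-β n n≢1))
    (trans (ℤ.*-zeroʳ (sgn n)) (sym (cong ℤ.-_ (Supp-β n n≢1))))

-- α² and β² are the parts of φ² with exponents 0 and 2 mod 4, and φ(q)φ(−q) = α² − β².
φg : φ · g ≈ dilate 2 (φ · φ)
φg = ≈-trans (≈-trans (*-cong φ≈α+β g≈α-β) (difference α β)) (dilate-unique {2} double odd)
  where
  difference : ∀ a b → (a ⊞ b) · (a ⊟ b) ≈ a · a ⊟ b · b
  difference = solve 2 (λ a b → (a :+ b) :* (a :- b) := a :* a :- b :* b) ≈-refl
  binomial : ∀ a b → (a ⊞ b) · (a ⊞ b) ≈ (a · a ⊞ b · b) ⊞ κ (+ 2) · (a · b)
  binomial = solve 2 (λ a b → (a :+ b) :* (a :+ b) := (a :* a :+ b :* b) :+ con (+ 2) :* (a :* b)) ≈-refl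
  φφ : φ · φ ≈ (α · α ⊞ β · β) ⊞ κ (+ 2) · (α · β)
  φφ = ≈-trans (*-cong φ≈α+β φ≈α+β) (binomial α β)
  αα : Supp 4 0 (α · α)
  αα = Supp-· refl Supp-α Supp-α
  ββ : Supp 4 2 (β · β)
  ββ = Supp-· refl Supp-β Supp-β
  αβ : Supp 4 1 (κ (+ 2) · (α · β))
  αβ = Supp-κ· (+ 2) (Supp-· refl Supp-α Supp-β)
  mod-2 : ∀ n → (n % 4) % 2 ≡ n % 2
  mod-2 n = m∣n⇒o%n%m≡o%m 2 4 n (divides 2 refl)
  odd : ∀ {n} → ¬ 2 ∣ n → (α · α ⊟ β · β) n ≡ 0ℤ
  odd {n} ∤ = cong₂ (λ x y → x ℤ.- y)
    (αα n (λ eq → ∤ (m%n≡0⇒n∣m n 2 (trans (sym (mod-2 n)) (cong (_% 2) eq)))))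
    (ββ n (λ eq → ∤ (m%n≡0⇒n∣m n 2 (trans (sym (mod-2 n)) (cong (_% 2) eq)))))
  cases : ∀ n → sgn n ≡ 1ℤ × (2 ℕ.* n) % 4 ≡ 0 ⊎ sgn n ≡ -1ℤ × (2 ℕ.* n) % 4 ≡ 2
  cases zero          = inj₁ (refl , refl)
  cases (suc zero)    = inj₂ (refl , refl)
  cases (suc (suc n)) = [ (λ (s , r) → inj₁ (trans (sgn-suc-suc n) s , trans (reduce n) r)) ,
                          (λ (s , r) → inj₂ (trans (sgn-suc-suc n) s , trans (reduce n) r)) ]′ (cases n)
    where
    reduce : ∀ n → (2 ℕ.* suc (suc n)) % 4 ≡ (2 ℕ.* n) % 4
    reduce n = trans (cong (_% 4) (trans (ℕ.*-distribˡ-+ 2 2 n) (ℕ.+-comm 4 (2 ℕ.* n))))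
      ([m+kn]%n≡m%n (2 ℕ.* n) 1 4)
  double : ∀ n → (α · α ⊟ β · β) (2 ℕ.* n) ≡ (φ · φ) n
  double n with cases n
  ... | inj₁ (s , r) = trans (cong (λ y → (α · α) (2 ℕ.* n) ℤ.- y) (ββ (2 ℕ.* n) r≢2))
    (trans (lemma ((α · α) (2 ℕ.* n)))
      (trans (sym φφ′) (trans (φ²-double n) (trans (cong (ℤ._* (φ · φ) n) s) (ℤ.*-identityˡ _)))))
    where
    r≢2 : (2 ℕ.* n) % 4 ≢ 2
    r≢2 eq = contradiction (trans (sym r) eq) λ ()
    lemma : ∀ x → x ℤ.- 0ℤ ≡ x ℤ.+ 0ℤ ℤ.+ 0ℤ
    lemma = solve-∀
    φφ′ : (φ · φ) (2 ℕ.* n) ≡ (α · α) (2 ℕ.* n) ℤ.+ 0ℤ ℤ.+ 0ℤ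
    φφ′ = trans (at φφ (2 ℕ.* n)) (cong₂ (λ y z → (α · α) (2 ℕ.* n) ℤ.+ y ℤ.+ z) (ββ (2 ℕ.* n) r≢2)
      (αβ (2 ℕ.* n) (λ eq → contradiction (trans (sym r) eq) λ ())))
  ... | inj₂ (s , r) = trans (cong (λ x → x ℤ.- (β · β) (2 ℕ.* n)) (αα (2 ℕ.* n) r≢0))
    (trans (lemma ((β · β) (2 ℕ.* n)))
      (trans (cong ℤ.-_ (trans (sym φφ′) (trans (φ²-double n) (cong (ℤ._* (φ · φ) n) s))))
      (negate ((φ · φ) n))))
    where
    r≢0 : (2 ℕ.* n) % 4 ≢ 0
    r≢0 eq = contradiction (trans (sym r) eq) λ ()
    lemma : ∀ y → 0ℤ ℤ.- y ≡ ℤ.- (0ℤ ℤ.+ y ℤ.+ 0ℤ)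
    lemma = solve-∀
    negate : ∀ x → ℤ.- (-1ℤ ℤ.* x) ≡ x
    negate = solve-∀
    φφ′ : (φ · φ) (2 ℕ.* n) ≡ 0ℤ ℤ.+ (β · β) (2 ℕ.* n) ℤ.+ 0ℤ
    φφ′ = trans (at φφ (2 ℕ.* n)) (cong₂ (λ x z → x ℤ.+ (β · β) (2 ℕ.* n) ℤ.+ z) (αα (2 ℕ.* n) r≢0)
      (αβ (2 ℕ.* n) (λ eq → contradiction (trans (sym r) eq) λ ())))

-- In Jacobi's notation X and Y are the fourth powers of θ₄ and θ₃, so `E` is the Eisenstein series
-- of weight 4 in q², namely 1 + 240 ∑ σ₃(n) q^(2n). This explains the congruence modulo 5; the
-- proof uses only the doubling formulas.
X Y E : Series
X = φ ↑ 4
Y = g ↑ 4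
E = X ↑ 2 ⊟ X · Y ⊞ Y ↑ 2

XY : X · Y ≈ dilate 2 (X ↑ 2)
XY = begin
  φ ↑ 4 · g ↑ 4             ≈⟨ regroup φ g ⟩
  (φ · g) ↑ 4               ≈⟨ ↑-cong 4 φg ⟩
  dilate 2 (φ · φ) ↑ 4      ≈⟨ dilate-↑ {2} (φ · φ) 4 ⟨
  dilate 2 ((φ · φ) ↑ 4)    ≈⟨ dilate-cong {2} (square-fourth φ) ⟩
  dilate 2 ((φ ↑ 4) ↑ 2)    ∎
  where
  regroup : ∀ f g → f ↑ 4 · g ↑ 4 ≈ (f · g) ↑ 4
  regroup = solve 2 (λ f g → f :^ 4 :* g :^ 4 := (f :* g) :^ 4) ≈-refl
  square-fourth : ∀ f → (f · f) ↑ 4 ≈ (f ↑ 4) ↑ 2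
  square-fourth = solve 1 (λ f → (f :* f) :^ 4 := (f :^ 4) :^ 2) ≈-refl

-- With `XY` this expresses both elementary symmetric functions of X and Y through X(q²) and Y(q²),
-- hence also every symmetric polynomial such as `E`.
X+Y : X ⊞ Y ≈ κ (+ 4) · dilate 2 Y ⊟ κ (+ 2) · dilate 2 X
X+Y = begin
  φ ↑ 4 ⊞ g ↑ 4 ≈⟨ square-sum φ g ⟩
  (φ · φ ⊞ g · g) ↑ 2 ⊟ κ (+ 2) · (φ · g) ↑ 2
    ≈⟨ ⊞-cong (↑-cong 2 φ²+g²) (⊝-cong (·-congˡ (κ (+ 2)) (↑-cong 2 φg))) ⟩
  (κ (+ 2) · dilate 2 (g · g)) ↑ 2 ⊟ κ (+ 2) · dilate 2 (φ · φ) ↑ 2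
    ≈⟨ expand (dilate 2 (g · g)) (dilate 2 (φ · φ)) ⟩
  κ (+ 4) · dilate 2 (g · g) ↑ 2 ⊟ κ (+ 2) · dilate 2 (φ · φ) ↑ 2
    ≈⟨ ⊞-cong (·-congˡ (κ (+ 4)) (fourth g)) (⊝-cong (·-congˡ (κ (+ 2)) (fourth φ))) ⟩
  κ (+ 4) · dilate 2 (g ↑ 4) ⊟ κ (+ 2) · dilate 2 (φ ↑ 4) ∎
  where
  square-sum : ∀ f g → f ↑ 4 ⊞ g ↑ 4 ≈ (f · f ⊞ g · g) ↑ 2 ⊟ κ (+ 2) · (f · g) ↑ 2
  square-sum = solve 2 (λ f g → f :^ 4 :+ g :^ 4 := (f :* f :+ g :* g) :^ 2 :- con (+ 2) :* (f :* g) :^ 2)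
    ≈-refl
  expand : ∀ x y → (κ (+ 2) · x) ↑ 2 ⊟ κ (+ 2) · y ↑ 2 ≈ κ (+ 4) · x ↑ 2 ⊟ κ (+ 2) · y ↑ 2
  expand = solve 2 (λ x y → (con (+ 2) :* x) :^ 2 :- con (+ 2) :* y :^ 2 :=
    con (+ 4) :* x :^ 2 :- con (+ 2) :* y :^ 2) ≈-refl
  fourth : ∀ f → dilate 2 (f · f) ↑ 2 ≈ dilate 2 (f ↑ 4)
  fourth f = ≈-trans (≈-sym (dilate-↑ {2} (f · f) 2)) (dilate-cong {2} (square-square f))
    where
    square-square : ∀ f → (f · f) ↑ 2 ≈ f ↑ 4
    square-square = solve 1 (λ f → (f :* f) :^ 2 := f :^ 4) ≈-refl

-- E(q) − E(q²) = 15 (Y(q²)² − X(q²) Y(q²)), so modulo 5 the coefficients of E at n and 2n agree.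
E-dilate : E ≈ dilate 2 E ⊞ κ (+ 5) · (κ (+ 3) · dilate 2 (Y ↑ 2 ⊟ X · Y))
E-dilate = begin
  X ↑ 2 ⊟ X · Y ⊞ Y ↑ 2 ≈⟨ square-sum X Y ⟩
  (X ⊞ Y) ↑ 2 ⊟ κ (+ 3) · (X · Y)
    ≈⟨ ⊞-cong (↑-cong 2 X+Y) (⊝-cong (·-congˡ (κ (+ 3)) (≈-trans XY (dilate-↑ {2} X 2)))) ⟩
  (κ (+ 4) · Y₂ ⊟ κ (+ 2) · X₂) ↑ 2 ⊟ κ (+ 3) · X₂ ↑ 2 ≈⟨ expand X₂ Y₂ ⟩
  (X₂ ↑ 2 ⊟ X₂ · Y₂ ⊞ Y₂ ↑ 2) ⊞ κ (+ 5) · (κ (+ 3) · (Y₂ ↑ 2 ⊟ X₂ · Y₂))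
    ≈⟨ ⊞-cong dilate-E (·-congˡ (κ (+ 5)) (·-congˡ (κ (+ 3)) dilate-R)) ⟨
  dilate 2 E ⊞ κ (+ 5) · (κ (+ 3) · dilate 2 (Y ↑ 2 ⊟ X · Y)) ∎
  where
  X₂ = dilate 2 X
  Y₂ = dilate 2 Y
  square-sum : ∀ x y → x ↑ 2 ⊟ x · y ⊞ y ↑ 2 ≈ (x ⊞ y) ↑ 2 ⊟ κ (+ 3) · (x · y)
  square-sum = solve 2 (λ x y → x :^ 2 :- x :* y :+ y :^ 2 := (x :+ y) :^ 2 :- con (+ 3) :* (x :* y)) ≈-refl
  expand : ∀ x y → (κ (+ 4) · y ⊟ κ (+ 2) · x) ↑ 2 ⊟ κ (+ 3) · x ↑ 2 ≈
    (x ↑ 2 ⊟ x · y ⊞ y ↑ 2) ⊞ κ (+ 5) · (κ (+ 3) · (y ↑ 2 ⊟ x · y))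
  expand = solve 2 (λ x y → (con (+ 4) :* y :- con (+ 2) :* x) :^ 2 :- con (+ 3) :* x :^ 2
    := (x :^ 2 :- x :* y :+ y :^ 2) :+ con (+ 5) :* (con (+ 3) :* (y :^ 2 :- x :* y))) ≈-refl
  dilate-⊟ : ∀ f g → dilate 2 (f ⊟ g) ≈ dilate 2 f ⊟ dilate 2 g
  dilate-⊟ f g = ≈-trans (dilate-⊞ {2} f (⊝ g)) (⊞-congˡ (dilate 2 f) (dilate-⊝ {2} g))
  dilate-R : dilate 2 (Y ↑ 2 ⊟ X · Y) ≈ Y₂ ↑ 2 ⊟ X₂ · Y₂
  dilate-R = ≈-trans (dilate-⊟ (Y ↑ 2) (X · Y)) (⊞-cong (dilate-↑ {2} Y 2) (⊝-cong (dilate-· {2} X Y)))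
  dilate-E : dilate 2 E ≈ X₂ ↑ 2 ⊟ X₂ · Y₂ ⊞ Y₂ ↑ 2
  dilate-E = ≈-trans (dilate-⊞ {2} (X ↑ 2 ⊟ X · Y) (Y ↑ 2)) (⊞-cong (≈-trans (dilate-⊟ (X ↑ 2) (X · Y))
    (⊞-cong (dilate-↑ {2} X 2) (⊝-cong (dilate-· {2} X Y)))) (dilate-↑ {2} Y 2))

opaque
  unfolding _·_

  E₀ : E 0 ≡ 1ℤ
  E₀ = refl

-- Modulo 5, `E` equals its own dilation by 2. A positive exponent can thus be halved until it is
-- odd, where the dilation has no term.
E≡1 : Div 5 (E ⊟ 1ˢ)
E≡1 = div (<-rec (λ n → + 5 ℤ.∣ (E ⊟ 1ˢ) n) step)
  where
  remainder = κ (+ 3) · dilate 2 (Y ↑ 2 ⊟ X · Y)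
  positive : ∀ n → + 5 ℤ.∣ dilate 2 E (suc n) → + 5 ℤ.∣ (E ⊟ 1ˢ) (suc n)
  positive n d = subst (+ 5 ℤ.∣_) (sym (trans (ℤ.+-identityʳ (E (suc n))) (at E-dilate (suc n))))
    (ℤ.∣m∣n⇒∣m+n d (at-∣ (Div-κ {5} remainder) (suc n)))
  step : ∀ n → (∀ {m} → m ℕ.< n → + 5 ℤ.∣ (E ⊟ 1ˢ) m) → + 5 ℤ.∣ (E ⊟ 1ˢ) n
  step zero    _   = divides 0ℤ (cong (ℤ._- 1ℤ) E₀)
  step (suc n) rec with 2 ∣? suc n
  ... | no ∤ = positive n (subst (+ 5 ℤ.∣_) (sym (dilate-∤ {2} E ∤)) (divides 0ℤ refl))
  ... | yes (divides (suc k) eq) =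
    positive n (subst (+ 5 ℤ.∣_)
    (sym (trans (cong (dilate 2 E) (trans eq (ℕ.*-comm (suc k) 2))) (dilate-* {2} E (suc k))))
    (subst (+ 5 ℤ.∣_) (ℤ.+-identityʳ (E (suc k)))
      (rec (subst (suc k ℕ.<_) (sym eq) (ℕ.m<m*n (suc k) 2 (ℕ.s≤s (ℕ.s≤s ℕ.z≤n)))))))

-- The congruences for ā₅ modulo 5 and modulo 2.

φ⁵≡φ₅ : Div 5 (φ ↑ 5 ⊟ φ₅)
φ⁵≡φ₅ = frobenius φ

-- After multiplication by φ₅⁵ = ā₅ φ, the difference becomes ā₅ (φ₅⁵ - φ²⁵), a difference of fifth
-- powers that contains the factor φ₅ - φ⁵.
ā₅≡X⁶ : Div 5 (ā₅ ⊟ X ↑ 6)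
ā₅≡X⁶ = Div-cancel (φ₅ ↑ 5) φ₅⁵₀ (Div-resp (≈-sym factored) (Div-· _ φ⁵≡φ₅))
  where
  distribute : ∀ p a x → p · (a ⊟ x) ≈ a · p ⊟ p · x
  distribute = solve 3 (λ p a x → p :* (a :- x) := a :* p :- p :* x) ≈-refl
  fifth-power : ∀ f → f · (f ↑ 4) ↑ 6 ≈ (f ↑ 5) ↑ 5
  fifth-power = solve 1 (λ f → f :* (f :^ 4) :^ 6 := (f :^ 5) :^ 5) ≈-refl
  reassociate : ∀ a f x → (a · f) · x ≈ a · (f · x)
  reassociate = solve 3 (λ a f x → (a :* f) :* x := a :* (f :* x)) ≈-refl
  difference : ∀ a p f → a · p ↑ 5 ⊟ a · f ↑ 5 ≈
    (⊝ (a · (p ↑ 4 ⊞ p ↑ 3 · f ⊞ p ↑ 2 · f ↑ 2 ⊞ p · f ↑ 3 ⊞ f ↑ 4))) · (f ⊟ p)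
  difference = solve 3 (λ a p f → a :* p :^ 5 :- a :* f :^ 5 :=
    (:- (a :* (p :^ 4 :+ p :^ 3 :* f :+ p :^ 2 :* f :^ 2 :+ p :* f :^ 3 :+ f :^ 4))) :* (f :- p)) ≈-refl
  factored : φ₅ ↑ 5 · (ā₅ ⊟ X ↑ 6) ≈
    (⊝ (ā₅ · (φ₅ ↑ 4 ⊞ φ₅ ↑ 3 · φ ↑ 5 ⊞ φ₅ ↑ 2 · (φ ↑ 5) ↑ 2 ⊞ φ₅ · (φ ↑ 5) ↑ 3 ⊞ (φ ↑ 5) ↑ 4))) · (φ ↑ 5
    ⊟ φ₅)
  factored = begin
    φ₅ ↑ 5 · (ā₅ ⊟ X ↑ 6)               ≈⟨ distribute (φ₅ ↑ 5) ā₅ (X ↑ 6) ⟩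
    ā₅ · φ₅ ↑ 5 ⊟ φ₅ ↑ 5 · X ↑ 6         ≈⟨ ⊞-congˡ (ā₅ · φ₅ ↑ 5) (⊝-cong (·-congʳ (X ↑ 6) ā₅·φ)) ⟨
    ā₅ · φ₅ ↑ 5 ⊟ (ā₅ · φ) · X ↑ 6      ≈⟨ ⊞-congˡ (ā₅ · φ₅ ↑ 5) (⊝-cong (reassociate ā₅ φ (X ↑ 6))) ⟩
    ā₅ · φ₅ ↑ 5 ⊟ ā₅ · (φ · X ↑ 6)      ≈⟨ ⊞-congˡ (ā₅ · φ₅ ↑ 5) (⊝-cong (·-congˡ ā₅ (fifth-power φ))) ⟩
    ā₅ · φ₅ ↑ 5 ⊟ ā₅ · (φ ↑ 5) ↑ 5      ≈⟨ difference ā₅ φ₅ (φ ↑ 5) ⟩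
    _                                  ∎

X⁴≡φ₅³φ : Div 5 (X ↑ 4 ⊟ φ₅ ↑ 3 · φ)
X⁴≡φ₅³φ = Div-resp (≈-sym (≈-trans (⊞-congʳ (⊝ (φ₅ ↑ 3 · φ)) (sixteenth φ)) (difference φ₅ φ (φ ↑ 5))))
  (Div-· _ φ⁵≡φ₅)
  where
  sixteenth : ∀ f → (f ↑ 4) ↑ 4 ≈ (f ↑ 5) ↑ 3 · f
  sixteenth = solve 1 (λ f → (f :^ 4) :^ 4 := (f :^ 5) :^ 3 :* f) ≈-refl
  difference : ∀ p f h → h ↑ 3 · f ⊟ p ↑ 3 · f ≈ (f · (h ↑ 2 ⊞ h · p ⊞ p ↑ 2)) · (h ⊟ p)
  difference = solve 3 (λ p f h → h :^ 3 :* f :- p :^ 3 :* f :=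
    (f :* (h :^ 2 :+ h :* p :+ p :^ 2)) :* (h :- p)) ≈-refl

-- Modulo 5, X⁴ = φ¹⁶ is a series in q⁵ times φ, and squares are never ±2 mod 5.
5∣X⁴ : ∀ m → m % 5 ≡ 2 ⊎ m % 5 ≡ 3 → + 5 ℤ.∣ (X ↑ 4) m
5∣X⁴ m r = subst (+ 5 ℤ.∣_) (trans (cong (λ z → (X ↑ 4) m ℤ.- z) vanish) (ℤ.+-identityʳ _)) (at-∣ X⁴≡φ₅³φ m)
  where
  distribute : ∀ p a u v → p · (a ⊞ u ⊞ v) ≈ p · a ⊞ p · u ⊞ p · v
  distribute = solve 4 (λ p a u v → p :* (a :+ u :+ v) := p :* a :+ p :* u :+ p :* v) ≈-refl
  Supp-φ₅³ : Supp 5 0 (φ₅ ↑ 3)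
  Supp-φ₅³ = Supp-resp (dilate-↑ {5} φ 3) (Supp-dilate (φ ↑ 3))
  avoid : ∀ {s} → s ≢ 2 → s ≢ 3 → m % 5 ≢ s
  avoid s≢2 s≢3 refl = [ s≢2 , s≢3 ]′ r
  vanish : (φ₅ ↑ 3 · φ) m ≡ 0ℤ
  vanish = trans (at (≈-trans (·-congˡ (φ₅ ↑ 3) φ-dissection) (distribute (φ₅ ↑ 3) a u v)) m)
    (cong₂ ℤ._+_ (cong₂ ℤ._+_ (Supp-· refl Supp-φ₅³ Supp-a m (avoid (λ ()) (λ ())))
      (Supp-· refl Supp-φ₅³ Supp-u m (avoid (λ ()) (λ ()))))
      (Supp-· refl Supp-φ₅³ Supp-v m (avoid (λ ()) (λ ()))))

E≡κ1 : Div 5 (E ⊟ κ 1ℤ)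
E≡κ1 = Div-resp (⊞-congˡ E (⊝-cong 1ˢ≈κ1)) E≡1

Y-power : ∀ k → Y ↑ k ≈ τ (X ↑ k)
Y-power k = ≈-sym (≈-trans (τ-↑ X k) (↑-cong k (τ-↑ φ 4)))

-- Put p = XY. From X² + Y² ≡ 1 + p one gets X⁶ + Y⁶ ≡ (1 + p)³ - 3p²(1 + p) = 1 + 3p - 2p³, and by
-- `XY` both p and p³ are dilations by 2.
sixth-powers : Div 5 (X ↑ 6 ⊞ Y ↑ 6 ⊟ (κ 1ℤ ⊞ κ (+ 3) · dilate 2 (X ↑ 2) ⊟ κ (+ 2) · dilate 2 (X ↑ 6)))
sixth-powers = Div-resp (≈-sym
  (≈-trans (⊞-congˡ (X ↑ 6 ⊞ Y ↑ 6) (⊝-cong (⊞-cong (⊞-congˡ (κ 1ℤ) (·-congˡ (κ (+ 3)) (≈-sym XY)))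
    (⊝-cong (·-congˡ (κ (+ 2)) cube))))) (factor X Y))) (Div-· _ E≡κ1)
  where
  cube : dilate 2 (X ↑ 6) ≈ (X · Y) ↑ 3
  cube = ≈-trans (dilate-cong {2} (square-cube X)) (≈-trans (dilate-↑ {2} (X ↑ 2) 3) (↑-cong 3 (≈-sym XY)))
    where
    square-cube : ∀ x → x ↑ 6 ≈ (x ↑ 2) ↑ 3
    square-cube = solve 1 (λ x → x :^ 6 := (x :^ 2) :^ 3) ≈-refl
  factor : ∀ x y → let e = x ↑ 2 ⊟ x · y ⊞ y ↑ 2 in
    x ↑ 6 ⊞ y ↑ 6 ⊟ (κ 1ℤ ⊞ κ (+ 3) · (x · y) ⊟ κ (+ 2) · (x · y) ↑ 3)
    ≈ (e ↑ 2 ⊞ e ⊞ κ 1ℤ ⊞ κ (+ 3) · (x · y) · (e ⊞ κ 1ℤ)) · (e ⊟ κ 1ℤ)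
  factor = solve 2 (λ x y → let e = x :^ 2 :- x :* y :+ y :^ 2 in
    x :^ 6 :+ y :^ 6 :- (con 1ℤ :+ con (+ 3) :* (x :* y) :- con (+ 2) :* (x :* y) :^ 3)
    := (e :^ 2 :+ e :+ con 1ℤ :+ con (+ 3) :* (x :* y) :* (e :+ con 1ℤ)) :* (e :- con 1ℤ)) ≈-refl

-- With D = X² - Y² and p = XY, the congruence for `E` gives X⁴ - Y⁴ ≡ D(1 + p) and X⁶ - Y⁶ ≡ D(1 +
-- 2p), so D + D(1 + 2p) = 2D(1 + p). Taking differences isolates odd exponents, where Y is minus X
-- in each power.
odd-parts : Div 5 ((X ↑ 2 ⊟ Y ↑ 2) ⊞ (X ↑ 6 ⊟ Y ↑ 6) ⊟ κ (+ 2) · (X ↑ 4 ⊟ Y ↑ 4))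
odd-parts = Div-resp (≈-sym (factor X Y)) (Div-· _ E≡κ1)
  where
  factor : ∀ x y → let e = x ↑ 2 ⊟ x · y ⊞ y ↑ 2 in
    (x ↑ 2 ⊟ y ↑ 2) ⊞ (x ↑ 6 ⊟ y ↑ 6) ⊟ κ (+ 2) · (x ↑ 4 ⊟ y ↑ 4)
    ≈ ((x ⊟ y) · (x ⊞ y) · (e ⊟ κ 1ℤ ⊞ κ (+ 2) · (x · y))) · (e ⊟ κ 1ℤ)
  factor = solve 2 (λ x y → let e = x :^ 2 :- x :* y :+ y :^ 2 in
    (x :^ 2 :- y :^ 2) :+ (x :^ 6 :- y :^ 6) :- con (+ 2) :* (x :^ 4 :- y :^ 4)
    := ((x :- y) :* (x :+ y) :* (e :- con 1ℤ :+ con (+ 2) :* (x :* y))) :* (e :- con 1ℤ)) ≈-refl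

5∣ā₅ : ∀ m → sgn (suc m) ≡ -1ℤ → suc m % 5 ≡ 2 ⊎ suc m % 5 ≡ 3 → + 5 ℤ.∣ ā₅ (2 ℕ.* suc m)
5∣ā₅ m′ odd r = subst (+ 5 ℤ.∣_) (sym (combine (ā₅ (2 ℕ.* m)) x₆′ x₂ x₆ x₄))
  (ℤ.∣m∣n⇒∣m+n (ℤ.∣m∣n⇒∣m+n (ℤ.∣m∣n⇒∣m+n (ℤ.∣m∣n⇒∣m+n
    (at-∣ ā₅≡X⁶ (2 ℕ.* m)) (ℤ.∣n⇒∣m*n (x₆′ ℤ.- + 2 ℤ.* x₂) ℤ.∣-refl)) (ℤ.∣n⇒∣m*n (ℤ.- + 2) even-part))
      (ℤ.∣n⇒∣m*n (+ 2) odd-part)) (ℤ.∣n⇒∣m*n (+ 8) (5∣X⁴ m r)))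
  where
  m = suc m′
  x₂ = (X ↑ 2) m
  x₄ = (X ↑ 4) m
  x₆ = (X ↑ 6) m
  x₆′ = (X ↑ 6) (2 ℕ.* m)
  -- The leading 0 is the coefficient of the constant 1 in `sixth-powers`, at the positive exponent
  -- 2m.
  even-part : + 5 ℤ.∣ (x₆′ ℤ.+ 1ℤ ℤ.* x₆′ ℤ.- (0ℤ ℤ.+ + 3 ℤ.* x₂ ℤ.- + 2 ℤ.* x₆))
  even-part = subst (+ 5 ℤ.∣_) (cong₂ (λ y z → x₆′ ℤ.+ y ℤ.- z)
      (trans (at (Y-power 6) (2 ℕ.* m)) (cong (ℤ._* x₆′) (sgn-double m)))
      (cong₂ (λ a b → 0ℤ ℤ.+ a ℤ.- b) (trans (κ-· (+ 3) (dilate 2 (X ↑ 2)) (2 ℕ.* m))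
        (cong (+ 3 ℤ.*_) (dilate-* {2} (X ↑ 2) m)))
        (trans (κ-· (+ 2) (dilate 2 (X ↑ 6)) (2 ℕ.* m)) (cong (+ 2 ℤ.*_) (dilate-* {2} (X ↑ 6) m)))))
    (at-∣ sixth-powers (2 ℕ.* m))
  negated : ∀ k → (Y ↑ k) m ≡ -1ℤ ℤ.* (X ↑ k) m
  negated k = trans (at (Y-power k) m) (cong (ℤ._* (X ↑ k) m) odd)
  odd-part : + 5 ℤ.∣ ((x₂ ℤ.- -1ℤ ℤ.* x₂) ℤ.+ (x₆ ℤ.- -1ℤ ℤ.* x₆) ℤ.- + 2 ℤ.* (x₄ ℤ.- -1ℤ ℤ.* x₄))
  odd-part = subst (+ 5 ℤ.∣_)
    (cong₂ ℤ._-_ (cong₂ (λ y z → (x₂ ℤ.- y) ℤ.+ (x₆ ℤ.- z)) (negated 2) (negated 6))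
      (trans (κ-· (+ 2) (X ↑ 4 ⊟ Y ↑ 4) m) (cong (λ y → + 2 ℤ.* (x₄ ℤ.- y)) (negated 4))))
    (at-∣ odd-parts m)
  -- The weight -2 inverts 2 modulo 5 and so solves the even relation for x₆′, up to the multiple of
  -- 5 written first. Adding twice the odd relation then cancels x₂ and x₆, leaving 8x₄.
  combine : ∀ a x₆′ x₂ x₆ x₄ → a ≡ a ℤ.- x₆′ ℤ.+ (x₆′ ℤ.- + 2 ℤ.* x₂) ℤ.* + 5
    ℤ.+ (ℤ.- + 2) ℤ.* (x₆′ ℤ.+ 1ℤ ℤ.* x₆′ ℤ.- (0ℤ ℤ.+ + 3 ℤ.* x₂ ℤ.- + 2 ℤ.* x₆))
    ℤ.+ + 2 ℤ.* ((x₂ ℤ.- -1ℤ ℤ.* x₂) ℤ.+ (x₆ ℤ.- -1ℤ ℤ.* x₆) ℤ.- + 2 ℤ.* (x₄ ℤ.- -1ℤ ℤ.* x₄)) ℤ.+ + 8 ℤ.* x₄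
  combine = solve-∀

-- By φ₅⁵ = ā₅ φ, the series ā₅ - 1 equals (φ₅⁵ - 1) - ā₅ (φ - 1), and φ and φ₅ are both 1 modulo 2.
2∣ā₅ : ∀ n → + 2 ℤ.∣ ā₅ (suc n)
2∣ā₅ n = subst (+ 2 ℤ.∣_) (ℤ.+-identityʳ (ā₅ (suc n))) (at-∣ ā₅≡1 (suc n))
  where
  φ≡1 : Div 2 (φ ⊟ κ 1ℤ)
  φ≡1 = div λ { zero → divides 0ℤ refl ; (suc n) → subst (+ 2 ℤ.∣_) (sym (ℤ.+-identityʳ (φ (suc n))))
    (φ-even n) }
  φ₅≡1 : Div 2 (φ₅ ⊟ κ 1ℤ)
  φ₅≡1 = Div-resp (≈-trans (dilate-⊞ {5} φ (⊝ κ 1ℤ))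
    (⊞-congˡ φ₅ (≈-trans (dilate-⊝ {5} (κ 1ℤ)) (⊝-cong (dilate-κ {5} 1ℤ))))) (Div-dilate {2} {5} φ≡1)
  factor₁ : ∀ a f → a · f ⊟ a · (f ⊟ κ 1ℤ) ⊟ κ 1ℤ ≈ a ⊟ κ 1ℤ
  factor₁ = solve 2 (λ a f → a :* f :- a :* (f :- con 1ℤ) :- con 1ℤ := a :- con 1ℤ) ≈-refl
  factor₂ : ∀ p d → p ↑ 5 ⊟ d ⊟ κ 1ℤ ≈ (p ↑ 4 ⊞ p ↑ 3 ⊞ p ↑ 2 ⊞ p ⊞ κ 1ℤ) · (p ⊟ κ 1ℤ) ⊟ d
  factor₂ = solve 2 (λ p d → p :^ 5 :- d :- con 1ℤ :=
    (p :^ 4 :+ p :^ 3 :+ p :^ 2 :+ p :+ con 1ℤ) :* (p :- con 1ℤ) :- d) ≈-refl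
  negate : ∀ a f → (⊝ a) · f ≈ ⊝ (a · f)
  negate = solve 2 (λ a f → (:- a) :* f := :- (a :* f)) ≈-refl
  ā₅≡1 : Div 2 (ā₅ ⊟ κ 1ℤ)
  ā₅≡1 = Div-resp (begin
    (φ₅ ↑ 4 ⊞ φ₅ ↑ 3 ⊞ φ₅ ↑ 2 ⊞ φ₅ ⊞ κ 1ℤ) · (φ₅ ⊟ κ 1ℤ) ⊟ ā₅ · (φ ⊟ κ 1ℤ) ≈⟨ factor₂ φ₅ (ā₅ · (φ ⊟ κ 1ℤ)) ⟨
    φ₅ ↑ 5 ⊟ ā₅ · (φ ⊟ κ 1ℤ) ⊟ κ 1ℤ   ≈⟨ ⊞-congʳ (⊝ κ 1ℤ) (⊞-congʳ (⊝ (ā₅ · (φ ⊟ κ 1ℤ))) ā₅·φ) ⟨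
    ā₅ · φ ⊟ ā₅ · (φ ⊟ κ 1ℤ) ⊟ κ 1ℤ  ≈⟨ factor₁ ā₅ φ ⟩
    ā₅ ⊟ κ 1ℤ                        ∎)
    (Div-⊞ (Div-· _ φ₅≡1) (Div-resp (negate ā₅ (φ ⊟ κ 1ℤ)) (Div-· (⊝ ā₅) φ≡1)))

10∣ : ∀ x → + 2 ℤ.∣ x → + 5 ℤ.∣ x → x ≡ 0ℤ [mod 10 ]
-- The witness comes from x = 5x - 4x with x = 2p in the first term and x = 5q in the second.
10∣ x (divides p x≡2p) (divides q x≡5q) = divides (p ℤ.- + 2 ℤ.* q) (trans (split x)
  (trans (cong₂ (λ y z → + 5 ℤ.* y ℤ.- + 4 ℤ.* z) x≡2p x≡5q) (lemma p q)))
  where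
  split : ∀ x → x ℤ.- 0ℤ ≡ + 5 ℤ.* x ℤ.- + 4 ℤ.* x
  split = solve-∀
  lemma : ∀ p q → + 5 ℤ.* (p ℤ.* + 2) ℤ.- + 4 ℤ.* (q ℤ.* + 5) ≡ (p ℤ.- + 2 ℤ.* q) ℤ.* + 10
  lemma = solve-∀

-- The index is twice 10n + r + 1, and 10n changes neither the parity nor the residue modulo 5 of r
-- + 1.
10∣ā₅ : ∀ r n → sgn (suc r) ≡ -1ℤ → suc r % 5 ≡ 2 ⊎ suc r % 5 ≡ 3 → ā₅ (20 ℕ.* n ℕ.+ 2 ℕ.* suc r) ≡
  0ℤ [mod 10 ]
10∣ā₅ r n odd res = 10∣ (ā₅ (20 ℕ.* n ℕ.+ 2 ℕ.* suc r))
  (subst (λ k → + 2 ℤ.∣ ā₅ k) (sym (index n r)) (2∣ā₅ (m ℕ.+ suc (m ℕ.+ 0))))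
  (subst (λ k → + 5 ℤ.∣ ā₅ k) (sym (index n r))
    (5∣ā₅ m odd′ (subst (λ k → k ≡ 2 ⊎ k ≡ 3) (sym residue′) res)))
  where
  m = 10 ℕ.* n ℕ.+ r
  index : ∀ n r → 20 ℕ.* n ℕ.+ 2 ℕ.* suc r ≡ 2 ℕ.* suc (10 ℕ.* n ℕ.+ r)
  index = ℕ.solve-∀
  shape₁ : ∀ n r → suc (10 ℕ.* n ℕ.+ r) ≡ 2 ℕ.* (5 ℕ.* n) ℕ.+ suc r
  shape₁ = ℕ.solve-∀
  shape₂ : ∀ n r → suc (10 ℕ.* n ℕ.+ r) ≡ suc r ℕ.+ 2 ℕ.* n ℕ.* 5
  shape₂ = ℕ.solve-∀
  odd′ : sgn (suc m) ≡ -1ℤ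
  odd′ = trans (cong sgn (shape₁ n r)) (trans (sgn-+ (2 ℕ.* (5 ℕ.* n)) (suc r))
    (cong₂ ℤ._*_ (sgn-double (5 ℕ.* n)) odd))
  residue′ : suc m % 5 ≡ suc r % 5
  residue′ = trans (cong (_% 5) (shape₂ n r)) ([m+kn]%n≡m%n (suc r) (2 ℕ.* n) 5)

corollary3 : (n k : ℕ) → 2 ≤ k →
    (ā₅ (20 * n + 6) ≡ 0ℤ [mod 10 ]) ×
    (ā₅ (20 * n + 14) ≡ 0ℤ [mod 10 ]) ×
    (+ 4 ℤ.* ā₅ (5 ^ k * n) ≡ + 5 ℤ.* ā₅ n ℤ.- ā₅ (5 * n) [mod 5 ^ k ])
-- Here 6 = 2 · 3 and 14 = 2 · 7, where 3 and 7 are odd and congruent to 3 and 2 modulo 5.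
corollary3 n k _ = 10∣ā₅ 2 n refl (inj₂ refl) , 10∣ā₅ 6 n refl (inj₁ refl) , ā₅-mod-5^k k n
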